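{- For all $n$, $B_n(132,312)$ and $\widetilde B_n(123)$ are Gorenstein.
   Context: $M_\sigma$ is the permutation matrix of $\sigma$. $B_n(132,312)$ is the convex hull of $M_\sigma$ over $\sigma\in\mathfrak S_n$ avoiding $132$ and $312$; $\widetilde B_n(123)$ is the convex hull of $M_\sigma$ over alternating ($a_1<a_2>a_3<\cdots$) $123$-avoiding $\sigma=a_1\cdots a_n\in\mathfrak S_n$. Polytopes are regarded as lattice polytopes in their affine span with lattice $(\mathrm{aff}\,P)\cap\mathbb Z^{n\times n}$. A lattice polytope containing the origin in its interior is reflexive if its polar dual $\{x : x^Ty\le 1\ \forall y\in P\}$ is a lattice polytope; lattice translates of reflexive polytopes are also called reflexive. A lattice polytope $P$ is Gorenstein if $kP$ is reflexive for some positive integer $k$. -}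

module Defs where

open import Level using (0ℓ)
open import Data.Nat as ℕ using (ℕ; zero; suc; _%_)
open import Data.Integer using (ℤ)
open import Data.Rational using (ℚ; 0ℚ; 1ℚ; _+_; _*_; _≤_; _<_; _/_)
open import Data.Fin using (Fin; toℕ)
import Data.Fin as F
open import Data.Fin.Permutation using (Permutation′; _⟨$⟩ʳ_)
open import Data.Product using (Σ; ∃; _×_; _,_; proj₁; proj₂)
open import Data.List using (List; []; _∷_; map)
open import Data.List.Relation.Unary.All using (All)
open import Relation.Binary.PropositionalEquality using (_≡_)
open import Function.Bundles using (_⇔_)
import Data.Integer
import Data.Rational
import Data.List.Membership.Propositional
import Data.Empty
import Relation.Nullary

Point : Set → Set
Point I = I → ℚ

Region : Set → Set₁
Region I = Point I → Set

ℤ→ℚ : ℤ → ℚ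
ℤ→ℚ z = z / 1

IsIntegral : ℚ → Set
IsIntegral q = ∃ λ (z : ℤ) → q ≡ ℤ→ℚ z

IsLatticePoint : {I : Set} → Point I → Set
IsLatticePoint {I} x = ∀ i → IsIntegral (x i)

_≐_ : {I : Set} → Point I → Point I → Set
x ≐ y = ∀ i → x i ≡ y i

zeroP : {I : Set} → Point I
zeroP _ = 0ℚ

combo : {I : Set} → List (ℚ × Point I) → Point I
combo [] = zeroP
combo ((l , v) ∷ ws) i = l * v i + combo ws i

weightSum : {I : Set} → List (ℚ × Point I) → ℚ
weightSum [] = 0ℚ
weightSum ((l , _) ∷ ws) = l + weightSum ws

Conv : {I : Set} → Region I → Region I
Conv S x = ∃ λ ws →
  All (λ w → 0ℚ ≤ proj₁ w) ws × All (λ w → S (proj₂ w)) ws ×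
  weightSum ws ≡ 1ℚ × x ≐ combo ws

Aff : {I : Set} → Region I → Region I
Aff S x = ∃ λ ws →
  All (λ w → S (proj₂ w)) ws × weightSum ws ≡ 1ℚ × x ≐ combo ws

Dilate : {I : Set} → ℕ → Region I → Region I
Dilate k P y = ∃ λ x → P x × y ≐ (λ i → ℤ→ℚ (Data.Integer.+ k) * x i)

Vecℚ : ℕ → Set
Vecℚ d = Fin d → ℚ

sumFin : (d : ℕ) → (Fin d → ℚ) → ℚ
sumFin zero f = 0ℚ
sumFin (suc d) f = f F.zero + sumFin d (λ j → f (F.suc j))

dot : {d : ℕ} → Vecℚ d → Vecℚ d → ℚ
dot {d} x y = sumFin d (λ j → x j * y j)

record AffMap (d : ℕ) (I : Set) : Set where
  field
    base : I → ℤ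
    cols : Fin d → I → ℤ

apply : {d : ℕ} {I : Set} → AffMap d I → Vecℚ d → Point I
apply {d} φ x i = ℤ→ℚ (AffMap.base φ i) + sumFin d (λ j → x j * ℤ→ℚ (AffMap.cols φ j i))

-- φ is an affine lattice isomorphism from (ℚ^d, ℤ^d) onto
-- (aff P, aff P ∩ ℤ^I)
IsLatticeChart : {d : ℕ} {I : Set} → AffMap d I → Region I → Set
IsLatticeChart {d} φ P =
  (∀ x y → apply φ x ≐ apply φ y → ∀ j → x j ≡ y j) ×
  (∀ x → Aff P (apply φ x)) ×
  (∀ y → Aff P y → ∃ λ x → apply φ x ≐ y) ×
  (∀ x → IsLatticePoint (apply φ x) → IsLatticePoint x)

IsReflexiveFD : (d : ℕ) → Region (Fin d) → Set
IsReflexiveFD d Q =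
  (∃ λ (ε : ℚ) → 0ℚ < ε × (∀ x → (∀ j → Data.Rational.∣ x j ∣ ≤ ε) → Q x)) ×
  (∃ λ (W : List (Vecℚ d)) → All IsLatticePoint W ×
     (∀ x → (∀ y → Q y → dot x y ≤ 1ℚ) ⇔ Conv (λ v → Data.List.Membership.Propositional._∈_ v W) x))

-- P (a lattice polytope in ℚ^I) is reflexive, regarded in its affine span
-- with the lattice aff P ∩ ℤ^I (lattice translates included)
IsReflexive : {I : Set} → Region I → Set
IsReflexive {I} P = ∃ λ (d : ℕ) → Σ (AffMap d I) λ φ →
  IsLatticeChart φ P × IsReflexiveFD d (λ x → P (apply φ x))

IsGorenstein : {I : Set} → Region I → Set
IsGorenstein P = ∃ λ (k : ℕ) → 1 ℕ.≤ k × IsReflexive (Dilate k P)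

Matrix : ℕ → Set
Matrix n = Fin n × Fin n

val : {n : ℕ} → Permutation′ n → Fin n → ℕ
val σ i = toℕ (σ ⟨$⟩ʳ i)

permMatrix : {n : ℕ} → Permutation′ n → Point (Matrix n)
permMatrix σ (i , j) with σ ⟨$⟩ʳ i F.≟ j
... | Relation.Nullary.yes _ = 1ℚ
... | Relation.Nullary.no _ = 0ℚ

Contains132 Contains312 Contains123 : {n : ℕ} → Permutation′ n → Set
Contains132 σ = ∃ λ i → ∃ λ j → ∃ λ k → i F.< j × j F.< k ×
  (val σ i ℕ.< val σ k × val σ k ℕ.< val σ j)
Contains312 σ = ∃ λ i → ∃ λ j → ∃ λ k → i F.< j × j F.< k ×
  (val σ j ℕ.< val σ k × val σ k ℕ.< val σ i)
Contains123 σ = ∃ λ i → ∃ λ j → ∃ λ k → i F.< j × j F.< k ×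
  (val σ i ℕ.< val σ j × val σ j ℕ.< val σ k)

-- alternating a₁ < a₂ > a₃ < ⋯  (positions 1-based; with 0-based index i,
-- an ascent follows position i when i is even, a descent when i is odd)
Alternating : {n : ℕ} → Permutation′ n → Set
Alternating σ = ∀ i j → toℕ j ≡ suc (toℕ i) →
  (toℕ i % 2 ≡ 0 → val σ i ℕ.< val σ j) ×
  (toℕ i % 2 ≡ 1 → val σ j ℕ.< val σ i)

Vert-132-312 : (n : ℕ) → Region (Matrix n)
Vert-132-312 n M = ∃ λ (σ : Permutation′ n) →
  (Contains132 σ → Data.Empty.⊥) × (Contains312 σ → Data.Empty.⊥) × M ≐ permMatrix σ

Vert-alt-123 : (n : ℕ) → Region (Matrix n)
Vert-alt-123 n M = ∃ λ (σ : Permutation′ n) →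
  Alternating σ × (Contains123 σ → Data.Empty.⊥) × M ≐ permMatrix σ

B-132-312 : (n : ℕ) → Region (Matrix n)
B-132-312 n = Conv (Vert-132-312 n)

B̃-123 : (n : ℕ) → Region (Matrix n)
B̃-123 n = Conv (Vert-alt-123 n)

{-# OPTIONS --safe #-}
-- Reading a permutation of either class from one end (positions from right to left for the first,
-- values from top to bottom for the second) interleaves two chains, one low and one high.  The
-- permutation is thus a lattice path t ↦ b t, and the entries of its matrix are differences of
-- truth values of statements c < b t.  In these coordinates the polytope is the order polytope of
-- a poset graded by the ranks 1, …, k − 1, with every minimal element at rank 1 and every maximal
-- one at rank k − 1.  Its k-th dilate, translated so that the rank function becomes the origin, is
-- cut out by the inequalities w · x ≤ 1 with w one of − e_j (j minimal), e_j (j maximal), e_i − e_j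
-- (i covered by j).  A point satisfying them is a combination of indicators of filters, by cutting
-- it into level sets, and Farkas' lemma identifies the polar with the convex hull of 0 and these
-- lattice vectors w.
module Submission where

open import Defs
open import Data.Nat using (ℕ)
open import Data.Product using (_×_)

-- The statements c < b t imply one another in two ways: b never decreases, and it grows by at most
-- 1 per step. The poset consists of the statements that are not decided in advance, and these two
-- implications are its covers, so that its filters correspond to the admissible paths. Each cover
-- changes t - 2c by exactly 1, which is why the poset is graded; the rank function then has lattice
-- distance 1 from every facet of the k-th dilate. Here k is 2n - 2 for the first polytope (n at
-- least 2) and ⌈n/2⌉ for the second (n at least 1). Two obstacles shape the proof. The lattice is
-- that of the affine span inside all matrices, so every coordinate of the order polytope has to be
-- recovered from matrix entries by additions and subtractions alone. And in the first class a value
-- lies on both chains, so that an entry mixes a low and a high statement, and the last letter can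
-- be read either way; statements about the time after it are therefore kept out of the poset.

module OrderPolytope where

  open import Data.Bool using (Bool; true; false; if_then_else_; T)
  open import Data.Empty using (⊥-elim)
  open import Data.Fin as F using (Fin)
  import Data.Fin.Properties as F
  open import Data.Integer as ℤ using (ℤ)
  import Data.Integer.Properties as ℤ
  open import Data.List using (List; []; _∷_; map; length; _++_; filter; allFin; cartesianProduct; tabulate)
  open import Data.List.Membership.Propositional using (_∈_)
  open import Data.List.Membership.Propositional.Properties
  open import Data.List.Properties using (length-map)
  open import Data.List.Relation.Binary.Permutation.Propositional using (↭-sym)
  open import Data.List.Relation.Binary.Permutation.Propositional.Properties using (All-resp-↭; ∈-resp-↭)
  open import Data.List.Relation.Unary.All as All using (All; []; _∷_)
  import Data.List.Relation.Unary.All.Properties as All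
  open import Data.List.Relation.Unary.Any using (here; there)
  open import Data.List.Relation.Unary.Linked using (Linked; []; [-]; _∷_)
  import Data.List.Sort
  open import Data.Nat as ℕ using (zero; suc)
  import Data.Nat.Properties as ℕ
  open import Data.Product using (∃; _,_; proj₁; proj₂; uncurry)
  open import Data.Rational hiding (floor)
  open import Data.Rational.Properties
  import Data.Rational.Unnormalised as ℚᵘ
  import Data.Rational.Unnormalised.Properties as ℚᵘ
  open import Data.Sum using (_⊎_; inj₁; inj₂)
  open import Function using (_∘_)
  open import Function.Bundles using (mk⇔)
  open import Level using (0ℓ)
  open import Relation.Binary.Definitions using (tri<; tri≈; tri>)
  open import Relation.Binary.PropositionalEquality
  open import Relation.Nullary using (¬_; Dec; yes; no; does; contradiction)
  open import Relation.Nullary.Decidable using (dec⇒maybe; ⌊_⌋; toWitness; fromWitness)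
  open import Tactic.RingSolver using (solve-∀)
  open import Tactic.RingSolver.Core.AlmostCommutativeRing using (AlmostCommutativeRing; fromCommutativeRing)

  -- Farkas' lemma over the rationals

  ℚ-ring : AlmostCommutativeRing 0ℓ 0ℓ
  ℚ-ring = fromCommutativeRing +-*-commutativeRing (λ x → dec⇒maybe (0ℚ ≟ x))

  ℤ→ℚ-+ : ∀ a b → ℤ→ℚ (a ℤ.+ b) ≡ ℤ→ℚ a + ℤ→ℚ b
  ℤ→ℚ-+ a b = toℚᵘ-injective (begin
    toℚᵘ (ℤ→ℚ (a ℤ.+ b))              ≈⟨ toℚᵘ-fromℚᵘ (ℚᵘ.mkℚᵘ (a ℤ.+ b) 0) ⟩
    ℚᵘ.mkℚᵘ (a ℤ.+ b) 0               ≈⟨ ℚᵘ.*≡* (cong (ℤ._* ℤ.+ 1) (cong₂ ℤ._+_ (sym (ℤ.*-identityʳ a)) (sym (ℤ.*-identityʳ b)))) ⟩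
    ℚᵘ.mkℚᵘ a 0 ℚᵘ.+ ℚᵘ.mkℚᵘ b 0      ≈⟨ ℚᵘ.+-cong (toℚᵘ-fromℚᵘ (ℚᵘ.mkℚᵘ a 0)) (toℚᵘ-fromℚᵘ (ℚᵘ.mkℚᵘ b 0)) ⟨
    toℚᵘ (ℤ→ℚ a) ℚᵘ.+ toℚᵘ (ℤ→ℚ b)    ≈⟨ toℚᵘ-homo-+ (ℤ→ℚ a) (ℤ→ℚ b) ⟨
    toℚᵘ (ℤ→ℚ a + ℤ→ℚ b)              ∎)
    where open ℚᵘ.≃-Reasoning

  p≡p+q-q : ∀ p q → p ≡ (p + q) - q
  p≡p+q-q = solve-∀ ℚ-ring

  ℤ→ℚ-neg : ∀ a → ℤ→ℚ (ℤ.- a) ≡ - ℤ→ℚ a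
  ℤ→ℚ-neg a = begin
    ℤ→ℚ (ℤ.- a)                        ≡⟨ p≡p+q-q _ (ℤ→ℚ a) ⟩
    (ℤ→ℚ (ℤ.- a) + ℤ→ℚ a) - ℤ→ℚ a      ≡⟨ cong (_- ℤ→ℚ a) (ℤ→ℚ-+ (ℤ.- a) a) ⟨
    ℤ→ℚ (ℤ.- a ℤ.+ a) - ℤ→ℚ a          ≡⟨ cong (λ z → ℤ→ℚ z - ℤ→ℚ a) (ℤ.+-inverseˡ a) ⟩
    0ℚ - ℤ→ℚ a                         ≡⟨ +-identityˡ (- ℤ→ℚ a) ⟩
    - ℤ→ℚ a                            ∎
    where open ≡-Reasoning

  ℤ→ℚ-- : ∀ a b → ℤ→ℚ (a ℤ.- b) ≡ ℤ→ℚ a - ℤ→ℚ b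
  ℤ→ℚ-- a b = trans (ℤ→ℚ-+ a (ℤ.- b)) (cong (ℤ→ℚ a +_) (ℤ→ℚ-neg b))

  ℕ→ℚ : ℕ → ℚ
  ℕ→ℚ m = ℤ→ℚ (ℤ.+ m)

  ℕ→ℚ-suc : ∀ m → ℕ→ℚ (suc m) ≡ 1ℚ + ℕ→ℚ m
  ℕ→ℚ-suc m = ℤ→ℚ-+ (ℤ.+ 1) (ℤ.+ m)

  integral-+ : ∀ {p q} → IsIntegral p → IsIntegral q → IsIntegral (p + q)
  integral-+ (a , refl) (b , refl) = a ℤ.+ b , sym (ℤ→ℚ-+ a b)

  integral-neg : ∀ {p} → IsIntegral p → IsIntegral (- p)
  integral-neg (a , refl) = ℤ.- a , sym (ℤ→ℚ-neg a)

  -- The equation is a ring identity, left to the solver.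
  linear : ∀ {a b A B} → a ≤ b → A + b ≡ B + a → A ≤ B
  linear {a} {b} {A} {B} p e = begin
    A              ≡⟨ p≡p+q-q A b ⟩
    (A + b) - b    ≡⟨ cong (_- b) e ⟩
    (B + a) - b    ≤⟨ +-monoˡ-≤ (- b) (+-monoʳ-≤ B p) ⟩
    (B + b) - b    ≡⟨ p≡p+q-q B b ⟨
    B              ∎
    where open ≤-Reasoning

  linear-< : ∀ {a b A B} → a < b → A + b ≡ B + a → A < B
  linear-< {a} {b} {A} {B} p e = begin-strict
    A              ≡⟨ p≡p+q-q A b ⟩
    (A + b) - b    ≡⟨ cong (_- b) e ⟩
    (B + a) - b    <⟨ +-monoˡ-< (- b) (+-monoʳ-< B p) ⟩
    (B + b) - b    ≡⟨ p≡p+q-q B b ⟨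
    B              ∎
    where open ≤-Reasoning

  *-nonneg : ∀ {p q} → 0ℚ ≤ p → 0ℚ ≤ q → 0ℚ ≤ p * q
  *-nonneg {p} {q} 0≤p 0≤q =
    subst (_≤ p * q) (*-zeroʳ p) (*-monoˡ-≤-nonNeg p {{nonNegative 0≤p}} 0≤q)

  *-pos : ∀ {p q} → 0ℚ < p → 0ℚ < q → 0ℚ < p * q
  *-pos {p} {q} 0<p 0<q =
    subst (_< p * q) (*-zeroʳ p) (*-monoʳ-<-pos p {{positive 0<p}} 0<q)

  *-monoˡ : ∀ {p q r} → 0ℚ ≤ p → q ≤ r → p * q ≤ p * r
  *-monoˡ {p} 0≤p q≤r = *-monoˡ-≤-nonNeg p {{nonNegative 0≤p}} q≤r

  *-monoˡ-< : ∀ {p q r} → 0ℚ < p → q < r → p * q < p * r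
  *-monoˡ-< {p} 0<p q<r = *-monoʳ-<-pos p {{positive 0<p}} q<r

  reciprocal : ∀ {p} → 0ℚ < p → ∃ λ r → 0ℚ < r × r * p ≡ 1ℚ
  reciprocal {p} 0<p =
    1/ p , positive⁻¹ (1/ p) {{1/pos⇒pos p}} , *-inverseˡ p
    where instance
      p>0 : Positive p
      p>0 = positive 0<p
      p≢0 : NonZero p
      p≢0 = pos⇒nonZero p

  0≤1 : 0ℚ ≤ 1ℚ
  0≤1 = nonNegative⁻¹ 1ℚ

  0<1 : 0ℚ < 1ℚ
  0<1 = positive⁻¹ 1ℚ

  ℕ→ℚ-nonneg : ∀ m → 0ℚ ≤ ℕ→ℚ m
  ℕ→ℚ-nonneg zero    = ≤-refl
  ℕ→ℚ-nonneg (suc m) = subst (0ℚ ≤_) (sym (ℕ→ℚ-suc m))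
    (+-mono-≤ 0≤1 (ℕ→ℚ-nonneg m))


  sumFin-cong : ∀ d {f g : Fin d → ℚ} → (∀ j → f j ≡ g j) → sumFin d f ≡ sumFin d g
  sumFin-cong zero    e = refl
  sumFin-cong (suc d) e = cong₂ _+_ (e F.zero) (sumFin-cong d (e ∘ F.suc))

  sumFin-0 : ∀ d → sumFin d (λ _ → 0ℚ) ≡ 0ℚ
  sumFin-0 zero    = refl
  sumFin-0 (suc d) = trans (+-identityˡ _) (sumFin-0 d)

  sumFin-+* : ∀ d c (f g : Fin d → ℚ) →
              sumFin d (λ j → f j + c * g j) ≡ sumFin d f + c * sumFin d g
  sumFin-+* zero    c f g = sym (trans (+-identityˡ _) (*-zeroʳ c))
  sumFin-+* (suc d) c f g =
    trans (cong (_+_ (f F.zero + c * g F.zero)) (sumFin-+* d c (f ∘ F.suc) (g ∘ F.suc)))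
          (lemma (f F.zero) (g F.zero) (sumFin d (f ∘ F.suc)) (sumFin d (g ∘ F.suc)) c)
    where
    lemma : ∀ a b s t c → (a + c * b) + (s + c * t) ≡ (a + s) + c * (b + t)
    lemma = solve-∀ ℚ-ring

  dot-cong : ∀ {d} {x x′ y y′ : Vecℚ d} → x ≐ x′ → y ≐ y′ → dot x y ≡ dot x′ y′
  dot-cong {d} p q = sumFin-cong d (λ j → cong₂ _*_ (p j) (q j))

  dot-comm : ∀ {d} (x y : Vecℚ d) → dot x y ≡ dot y x
  dot-comm {d} x y = sumFin-cong d (λ j → *-comm (x j) (y j))

  dot-+*ʳ : ∀ {d} (x y z : Vecℚ d) c → dot x (λ j → y j + c * z j) ≡ dot x y + c * dot x z
  dot-+*ʳ {d} x y z c =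
    trans (sumFin-cong d (λ j → lemma (x j) (y j) (z j) c))
          (sumFin-+* d c (λ j → x j * y j) (λ j → x j * z j))
    where
    lemma : ∀ a b e c → a * (b + c * e) ≡ a * b + c * (a * e)
    lemma = solve-∀ ℚ-ring

  dot-+*ˡ : ∀ {d} (x y z : Vecℚ d) c → dot (λ j → x j + c * y j) z ≡ dot x z + c * dot y z
  dot-+*ˡ x y z c = begin
    dot (λ j → x j + c * y j) z   ≡⟨ dot-comm _ z ⟩
    dot z (λ j → x j + c * y j)   ≡⟨ dot-+*ʳ z x y c ⟩
    dot z x + c * dot z y         ≡⟨ cong₂ (λ s t → s + c * t) (dot-comm z x) (dot-comm z y) ⟩
    dot x z + c * dot y z         ∎
    where open ≡-Reasoning

  dot-zeroˡ : ∀ {d} (x : Vecℚ d) → dot zeroP x ≡ 0ℚ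
  dot-zeroˡ {d} x = trans (sumFin-cong d (λ j → *-zeroˡ (x j))) (sumFin-0 d)

  dot-*ʳ : ∀ {d} (x z : Vecℚ d) c → dot x (λ j → c * z j) ≡ c * dot x z
  dot-*ʳ x z c = begin
    dot x (λ j → c * z j)            ≡⟨ dot-cong {x = x} (λ _ → refl) (λ j → sym (+-identityˡ (c * z j))) ⟩
    dot x (λ j → 0ℚ + c * z j)       ≡⟨ dot-+*ʳ x zeroP z c ⟩
    dot x zeroP + c * dot x z        ≡⟨ cong (_+ c * dot x z) (trans (dot-comm x zeroP) (dot-zeroˡ x)) ⟩
    0ℚ + c * dot x z                 ≡⟨ +-identityˡ _ ⟩
    c * dot x z                      ∎
    where open ≡-Reasoning

  δ : ∀ {d} → Fin d → Fin d → ℤ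
  δ i j = if does (i F.≟ j) then ℤ.+ 1 else ℤ.+ 0

  sumFin-δ : ∀ {d} (x : Vecℚ d) j → sumFin d (λ i → x i * ℤ→ℚ (δ i j)) ≡ x j
  sumFin-δ {suc d} x F.zero = begin
    x F.zero * 1ℚ + sumFin d (λ i → x (F.suc i) * 0ℚ)
      ≡⟨ cong₂ _+_ (*-identityʳ (x F.zero)) (trans (sumFin-cong d (λ i → *-zeroʳ (x (F.suc i)))) (sumFin-0 d)) ⟩
    x F.zero + 0ℚ
      ≡⟨ +-identityʳ (x F.zero) ⟩
    x F.zero ∎
    where open ≡-Reasoning
  sumFin-δ {suc d} x (F.suc j) =
    trans (cong₂ _+_ (*-zeroʳ (x F.zero)) (sumFin-δ (x ∘ F.suc) j)) (+-identityˡ _)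

  -- The cone spanned by a list, encoded by peeling off one coefficient per generator; no sum over
  -- the list has to be formed, and the induction on generators is structural.
  data Cone {d} : List (Vecℚ d) → Vecℚ d → Set where
    apex : ∀ {b} → b ≐ zeroP → Cone [] b
    ray  : ∀ {a A b} l → 0ℚ ≤ l → Cone A (λ j → b j + (- l) * a j) → Cone (a ∷ A) b

  Cone-resp : ∀ {d A} {b b′ : Vecℚ d} → b ≐ b′ → Cone A b → Cone A b′
  Cone-resp e (apex b≐0)      = apex (λ j → trans (sym (e j)) (b≐0 j))
  Cone-resp e (ray {a} l 0≤l c) = ray l 0≤l (Cone-resp (λ j → cong (_+ (- l) * a j) (e j)) c)

  Separates : ∀ {d} → Vecℚ d → List (Vecℚ d) → Vecℚ d → Set
  Separates z A b = All (λ a → dot a z ≤ 0ℚ) A × 0ℚ < dot b z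

  project : ∀ {d} → Vecℚ d → Vecℚ d → Vecℚ d → Vecℚ d
  project α x a j = a j + (- dot a x) * α j

  -- Undoing the projection costs only multiples of `α`: a projected generator is a - (a·x) α, so
  -- `m` collects the terms l (a·x), each nonpositive.
  lift-Cone : ∀ {d} (α x : Vecℚ d) A b → All (λ a → dot a x ≤ 0ℚ) A → Cone (map (project α x) A) b →
              ∃ λ m → m ≤ 0ℚ × Cone A (λ j → b j + m * α j)
  lift-Cone α x [] b [] (apex e) =
    0ℚ , ≤-refl , apex (λ j → trans (cong (_+ 0ℚ * α j) (e j)) (trans (+-identityˡ _) (*-zeroˡ (α j))))
  lift-Cone α x (a ∷ A) b (ax≤0 ∷ h) (ray l 0≤l c) with lift-Cone α x A _ h c
  ... | m , m≤0 , c′ =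
    m + l * dot a x ,
    linear (+-mono-≤ m≤0 (*-monoˡ 0≤l ax≤0)) (lem₁ m (l * dot a x) l) ,
    ray l 0≤l (Cone-resp (λ j → lem₂ (b j) (a j) (α j) l m (dot a x)) c′)
    where
    lem₁ : ∀ m s l → (m + s) + (0ℚ + l * 0ℚ) ≡ 0ℚ + (m + s)
    lem₁ = solve-∀ ℚ-ring
    lem₂ : ∀ b a α l m s → (b + (- l) * (a + (- s) * α)) + m * α ≡ (b + (m + l * s) * α) + (- l) * a
    lem₂ = solve-∀ ℚ-ring

  -- The adjoint of the projection: it carries a separating functional of the projected problem back
  -- to the original one.
  project-dot : ∀ {d} (α x a z : Vecℚ d) →
                dot a (λ j → z j + (- dot α z) * x j) ≡ dot (project α x a) z
  project-dot α x a z = begin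
    dot a (λ j → z j + (- dot α z) * x j)   ≡⟨ dot-+*ʳ a z x (- dot α z) ⟩
    dot a z + (- dot α z) * dot a x         ≡⟨ lemma (dot a z) (dot α z) (dot a x) ⟩
    dot a z + (- dot a x) * dot α z         ≡⟨ dot-+*ˡ a α z (- dot a x) ⟨
    dot (project α x a) z                   ∎
    where
    open ≡-Reasoning
    lemma : ∀ s t u → s + (- t) * u ≡ s + (- u) * t
    lemma = solve-∀ ℚ-ring

  nonzero-separates : ∀ {d} (b : Vecℚ d) j → b j ≢ 0ℚ → ∃ λ z → 0ℚ < dot b z
  nonzero-separates b j bj≢0 with <-cmp (b j) 0ℚ
  ... | tri< bj<0 _ _ = (λ i → (- 1ℚ) * ℤ→ℚ (δ i j)) ,
    subst (0ℚ <_) (sym (trans (dot-*ʳ b (λ i → ℤ→ℚ (δ i j)) (- 1ℚ)) (cong (- 1ℚ *_) (sumFin-δ b j))))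
      (linear-< bj<0 (lemma (b j)))
    where
    lemma : ∀ p → 0ℚ + 0ℚ ≡ (- 1ℚ) * p + p
    lemma = solve-∀ ℚ-ring
  ... | tri≈ _ bj≡0 _ = contradiction bj≡0 bj≢0
  ... | tri> _ _ bj>0 = (λ i → ℤ→ℚ (δ i j)) , subst (0ℚ <_) (sym (sumFin-δ b j)) bj>0

  -- Either answer to the projected problem pulls back. In the cone case `α` receives the
  -- coefficient b·x - m, nonnegative because b·x > 0 and m ≤ 0; in the other case the corrected
  -- functional vanishes on `α` and has its old values on the projected vectors.
  extend-separation : ∀ {d} (α x b : Vecℚ d) A → dot α x ≡ 1ℚ → All (λ a → dot a x ≤ 0ℚ) A → 0ℚ < dot b x →
                      Cone (map (project α x) A) (project α x b) ⊎
                        (∃ λ z → Separates z (map (project α x) A) (project α x b)) →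
                      Cone (α ∷ A) b ⊎ ∃ λ z → Separates z (α ∷ A) b
  extend-separation α x b A αx≡1 Ax≤0 bx>0 (inj₁ c) with lift-Cone α x A _ Ax≤0 c
  ... | m , m≤0 , c′ = inj₁ (ray (dot b x + (- m))
    (linear (+-mono-≤ (<⇒≤ bx>0) m≤0) (lem₁ (dot b x) m))
    (Cone-resp (λ j → lem₂ (b j) (α j) (dot b x) m) c′))
    where
    lem₁ : ∀ s m → 0ℚ + (s + 0ℚ) ≡ (s + (- m)) + (0ℚ + m)
    lem₁ = solve-∀ ℚ-ring
    lem₂ : ∀ b α s m → (b + (- s) * α) + m * α ≡ b + (- (s + (- m))) * α
    lem₂ = solve-∀ ℚ-ring
  extend-separation α x b A αx≡1 Ax≤0 bx>0 (inj₂ (z , Az≤0 , bz>0)) = inj₂ (z′ ,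
      ≤-reflexive αz′≡0 ∷ All.map (λ {a} → subst (_≤ 0ℚ) (sym (project-dot α x a z))) (All.map⁻ Az≤0) ,
      subst (0ℚ <_) (sym (project-dot α x b z)) bz>0)
    where
    z′ = λ j → z j + (- dot α z) * x j
    lemma : ∀ s → s + (- s) * 1ℚ ≡ 0ℚ
    lemma = solve-∀ ℚ-ring
    αz′≡0 : dot α z′ ≡ 0ℚ
    αz′≡0 = trans (dot-+*ʳ α z x (- dot α z))
      (trans (cong (λ s → dot α z + (- dot α z) * s) αx≡1) (lemma (dot α z)))

  -- Bartl's induction: if x separates b from A but not from α, scale it to α·x = 1 and
  -- project everything along α into the hyperplane orthogonal to x.
  farkas : ∀ {d} n (A : List (Vecℚ d)) → length A ≡ n → ∀ b → Cone A b ⊎ ∃ λ z → Separates z A b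
  farkas zero [] _ b with F.all? (λ j → b j ≟ 0ℚ)
  ... | yes b≐0 = inj₁ (apex b≐0)
  ... | no  b≢0 =
    let (j , bj≢0) = F.¬∀⟶∃¬ _ _ (λ j → b j ≟ 0ℚ) b≢0
        (z , bz>0) = nonzero-separates b j bj≢0
    in  inj₂ (z , [] , bz>0)
  farkas {d} (suc n) (α ∷ A) len b = extend (farkas n A (ℕ.suc-injective len) b)
    where
    lemma : ∀ p q → p ≡ p + (- 0ℚ) * q
    lemma = solve-∀ ℚ-ring

    rescale : ∀ z → Separates z A b → Dec (dot α z ≤ 0ℚ) → Cone (α ∷ A) b ⊎ ∃ λ z → Separates z (α ∷ A) b
    rescale z (Az≤0 , bz>0) (yes αz≤0) = inj₂ (z , αz≤0 ∷ Az≤0 , bz>0)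
    rescale z (Az≤0 , bz>0) (no αz≰0) = scaled (reciprocal (≰⇒> αz≰0))
      where
      scaled : (∃ λ r → 0ℚ < r × r * dot α z ≡ 1ℚ) → Cone (α ∷ A) b ⊎ ∃ λ z → Separates z (α ∷ A) b
      scaled (r , 0<r , rαz≡1) = extend-separation α x b A
        (trans (dot-*ʳ α z r) rαz≡1)
        (All.map (λ {a} az≤0 → subst₂ _≤_ (sym (dot-*ʳ a z r)) (*-zeroʳ r) (*-monoˡ (<⇒≤ 0<r) az≤0)) Az≤0)
        (subst (0ℚ <_) (sym (dot-*ʳ b z r)) (*-pos 0<r bz>0))
        (farkas n (map (project α x) A) (trans (length-map _ A) (ℕ.suc-injective len)) (project α x b))
        where
        x : Vecℚ d
        x j = r * z j

    extend : Cone A b ⊎ (∃ λ z → Separates z A b) → Cone (α ∷ A) b ⊎ ∃ λ z → Separates z (α ∷ A) b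
    extend (inj₁ c) = inj₁ (ray 0ℚ ≤-refl (Cone-resp (λ j → lemma (b j) (α j)) c))
    extend (inj₂ (z , sep)) = rescale z sep (dot α z ≤? 0ℚ)

  -- Separation from a convex hull that contains the origin

  homogenize : ∀ {d} → Vecℚ d → Vecℚ (suc d)
  homogenize w F.zero    = 1ℚ
  homogenize w (F.suc j) = w j

  -- The leading coordinate 1 of every generator makes the leading coordinate of `b` the sum of the
  -- coefficients, so that cones at height 1 are convex hulls.
  Cone⇒combo : ∀ {d} (W : List (Vecℚ d)) b → Cone (map homogenize W) b →
               ∃ λ ws → All (λ w → 0ℚ ≤ proj₁ w) ws × All (λ w → proj₂ w ∈ W) ws ×
                        weightSum ws ≡ b F.zero × (b ∘ F.suc) ≐ combo ws
  Cone⇒combo [] b (apex b≐0) = [] , [] , [] , sym (b≐0 F.zero) , b≐0 ∘ F.suc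
  Cone⇒combo (w ∷ W) b (ray l 0≤l c) =
    let (ws , nonneg , ws⊆W , total , e) = Cone⇒combo W _ c
    in  (l , w) ∷ ws , 0≤l ∷ nonneg , here refl ∷ All.map there ws⊆W ,
        trans (cong (_+_ l) total) (lem₁ (b F.zero) l) ,
        λ j → trans (lem₂ (b (F.suc j)) (w j) l) (cong (_+_ (l * w j)) (e j))
    where
    lem₁ : ∀ b l → l + (b + (- l) * 1ℚ) ≡ b
    lem₁ = solve-∀ ℚ-ring
    lem₂ : ∀ b w l → b ≡ l * w + (b + (- l) * w)
    lem₂ = solve-∀ ℚ-ring

  -- The origin among the generators forces the constant term `z₀` of the separating functional to
  -- be nonpositive; this is what allows the right-hand side to be normalised to 1.
  hull⊎separated : ∀ {d} (W : List (Vecℚ d)) x →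
                   Conv (_∈ (zeroP ∷ W)) x ⊎ ∃ λ y → All (λ w → dot w y ≤ 1ℚ) W × 1ℚ < dot x y
  hull⊎separated {d} W x = conclude (farkas _ (map homogenize (zeroP ∷ W)) refl (homogenize x))
    where
    conclude : Cone (map homogenize (zeroP ∷ W)) (homogenize x) ⊎
                 (∃ λ z → Separates z (map homogenize (zeroP ∷ W)) (homogenize x)) →
               Conv (_∈ (zeroP ∷ W)) x ⊎ ∃ λ y → All (λ w → dot w y ≤ 1ℚ) W × 1ℚ < dot x y
    conclude (inj₁ c) = inj₁ (Cone⇒combo (zeroP ∷ W) (homogenize x) c)
    conclude (inj₂ (z , 0z≤0 ∷ Wz≤0 , xz>0)) = inj₂ (normalise (reciprocal T>0))
      where
      z₀ = z F.zero
      z₊ : Vecℚ d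
      z₊ j = z (F.suc j)
      X = dot x z₊
      z₀≤0 : z₀ ≤ 0ℚ
      z₀≤0 = subst (_≤ 0ℚ) (trans (cong (_+_ (1ℚ * z₀)) (dot-zeroˡ z₊)) (lemma z₀)) 0z≤0
        where
        lemma : ∀ p → 1ℚ * p + 0ℚ ≡ p
        lemma = solve-∀ ℚ-ring
      T>0 : 0ℚ < X + (- z₀)
      T>0 = linear-< (+-mono-<-≤ xz>0 (+-mono-≤ z₀≤0 z₀≤0)) (lem₂ z₀ X)
        where
        lem₂ : ∀ p q → 0ℚ + ((1ℚ * p + q) + (0ℚ + 0ℚ)) ≡ (q + (- p)) + (0ℚ + (p + p))
        lem₂ = solve-∀ ℚ-ring
      normalise : (∃ λ r → 0ℚ < r × r * (X + (- z₀)) ≡ 1ℚ) →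
                  ∃ λ y → All (λ w → dot w y ≤ 1ℚ) W × 1ℚ < dot x y
      normalise (r , 0<r , rT≡1) = y , All.map (λ {w} → bound w) (All.map⁻ Wz≤0) , strict
        where
        -- On `W` the functional `z₊` is at most -z₀, at `x` it is X > -z₀. Dividing by -z₀ fails
        -- when it is 0, so `y` is scaled to send the midpoint (X - z₀)/2 to 1.
        y : Vecℚ d
        y j = (r + r) * z₊ j
        bound : ∀ w → dot (homogenize w) z ≤ 0ℚ → dot w y ≤ 1ℚ
        bound w wz≤0 = subst₂ _≤_ (sym (dot-*ʳ w z₊ (r + r))) rT≡1
          (linear (*-monoˡ (<⇒≤ 0<r) (+-mono-≤ (+-mono-≤ wz≤0 wz≤0) (<⇒≤ xz>0))) (lem₃ r (dot w z₊) z₀ X))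
          where
          lem₃ : ∀ r q p x → (r + r) * q + r * (0ℚ + 0ℚ + (1ℚ * p + x)) ≡
                             r * (x + (- p)) + r * ((1ℚ * p + q) + (1ℚ * p + q) + 0ℚ)
          lem₃ = solve-∀ ℚ-ring
        strict : 1ℚ < dot x y
        strict = subst₂ _<_ rT≡1 (sym (dot-*ʳ x z₊ (r + r)))
          (linear-< (*-monoˡ-< 0<r xz>0) (lem₄ r z₀ X))
          where
          lem₄ : ∀ r p x → r * (x + (- p)) + r * (1ℚ * p + x) ≡ (r + r) * x + r * 0ℚ
          lem₄ = solve-∀ ℚ-ring

  -- Order polytopes of graded posets

  <⇒≱ : ∀ {p q} → p < q → ¬ q ≤ p
  <⇒≱ p<q q≤p = <-irrefl refl (<-≤-trans p<q q≤p)

  p≤∣p∣ : ∀ p → p ≤ ∣ p ∣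
  p≤∣p∣ p with ∣p∣≡p∨∣p∣≡-p p
  ... | inj₁ e = ≤-reflexive (sym e)
  ... | inj₂ e = linear (+-mono-≤ (0≤∣p∣ p) (0≤∣p∣ p))
    (trans (cong (λ t → p + (∣ p ∣ + t)) e) (lemma p ∣ p ∣))
    where
    lemma : ∀ p q → p + (q + (- p)) ≡ q + (0ℚ + 0ℚ)
    lemma = solve-∀ ℚ-ring

  χ : Bool → ℚ
  χ true  = 1ℚ
  χ false = 0ℚ

  -- Besides the coordinates of a point there are two constant ones, 0 and the dilation factor.
  data Node (d : ℕ) : Set where
    bot top : Node d
    elt     : Fin d → Node d

  value : ∀ {d} → ℚ → Vecℚ d → Node d → ℚ
  value K y bot     = 0ℚ
  value K y top     = K
  value K y (elt j) = y j

  value-0 : ∀ {d} (a : Node d) → value 0ℚ zeroP a ≡ 0ℚ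
  value-0 bot     = refl
  value-0 top     = refl
  value-0 (elt j) = refl

  value-+* : ∀ {d} K L c (y z : Vecℚ d) a →
             value (K + c * L) (λ j → y j + c * z j) a ≡ value K y a + c * value L z a
  value-+* K L c y z bot     = sym (trans (+-identityˡ _) (*-zeroʳ c))
  value-+* K L c y z top     = refl
  value-+* K L c y z (elt j) = refl

  value-cong : ∀ {d K L} {y z : Vecℚ d} → K ≡ L → y ≐ z → ∀ a → value K y a ≡ value L z a
  value-cong e f bot     = refl
  value-cong e f top     = e
  value-cong e f (elt j) = f j

  -- An entry of a permutation matrix tells whether a certain letter is read at a certain time,
  -- either as a low or as a high letter. Each of these two alternatives is a difference of two
  -- statements about the path, hence four nodes.
  record Entries (I : Set) (d : ℕ) : Set where
    field
      p q r s : I → Node d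

    entry : (Node d → ℚ) → Point I
    entry v i = (v (p i) - v (q i)) + (v (r i) - v (s i))

    entry-cong : ∀ {v w} → (∀ a → v a ≡ w a) → entry v ≐ entry w
    entry-cong e i = cong₂ _+_ (cong₂ _-_ (e (p i)) (e (q i))) (cong₂ _-_ (e (r i)) (e (s i)))

    entry-+* : ∀ v w c i → entry (λ a → v a + c * w a) i ≡ entry v i + c * entry w i
    entry-+* v w c i = lemma (v (p i)) (v (q i)) (v (r i)) (v (s i)) (w (p i)) (w (q i)) (w (r i)) (w (s i)) c
      where
      lemma : ∀ a b e f a′ b′ e′ f′ c →
              ((a + c * a′) - (b + c * b′)) + ((e + c * e′) - (f + c * f′)) ≡
              ((a - b) + (e - f)) + c * ((a′ - b′) + (e′ - f′))
      lemma = solve-∀ ℚ-ring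

    entry-0 : ∀ i → entry (value 0ℚ zeroP) i ≡ 0ℚ
    entry-0 i = entry-cong value-0 i

    point : ℚ → Vecℚ d → Point I
    point K y = entry (value K y)

    point-cong : ∀ {K L y z} → K ≡ L → y ≐ z → point K y ≐ point L z
    point-cong e f = entry-cong (value-cong e f)

    point-+* : ∀ K L c y z i →
               point (K + c * L) (λ j → y j + c * z j) i ≡ point K y i + c * point L z i
    point-+* K L c y z i = trans (entry-cong (value-+* K L c y z) i) (entry-+* (value K y) (value L z) c i)

    point-* : ∀ L c z i → point (c * L) (λ j → c * z j) i ≡ c * point L z i
    point-* L c z i = begin
      point (c * L) (λ j → c * z j) i
        ≡⟨ point-cong (sym (+-identityˡ (c * L))) (λ j → sym (+-identityˡ (c * z j))) i ⟩
      point (0ℚ + c * L) (λ j → zeroP {Fin d} j + c * z j) i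
        ≡⟨ point-+* 0ℚ L c zeroP z i ⟩
      point 0ℚ zeroP i + c * point L z i
        ≡⟨ cong (_+ c * point L z i) (entry-0 i) ⟩
      0ℚ + c * point L z i
        ≡⟨ +-identityˡ _ ⟩
      c * point L z i ∎
      where open ≡-Reasoning

  -- Decomposition of a function into its superlevel sets

  open Data.List.Sort ≤-decTotalOrder using (sort; sort-↭; sort-↗)

  level : ∀ {d} → Vecℚ d → ℚ → Fin d → Bool
  level y s j = ⌊ s ≤? y j ⌋

  -- The extra threshold 1 makes the gaps, counted from 0, add up to 1 when the values lie between 0
  -- and 1. The level set at 1 may be empty, and repeated values only give gaps of weight 0.
  thresholds : ∀ {d} → Vecℚ d → List ℚ
  thresholds y = sort (1ℚ ∷ tabulate y)

  layers : ℚ → List ℚ → List (ℚ × ℚ)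
  layers a []      = []
  layers a (s ∷ l) = (s - a , s) ∷ layers s l

  height : ℚ → List ℚ → ℚ → ℚ
  height a []      v = 0ℚ
  height a (s ∷ l) v = (s - a) * χ ⌊ s ≤? v ⌋ + height s l v

  χ-≤ : ∀ {s v} → s ≤ v → χ ⌊ s ≤? v ⌋ ≡ 1ℚ
  χ-≤ {s} {v} s≤v with s ≤? v
  ... | yes _   = refl
  ... | no  s≰v = contradiction s≤v s≰v

  χ-> : ∀ {s v} → v < s → χ ⌊ s ≤? v ⌋ ≡ 0ℚ
  χ-> {s} {v} v<s with s ≤? v
  ... | yes s≤v = contradiction s≤v (<⇒≱ v<s)
  ... | no  _   = refl

  height-below : ∀ {a} l {v} → Linked _≤_ (a ∷ l) → v < a → height a l v ≡ 0ℚ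
  height-below []          _         v<a = refl
  height-below {a} (s ∷ l) (a≤s ∷ h) v<a =
    trans (cong₂ (λ x y → (s - a) * x + y) (χ-> v<s) (height-below l h v<s))
          (trans (+-identityʳ _) (*-zeroʳ (s - a)))
    where v<s = <-≤-trans v<a a≤s

  Linked-head-≤ : ∀ {a} l {v} → Linked _≤_ (a ∷ l) → v ∈ (a ∷ l) → a ≤ v
  Linked-head-≤ l       _         (here refl) = ≤-refl
  Linked-head-≤ (s ∷ l) (a≤s ∷ h) (there v∈l) = ≤-trans a≤s (Linked-head-≤ l h v∈l)

  -- The gaps telescope: thresholds up to `v` contribute, later ones do not. Membership of `v` makes
  -- the sum stop exactly at `v` instead of at the last threshold before it.
  height-total : ∀ {a} l {v} → Linked _≤_ (a ∷ l) → v ∈ (a ∷ l) → height a l v ≡ v - a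
  height-total {a} []      _ (here refl) = sym (+-inverseʳ a)
  height-total {a} (s ∷ l) {v} (a≤s ∷ h) v∈ = split (s ≤? v)
    where
    lemma : ∀ a s v → (s - a) * 1ℚ + (v - s) ≡ v - a
    lemma = solve-∀ ℚ-ring
    split : Dec (s ≤ v) → height a (s ∷ l) v ≡ v - a
    split (yes s≤v) = trans (cong₂ (λ x y → (s - a) * x + y) (χ-≤ s≤v) (height-total l h (later v∈))) (lemma a s v)
      where
      later : v ∈ (a ∷ s ∷ l) → v ∈ (s ∷ l)
      later (here refl) = here (≤-antisym a≤s s≤v)
      later (there v∈l) = v∈l
    split (no s≰v) = lowest v∈
      where
      v<s = ≰⇒> s≰v
      lowest : v ∈ (a ∷ s ∷ l) → height a (s ∷ l) v ≡ v - a
      lowest (here refl) = trans (cong₂ (λ x y → (s - a) * x + y) (χ-> v<s) (height-below l h v<s))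
        (trans (trans (+-identityʳ _) (*-zeroʳ (s - a))) (sym (+-inverseʳ a)))
      lowest (there v∈l) = contradiction (Linked-head-≤ l h v∈l) (<⇒≱ v<s)

  dot-combo-≤ : ∀ {d} (ws : List (ℚ × Vecℚ d)) y → All (λ w → 0ℚ ≤ proj₁ w) ws →
                All (λ w → dot (proj₂ w) y ≤ 1ℚ) ws → dot (combo ws) y ≤ weightSum ws
  dot-combo-≤ [] y [] [] = ≤-reflexive (dot-zeroˡ y)
  dot-combo-≤ ((l , w) ∷ ws) y (0≤l ∷ nonneg) (wy≤1 ∷ h) = begin
    dot (combo ((l , w) ∷ ws)) y
      ≡⟨ dot-cong {y = y} (λ j → +-comm (l * w j) (combo ws j)) (λ _ → refl) ⟩
    dot (λ j → combo ws j + l * w j) y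
      ≡⟨ dot-+*ˡ (combo ws) w y l ⟩
    dot (combo ws) y + l * dot w y
      ≤⟨ +-mono-≤ (dot-combo-≤ ws y nonneg h) (*-monoˡ 0≤l wy≤1) ⟩
    weightSum ws + l * 1ℚ
      ≡⟨ cong (_+_ (weightSum ws)) (*-identityʳ l) ⟩
    weightSum ws + l
      ≡⟨ +-comm (weightSum ws) l ⟩
    l + weightSum ws ∎
    where open ≤-Reasoning

  -- The polytope with vertex set V is the order polytope of the poset on Fin d generated by R, up
  -- to the affine map sending y to the point with entries y p − y q + y r − y s.  The last field
  -- says that this map is a lattice isomorphism onto its image: taking A to be "is 0" gives
  -- injectivity, and taking A to be "is an integer" gives compatibility with the lattices.
  record GradedModel {I : Set} (V : Region I) : Set₁ where
    field
      {d} k   : ℕ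
      1≤k     : 1 ℕ.≤ k
      entries : Entries I d
      rank    : Fin d → ℕ
      R       : Fin d → Fin d → Set
      R?      : ∀ i j → Dec (R i j)

    open Entries entries public

    Filter : (Fin d → Bool) → Set
    Filter F = ∀ i j → R i j → T (F i) → T (F j)

    field
      rank-suc : ∀ {i j} → R i j → rank j ≡ suc (rank i)
      rank<k   : ∀ j → rank j ℕ.< k
      lower    : ∀ j → rank j ≡ 1 ⊎ ∃ λ i → R i j
      upper    : ∀ j → suc (rank j) ≡ k ⊎ ∃ λ i → R j i
      filter⇒vertex : ∀ F → Filter F → V (point 1ℚ (χ ∘ F))
      vertex⇒filter : ∀ M → V M → ∃ λ F → Filter F × M ≐ point 1ℚ (χ ∘ F)
      recover  : ∀ (A : ℚ → Set) → (∀ {p q} → A p → A q → A (p - q)) →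
                 ∀ v → A (v bot) → A (v top) → (∀ i → A (entry v i)) → ∀ j → A (v (elt j))

  -- The dilate in poset coordinates and its lattice chart

  module _ {I : Set} {V : Region I} (model : GradedModel V) where
    open GradedModel model

    K : ℚ
    K = ℕ→ℚ k

    0<K : 0ℚ < K
    0<K = positive-k k 1≤k
      where
      positive-k : ∀ k → 1 ℕ.≤ k → 0ℚ < ℕ→ℚ k
      positive-k (suc k) _ = subst (0ℚ <_) (sym (ℕ→ℚ-suc k)) (+-mono-<-≤ 0<1 (ℕ→ℚ-nonneg k))

    ρ : Vecℚ d
    ρ j = ℕ→ℚ (rank j)

    ρ-suc : ∀ {i j} → R i j → ρ j ≡ 1ℚ + ρ i
    ρ-suc {i} i<j = trans (cong ℕ→ℚ (rank-suc i<j)) (ℕ→ℚ-suc (rank i))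

    Feasible : ℚ → Vecℚ d → Set
    Feasible L y = (∀ i j → R i j → y i ≤ y j) × (∀ j → 0ℚ ≤ y j) × (∀ j → y j ≤ L)

    Feasible-* : ∀ {c L y} → 0ℚ ≤ c → Feasible L y → Feasible (c * L) (λ j → c * y j)
    Feasible-* 0≤c (mono , low , up) =
      (λ i j r → *-monoˡ 0≤c (mono i j r)) , (λ j → *-nonneg 0≤c (low j)) , (λ j → *-monoˡ 0≤c (up j))

    rankℤ : Node d → ℤ
    rankℤ bot     = ℤ.+ 0
    rankℤ top     = ℤ.+ k
    rankℤ (elt j) = ℤ.+ rank j

    δ′ : Fin d → Node d → ℤ
    δ′ e bot     = ℤ.+ 0
    δ′ e top     = ℤ.+ 0
    δ′ e (elt j) = δ e j

    -- The origin is put at the rank function, which lies in the interior of the dilate.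
    chart : AffMap d I
    chart = record
      { base = λ i → (rankℤ (p i) ℤ.- rankℤ (q i)) ℤ.+ (rankℤ (r i) ℤ.- rankℤ (s i))
      ; cols = λ e i → (δ′ e (p i) ℤ.- δ′ e (q i)) ℤ.+ (δ′ e (r i) ℤ.- δ′ e (s i))
      }

    sumFin-δ′ : ∀ x a → sumFin d (λ e → x e * ℤ→ℚ (δ′ e a)) ≡ value 0ℚ x a
    sumFin-δ′ x bot     = trans (sumFin-cong d (λ e → *-zeroʳ (x e))) (sumFin-0 d)
    sumFin-δ′ x top     = trans (sumFin-cong d (λ e → *-zeroʳ (x e))) (sumFin-0 d)
    sumFin-δ′ x (elt j) = sumFin-δ x j

    ℤ→ℚ-entry : ∀ a b c e → ℤ→ℚ ((a ℤ.- b) ℤ.+ (c ℤ.- e)) ≡ (ℤ→ℚ a - ℤ→ℚ b) + (ℤ→ℚ c - ℤ→ℚ e)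
    ℤ→ℚ-entry a b c e = trans (ℤ→ℚ-+ (a ℤ.- b) (c ℤ.- e)) (cong₂ _+_ (ℤ→ℚ-- a b) (ℤ→ℚ-- c e))

    apply-chart : ∀ x → apply chart x ≐ point K (λ j → x j + ρ j)
    apply-chart x i = begin
      ℤ→ℚ (AffMap.base chart i) + sumFin d (λ e → x e * ℤ→ℚ (AffMap.cols chart e i))
        ≡⟨ cong₂ _+_ (ℤ→ℚ-entry (rankℤ (p i)) (rankℤ (q i)) (rankℤ (r i)) (rankℤ (s i)))
             (trans (sumFin-cong d (λ e → trans
                       (cong (_*_ (x e)) (ℤ→ℚ-entry (δ′ e (p i)) (δ′ e (q i)) (δ′ e (r i)) (δ′ e (s i))))
                       (distribute (x e) (ℤ→ℚ (δ′ e (p i))) (ℤ→ℚ (δ′ e (q i))) (ℤ→ℚ (δ′ e (r i))) (ℤ→ℚ (δ′ e (s i))))))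
                    sums) ⟩
      entry (ℤ→ℚ ∘ rankℤ) i + ((value 0ℚ x (p i) + (- 1ℚ) * value 0ℚ x (q i)) +
                                1ℚ * (value 0ℚ x (r i) + (- 1ℚ) * value 0ℚ x (s i)))
        ≡⟨ collect (ℤ→ℚ (rankℤ (p i))) (ℤ→ℚ (rankℤ (q i))) (ℤ→ℚ (rankℤ (r i))) (ℤ→ℚ (rankℤ (s i)))
                   (value 0ℚ x (p i)) (value 0ℚ x (q i)) (value 0ℚ x (r i)) (value 0ℚ x (s i)) ⟩
      entry (λ a → value 0ℚ x a + ℤ→ℚ (rankℤ a)) i
        ≡⟨ entry-cong translated i ⟩
      point K (λ j → x j + ρ j) i ∎
      where
      open ≡-Reasoning
      col : (I → Node d) → Vecℚ d
      col f e = x e * ℤ→ℚ (δ′ e (f i))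
      distribute : ∀ x a b c e → x * ((a - b) + (c - e)) ≡
                   (x * a + (- 1ℚ) * (x * b)) + 1ℚ * (x * c + (- 1ℚ) * (x * e))
      distribute = solve-∀ ℚ-ring
      sums : sumFin d (λ e → (col p e + (- 1ℚ) * col q e) + 1ℚ * (col r e + (- 1ℚ) * col s e)) ≡
             (value 0ℚ x (p i) + (- 1ℚ) * value 0ℚ x (q i)) + 1ℚ * (value 0ℚ x (r i) + (- 1ℚ) * value 0ℚ x (s i))
      sums = trans (sumFin-+* d 1ℚ (λ e → col p e + (- 1ℚ) * col q e) (λ e → col r e + (- 1ℚ) * col s e))
        (cong₂ (λ a b → a + 1ℚ * b)
          (trans (sumFin-+* d (- 1ℚ) (col p) (col q))
                 (cong₂ (λ a b → a + (- 1ℚ) * b) (sumFin-δ′ x (p i)) (sumFin-δ′ x (q i))))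
          (trans (sumFin-+* d (- 1ℚ) (col r) (col s))
                 (cong₂ (λ a b → a + (- 1ℚ) * b) (sumFin-δ′ x (r i)) (sumFin-δ′ x (s i)))))
      collect : ∀ a b c e a′ b′ c′ e′ →
                ((a - b) + (c - e)) + ((a′ + (- 1ℚ) * b′) + 1ℚ * (c′ + (- 1ℚ) * e′)) ≡
                ((a′ + a) - (b′ + b)) + ((c′ + c) - (e′ + e))
      collect = solve-∀ ℚ-ring
      translated : ∀ a → value 0ℚ x a + ℤ→ℚ (rankℤ a) ≡ value K (λ j → x j + ρ j) a
      translated bot     = refl
      translated top     = +-identityˡ K
      translated (elt j) = refl

    -- The running weight takes the place of the dilation factor, so that the induction covers
    -- partial combinations, whose weights do not yet add up to 1.
    lift-vertices : ∀ ws → All (λ w → V (proj₂ w)) ws → ∃ λ y →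
                    combo ws ≐ point (weightSum ws) y ×
                    (All (λ w → 0ℚ ≤ proj₁ w) ws → Feasible (weightSum ws) y)
    lift-vertices [] [] = zeroP , (λ i → sym (entry-0 i)) ,
      λ _ → (λ _ _ _ → ≤-refl) , (λ _ → ≤-refl) , (λ _ → ≤-refl)
    lift-vertices ((l , M) ∷ ws) (M∈V ∷ h) =
      let (F , up , M≐) = vertex⇒filter M M∈V
          (y , e , feasible) = lift-vertices ws h
      in  (λ j → y j + l * χ (F j)) ,
          (λ i → trans (cong₂ (λ a b → l * a + b) (M≐ i) (e i))
                   (trans (+-comm _ (point (weightSum ws) y i))
                   (trans (sym (point-+* (weightSum ws) 1ℚ l y (χ ∘ F) i))
                          (point-cong (total (weightSum ws) l) (λ _ → refl) i)))) ,
          λ { (0≤l ∷ nonneg) → let (mono , low , high) = feasible nonneg in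
              (λ i j r → +-mono-≤ (mono i j r) (*-monoˡ 0≤l (χ-mono (up i j r)))) ,
              (λ j → +-mono-≤ (low j) (*-nonneg 0≤l (0≤χ (F j)))) ,
              (λ j → subst (λ t → y j + l * χ (F j) ≤ t) (total (weightSum ws) l)
                       (+-mono-≤ (high j) (*-monoˡ 0≤l (χ≤1 (F j))))) }
      where
      total : ∀ w l → w + l * 1ℚ ≡ l + w
      total = solve-∀ ℚ-ring
      χ-mono : ∀ {a b} → (T a → T b) → χ a ≤ χ b
      χ-mono {false} {false} _ = ≤-refl
      χ-mono {false} {true}  _ = 0≤1
      χ-mono {true}  {false} f = ⊥-elim (f _)
      χ-mono {true}  {true}  _ = ≤-refl
      0≤χ : ∀ a → 0ℚ ≤ χ a
      0≤χ false = ≤-refl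
      0≤χ true  = 0≤1
      χ≤1 : ∀ a → χ a ≤ 1ℚ
      χ≤1 false = 0≤1
      χ≤1 true  = ≤-refl

    layered : Vecℚ d → ℚ → List ℚ → List (ℚ × Point I)
    layered y a l = map (λ (w , s) → w , point 1ℚ (χ ∘ level y s)) (layers a l)

    layered-combo : ∀ y a l → combo (layered y a l) ≐ point (weightSum (layered y a l)) (λ j → height a l (y j))
    layered-combo y a []      i = sym (entry-0 i)
    layered-combo y a (s ∷ l) i =
      trans (cong (_+_ ((s - a) * point 1ℚ (χ ∘ level y s) i)) (layered-combo y s l i))
      (trans (+-comm ((s - a) * point 1ℚ (χ ∘ level y s) i) _)
      (trans (sym (point-+* (weightSum (layered y s l)) 1ℚ (s - a) (λ j → height s l (y j)) (χ ∘ level y s) i))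
             (point-cong (lemma (weightSum (layered y s l)) (s - a))
                (λ j → +-comm (height s l (y j)) _) i)))
      where
      lemma : ∀ w l → w + l * 1ℚ ≡ l + w
      lemma = solve-∀ ℚ-ring

    layered-nonneg : ∀ y a l → Linked _≤_ (a ∷ l) → All (λ w → 0ℚ ≤ proj₁ w) (layered y a l)
    layered-nonneg y a []      _         = []
    layered-nonneg y a (s ∷ l) (a≤s ∷ h) = linear a≤s (lemma a s) ∷ layered-nonneg y s l h
      where
      lemma : ∀ a s → 0ℚ + s ≡ (s - a) + a
      lemma = solve-∀ ℚ-ring

    layered-vertex : ∀ y a l → (∀ i j → R i j → y i ≤ y j) → All (λ w → V (proj₂ w)) (layered y a l)
    layered-vertex y a []      mono = []
    layered-vertex y a (s ∷ l) mono =
      filter⇒vertex (level y s) (λ i j r s≤yi → fromWitness (≤-trans (toWitness s≤yi) (mono i j r))) ∷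
      layered-vertex y s l mono

    layered-weight : ∀ y a l → All (_≤ 1ℚ) l → weightSum (layered y a l) ≡ height a l 1ℚ
    layered-weight y a []      []        = refl
    layered-weight y a (s ∷ l) (s≤1 ∷ h) =
      cong₂ _+_ (sym (trans (cong (_*_ (s - a)) (χ-≤ s≤1)) (*-identityʳ (s - a)))) (layered-weight y s l h)

    -- The superlevel sets of a feasible y are filters, and y is the combination of their
    -- indicators weighted by the gaps between consecutive values.
    feasible⇒Conv : ∀ {y} → Feasible 1ℚ y → Conv V (point 1ℚ y)
    feasible⇒Conv {y} (mono , low , high) =
      layered y 0ℚ l , layered-nonneg y 0ℚ l ascending , layered-vertex y 0ℚ l mono , total ,
      λ i → sym (trans (layered-combo y 0ℚ l i) (point-cong total heights i))
      where
      l = thresholds y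
      unsort = ↭-sym (sort-↭ (1ℚ ∷ tabulate y))
      ascending : Linked _≤_ (0ℚ ∷ l)
      ascending = prepend l (sort-↗ (1ℚ ∷ tabulate y)) (All-resp-↭ unsort (0≤1 ∷ All.tabulate⁺ low))
        where
        prepend : ∀ l → Linked _≤_ l → All (0ℚ ≤_) l → Linked _≤_ (0ℚ ∷ l)
        prepend []      _ _         = [-]
        prepend (s ∷ l) h (0≤s ∷ _) = 0≤s ∷ h
      member : ∀ {v} → v ∈ (1ℚ ∷ tabulate y) → v ∈ (0ℚ ∷ l)
      member v∈ = there (∈-resp-↭ unsort v∈)
      total : weightSum (layered y 0ℚ l) ≡ 1ℚ
      total = trans (layered-weight y 0ℚ l (All-resp-↭ unsort (≤-refl ∷ All.tabulate⁺ high)))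
                    (height-total l ascending (member (here refl)))
      heights : ∀ j → height 0ℚ l (y j) ≡ y j
      heights j = trans (height-total l ascending (member (there (∈-tabulate⁺ j)))) (+-identityʳ (y j))

    P : Region I
    P = Dilate k (Conv V)

    feasible⇒P : ∀ {z y} → z ≐ point K y → Feasible K y → P z
    feasible⇒P {z} {y} z≐ feasible = scaled (reciprocal 0<K)
      where
      scaled : (∃ λ c → 0ℚ < c × c * K ≡ 1ℚ) → P z
      scaled (c , 0<c , cK≡1) =
        point 1ℚ (λ j → c * y j) ,
        feasible⇒Conv (subst (λ L → Feasible L (λ j → c * y j)) cK≡1 (Feasible-* (<⇒≤ 0<c) feasible)) ,
        λ i → trans (z≐ i) (trans (point-cong (sym (*-identityʳ K)) (λ j → sym (cancel (y j))) i)
                                  (point-* 1ℚ K (λ j → c * y j) i))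
        where
        cancel : ∀ v → K * (c * v) ≡ v
        cancel v = trans (assoc K c v) (trans (cong (_* v) cK≡1) (*-identityˡ v))
          where
          assoc : ∀ K c v → K * (c * v) ≡ (c * K) * v
          assoc = solve-∀ ℚ-ring

    P⇒feasible : ∀ {z} → P z → ∃ λ y → z ≐ point K y × Feasible K y
    P⇒feasible (x , (ws , nonneg , ws⊆V , total , x≐) , z≐) =
      let (y , e , feasible) = lift-vertices ws ws⊆V
      in  (λ j → K * y j) ,
          (λ i → trans (z≐ i) (trans (cong (_*_ K) (trans (x≐ i) (e i)))
                 (trans (sym (point-* (weightSum ws) K y i))
                        (point-cong (trans (cong (_*_ K) total) (*-identityʳ K)) (λ _ → refl) i)))) ,
          subst (λ L → Feasible L (λ j → K * y j)) (trans (cong (_*_ K) total) (*-identityʳ K))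
            (Feasible-* (<⇒≤ 0<K) (feasible nonneg))

    -- The weights of an affine combination may be negative, so no feasibility survives; a preimage
    -- `y` is all that the affine span requires.
    lift-P : ∀ ws → All (λ w → P (proj₂ w)) ws → ∃ λ y → combo ws ≐ point (weightSum ws * K) y
    lift-P [] [] = zeroP , λ i → sym (trans (point-cong (*-zeroˡ K) (λ _ → refl) i) (entry-0 i))
    lift-P ((l , z) ∷ ws) (z∈P ∷ h) =
      let (y , z≐ , _) = P⇒feasible z∈P
          (y′ , e) = lift-P ws h
      in  (λ j → y′ j + l * y j) ,
          λ i → trans (cong₂ (λ a b → l * a + b) (z≐ i) (e i))
                  (trans (+-comm _ (point (weightSum ws * K) y′ i))
                  (trans (sym (point-+* (weightSum ws * K) K l y′ y i))
                         (point-cong (lemma (weightSum ws) l K) (λ _ → refl) i)))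
      where
      lemma : ∀ w l K → w * K + l * K ≡ (l + w) * K
      lemma = solve-∀ ℚ-ring

    point-injective : ∀ {y z} → point K y ≐ point K z → y ≐ z
    point-injective {y} {z} e j = trans (lemma (y j) (z j)) (trans (cong (_+_ (z j)) difference) (+-identityʳ (z j)))
      where
      lemma : ∀ a b → a ≡ b + (a + (- 1ℚ) * b)
      lemma = solve-∀ ℚ-ring
      cancel : ∀ a → a + (- 1ℚ) * a ≡ 0ℚ
      cancel = solve-∀ ℚ-ring
      difference : y j + (- 1ℚ) * z j ≡ 0ℚ
      difference = recover (_≡ 0ℚ) (cong₂ _-_) (λ a → value K y a + (- 1ℚ) * value K z a) refl (cancel K)
        (λ i → trans (entry-+* (value K y) (value K z) (- 1ℚ) i)
                     (trans (cong (λ a → a + (- 1ℚ) * point K z i) (e i)) (cancel (point K z i)))) j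

    point-integral : ∀ y → IsLatticePoint (point K y) → IsLatticePoint y
    point-integral y lattice = recover IsIntegral (λ a b → integral-+ a (integral-neg b)) (value K y)
      (ℤ.+ 0 , refl) (ℤ.+ k , refl) lattice

    Normal-bounds : Vecℚ d → Set
    Normal-bounds x = (∀ j → rank j ≡ 1 → - x j ≤ 1ℚ) × (∀ j → suc (rank j) ≡ k → x j ≤ 1ℚ) ×
                      (∀ i j → R i j → x i - x j ≤ 1ℚ)

    -- Only elements of extreme rank are bounded directly. From any other element one walks along
    -- covers, down to rank 1 or up to rank k - 1, and `y` is monotone on the way. The descent is by
    -- the rank, the ascent by a bound `n` on k - rank.
    bounds⇒feasible : ∀ {x} → Normal-bounds x → Feasible K (λ j → x j + ρ j)
    bounds⇒feasible {x} (low , high , cover) = mono , (λ j → 0≤y (rank j) j refl) , (λ j → y≤K k j (ℕ.m≤m+n k (rank j)))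
      where
      y : Vecℚ d
      y j = x j + ρ j
      mono : ∀ i j → R i j → y i ≤ y j
      mono i j r = subst (λ t → y i ≤ x j + t) (sym (ρ-suc r)) (linear (cover i j r) (lemma (x i) (x j) (ρ i)))
        where
        lemma : ∀ a b t → (a + t) + 1ℚ ≡ (b + (1ℚ + t)) + (a - b)
        lemma = solve-∀ ℚ-ring
      0≤y : ∀ n j → rank j ≡ n → 0ℚ ≤ y j
      0≤y n j e with lower j
      ... | inj₁ r≡1 = subst (λ t → 0ℚ ≤ x j + ℕ→ℚ t) (sym r≡1) (linear (low j r≡1) (lemma (x j)))
        where
        lemma : ∀ a → 0ℚ + 1ℚ ≡ (a + 1ℚ) + (- a)
        lemma = solve-∀ ℚ-ring
      0≤y zero j e | inj₂ (i , r) with () ← trans (sym e) (rank-suc r)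
      0≤y (suc n) j e | inj₂ (i , r) = ≤-trans (0≤y n i (ℕ.suc-injective (trans (sym (rank-suc r)) e))) (mono i j r)
      y≤K : ∀ n j → k ℕ.≤ n ℕ.+ rank j → y j ≤ K
      y≤K n j k≤ with upper j
      ... | inj₁ r+1≡k = subst (y j ≤_) (trans (sym (ℕ→ℚ-suc (rank j))) (cong ℕ→ℚ r+1≡k))
                           (+-monoˡ-≤ (ρ j) (high j r+1≡k))
      y≤K zero j k≤ | inj₂ _ = contradiction (rank<k j) (ℕ.≤⇒≯ k≤)
      y≤K (suc n) j k≤ | inj₂ (i , r) = ≤-trans (mono j i r)
        (y≤K n i (subst (k ℕ.≤_) (trans (sym (ℕ.+-suc n (rank j))) (cong (n ℕ.+_) (sym (rank-suc r)))) k≤))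

    feasible⇒bounds : ∀ {x} → Feasible K (λ j → x j + ρ j) → Normal-bounds x
    feasible⇒bounds {x} (mono , low , high) =
      (λ j r≡1 → linear (subst (λ t → 0ℚ ≤ x j + ℕ→ℚ t) r≡1 (low j)) (lem₁ (x j))) ,
      (λ j r+1≡k → linear (subst (x j + ρ j ≤_) (trans (cong ℕ→ℚ (sym r+1≡k)) (ℕ→ℚ-suc (rank j))) (high j))
                     (lem₂ (x j) (ρ j))) ,
      (λ i j r → linear (subst (λ t → x i + ρ i ≤ x j + t) (ρ-suc r) (mono i j r)) (lem₃ (x i) (x j) (ρ i)))
      where
      lem₁ : ∀ a → - a + (a + 1ℚ) ≡ 1ℚ + 0ℚ
      lem₁ = solve-∀ ℚ-ring
      lem₂ : ∀ a t → a + (1ℚ + t) ≡ 1ℚ + (a + t)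
      lem₂ = solve-∀ ℚ-ring
      lem₃ : ∀ a b t → (a - b) + (b + (1ℚ + t)) ≡ 1ℚ + (a + t)
      lem₃ = solve-∀ ℚ-ring

    Q : Region (Fin d)
    Q x = P (apply chart x)

    bounds⇒Q : ∀ {x} → Normal-bounds x → Q x
    bounds⇒Q {x} h = feasible⇒P (apply-chart x) (bounds⇒feasible h)

    Q⇒bounds : ∀ {x} → Q x → Normal-bounds x
    Q⇒bounds {x} x∈Q =
      let (y , e , mono , low , high) = P⇒feasible x∈Q
          y≐ = point-injective {y} {λ j → x j + ρ j} (λ i → trans (sym (e i)) (apply-chart x i))
      in  feasible⇒bounds
            ( (λ i j r → subst₂ _≤_ (y≐ i) (y≐ j) (mono i j r))
            , (λ j → subst (0ℚ ≤_) (y≐ j) (low j))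
            , (λ j → subst (_≤ K) (y≐ j) (high j)) )

    box⇒Q : ∀ x → (∀ j → ∣ x j ∣ ≤ ½) → Q x
    box⇒Q x small = bounds⇒Q
      ( (λ j _ → ≤-trans (neg≤½ j) ½≤1)
      , (λ j _ → ≤-trans (≤½ j) ½≤1)
      -- The cover inequalities involve two coordinates, which is why the box has radius ½.
      , (λ i j _ → +-mono-≤ (≤½ i) (neg≤½ j)) )
      where
      ½≤1 : ½ ≤ 1ℚ
      ½≤1 = toWitness {a? = ½ ≤? 1ℚ} _
      ≤½ : ∀ j → x j ≤ ½
      ≤½ j = ≤-trans (p≤∣p∣ (x j)) (small j)
      neg≤½ : ∀ j → - x j ≤ ½
      neg≤½ j = ≤-trans (subst (- x j ≤_) (∣-p∣≡∣p∣ (x j)) (p≤∣p∣ (- x j))) (small j)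

    bound : ∀ {d} (x : Vecℚ d) → ∃ λ B → 0ℚ < B × ∀ j → ∣ x j ∣ ≤ B
    bound {zero}  x = 1ℚ , 0<1 , λ ()
    bound {suc d} x =
      let (B , 0<B , h) = bound (x ∘ F.suc)
      in  ∣ x F.zero ∣ + B , +-mono-≤-< (0≤∣p∣ (x F.zero)) 0<B ,
          λ { F.zero    → linear (<⇒≤ 0<B) (lemma ∣ x F.zero ∣ B)
            ; (F.suc j) → ≤-trans (h j) (linear (0≤∣p∣ (x F.zero)) (lemma′ B ∣ x F.zero ∣)) }
      where
      lemma : ∀ a b → a + b ≡ (a + b) + 0ℚ
      lemma = solve-∀ ℚ-ring
      lemma′ : ∀ b a → b + a ≡ (a + b) + 0ℚ
      lemma′ = solve-∀ ℚ-ring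

    -- x = N (x / N) + (1 − N) 0 with x / N in the box.
    image⊆Aff : ∀ x → Aff P (apply chart x)
    image⊆Aff x = build (bound x)
      where
      build : (∃ λ B → 0ℚ < B × ∀ j → ∣ x j ∣ ≤ B) → Aff P (apply chart x)
      build (B , 0<B , x≤B) = go (reciprocal 0<B)
        where
        go : (∃ λ c → 0ℚ < c × c * B ≡ 1ℚ) → Aff P (apply chart x)
        go (c , 0<c , cB≡1) =
          (N , apply chart x′) ∷ (1ℚ - N , apply chart zeroP) ∷ [] ,
          box⇒Q x′ small ∷ box⇒Q zeroP (λ _ → toWitness {a? = 0ℚ ≤? ½} _) ∷ [] ,
          lem₁ N ,
          λ i → sym (affine i)
          where
          N = (1ℚ + 1ℚ) * B
          x′ : Vecℚ d
          x′ j = (½ * c) * x j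
          instance
            ½c≥0 : NonNegative (½ * c)
            ½c≥0 = nonNegative (*-nonneg (toWitness {a? = 0ℚ ≤? ½} _) (<⇒≤ 0<c))
          lem₁ : ∀ N → N + ((1ℚ - N) + 0ℚ) ≡ 1ℚ
          lem₁ = solve-∀ ℚ-ring
          assoc : ∀ B c → (½ * c) * B ≡ ½ * (c * B)
          assoc = solve-∀ ℚ-ring
          small : ∀ j → ∣ x′ j ∣ ≤ ½
          small j = begin
            ∣ (½ * c) * x j ∣        ≡⟨ ∣p*q∣≡∣p∣*∣q∣ (½ * c) (x j) ⟩
            ∣ ½ * c ∣ * ∣ x j ∣      ≡⟨ cong (_* ∣ x j ∣) (0≤p⇒∣p∣≡p (nonNegative⁻¹ (½ * c))) ⟩
            (½ * c) * ∣ x j ∣        ≤⟨ *-monoˡ-≤-nonNeg (½ * c) (x≤B j) ⟩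
            (½ * c) * B              ≡⟨ assoc B c ⟩
            ½ * (c * B)              ≡⟨ cong (_*_ ½) cB≡1 ⟩
            ½ * 1ℚ                   ≡⟨ *-identityʳ ½ ⟩
            ½                        ∎
            where open ≤-Reasoning
          affine : ∀ i → combo ((N , apply chart x′) ∷ (1ℚ - N , apply chart zeroP) ∷ []) i ≡ apply chart x i
          affine i = begin
            N * (b + dot x′ v) + ((1ℚ - N) * (b + dot zeroP v) + 0ℚ)
              ≡⟨ cong₂ (λ s t → N * (b + s) + ((1ℚ - N) * (b + t) + 0ℚ))
                   (trans (dot-comm x′ v) (trans (dot-*ʳ v x (½ * c)) (cong (_*_ (½ * c)) (dot-comm v x))))
                   (dot-zeroˡ v) ⟩
            N * (b + (½ * c) * dot x v) + ((1ℚ - N) * (b + 0ℚ) + 0ℚ)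
              ≡⟨ lem₂ b (dot x v) c B ⟩
            b + (c * B) * dot x v
              ≡⟨ cong (λ t → b + t * dot x v) cB≡1 ⟩
            b + 1ℚ * dot x v
              ≡⟨ cong (_+_ b) (*-identityˡ (dot x v)) ⟩
            b + dot x v ∎
            where
            open ≡-Reasoning
            b = ℤ→ℚ (AffMap.base chart i)
            v : Vecℚ d
            v j = ℤ→ℚ (AffMap.cols chart j i)
            lem₂ : ∀ b t c B → ((1ℚ + 1ℚ) * B) * (b + (½ * c) * t) + ((1ℚ - (1ℚ + 1ℚ) * B) * (b + 0ℚ) + 0ℚ) ≡
                               b + (c * B) * t
            lem₂ = solve-∀ ℚ-ring

    Aff⊆image : ∀ z → Aff P z → ∃ λ x → apply chart x ≐ z
    Aff⊆image z (ws , ws⊆P , total , z≐) =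
      let (y , e) = lift-P ws ws⊆P
      in  (λ j → y j - ρ j) ,
          λ i → trans (apply-chart (λ j → y j - ρ j) i)
                (trans (point-cong (sym (trans (cong (_* K) total) (*-identityˡ K))) (λ j → lemma (y j) (ρ j)) i)
                       (sym (trans (z≐ i) (e i))))
      where
      lemma : ∀ a b → (a - b) + b ≡ a
      lemma = solve-∀ ℚ-ring

    isLatticeChart : IsLatticeChart chart P
    isLatticeChart =
      (λ x y e j → +-cancelʳ (ρ j) (x j) (y j)
        (point-injective {λ j → x j + ρ j} {λ j → y j + ρ j}
          (λ i → trans (sym (apply-chart x i)) (trans (e i) (apply-chart y i))) j)) ,
      image⊆Aff , Aff⊆image ,
      λ x lattice j → subst IsIntegral (lemma (x j) (ρ j))
        (integral-+ (point-integral (λ j → x j + ρ j) (λ i → subst IsIntegral (apply-chart x i) (lattice i)) j)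
                    (integral-neg (ℤ.+ rank j , refl)))
      where
      lemma : ∀ a b → (a + b) - b ≡ a
      lemma = solve-∀ ℚ-ring
      +-cancelʳ : ∀ c a b → a + c ≡ b + c → a ≡ b
      +-cancelʳ c a b e = trans (sym (lemma a c)) (trans (cong (_- c) e) (lemma b c))

    -- Facet normals and the polar dual

    lowerNormal upperNormal : Fin d → Vecℚ d
    lowerNormal j i = ℤ→ℚ (ℤ.- δ i j)
    upperNormal j i = ℤ→ℚ (δ i j)

    coverNormal : Fin d × Fin d → Vecℚ d
    coverNormal (i , j) e = ℤ→ℚ (δ e i ℤ.- δ e j)

    lowerNormals upperNormals coverNormals normals : List (Vecℚ d)
    lowerNormals = map lowerNormal (filter (λ j → rank j ℕ.≟ 1) (allFin d))
    upperNormals = map upperNormal (filter (λ j → suc (rank j) ℕ.≟ k) (allFin d))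
    coverNormals = map coverNormal (filter (uncurry R?) (cartesianProduct (allFin d) (allFin d)))
    normals      = lowerNormals ++ upperNormals ++ coverNormals

    All-normals : ∀ {Pr : Vecℚ d → Set} → (∀ j → rank j ≡ 1 → Pr (lowerNormal j)) →
                  (∀ j → suc (rank j) ≡ k → Pr (upperNormal j)) →
                  (∀ i j → R i j → Pr (coverNormal (i , j))) → All Pr normals
    All-normals f g h =
      All.++⁺ (All.map⁺ (All.map (f _) (All.all-filter _ (allFin d))))
      (All.++⁺ (All.map⁺ (All.map (g _) (All.all-filter _ (allFin d))))
               (All.map⁺ (All.map (h _ _) (All.all-filter _ (cartesianProduct (allFin d) (allFin d))))))

    dot-upper : ∀ j x → dot (upperNormal j) x ≡ x j
    dot-upper j x = trans (dot-comm (upperNormal j) x) (sumFin-δ x j)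

    dot-cover : ∀ i j x → dot (coverNormal (i , j)) x ≡ x i - x j
    dot-cover i j x = begin
      dot (coverNormal (i , j)) x
        ≡⟨ dot-cong {y = x} (λ e → trans (ℤ→ℚ-- (δ e i) (δ e j)) (lemma (ℤ→ℚ (δ e i)) (ℤ→ℚ (δ e j)))) (λ _ → refl) ⟩
      dot (λ e → upperNormal i e + (- 1ℚ) * upperNormal j e) x
        ≡⟨ dot-+*ˡ (upperNormal i) (upperNormal j) x (- 1ℚ) ⟩
      dot (upperNormal i) x + (- 1ℚ) * dot (upperNormal j) x
        ≡⟨ cong₂ (λ a b → a + (- 1ℚ) * b) (dot-upper i x) (dot-upper j x) ⟩
      x i + (- 1ℚ) * x j
        ≡⟨ lemma (x i) (x j) ⟨
      x i - x j ∎
      where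
      open ≡-Reasoning
      lemma : ∀ a b → a - b ≡ a + (- 1ℚ) * b
      lemma = solve-∀ ℚ-ring

    dot-lower : ∀ j x → dot (lowerNormal j) x ≡ - x j
    dot-lower j x = begin
      dot (lowerNormal j) x
        ≡⟨ dot-cong {y = x} (λ e → trans (ℤ→ℚ-neg (δ e j)) (lemma (ℤ→ℚ (δ e j)))) (λ _ → refl) ⟩
      dot (λ e → 0ℚ + (- 1ℚ) * upperNormal j e) x
        ≡⟨ dot-+*ˡ zeroP (upperNormal j) x (- 1ℚ) ⟩
      dot zeroP x + (- 1ℚ) * dot (upperNormal j) x
        ≡⟨ cong₂ (λ a b → a + (- 1ℚ) * b) (dot-zeroˡ x) (dot-upper j x) ⟩
      0ℚ + (- 1ℚ) * x j
        ≡⟨ lemma (x j) ⟨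
      - x j ∎
      where
      open ≡-Reasoning
      lemma : ∀ b → - b ≡ 0ℚ + (- 1ℚ) * b
      lemma = solve-∀ ℚ-ring

    normals⇒bounds : ∀ {x} → All (λ w → dot w x ≤ 1ℚ) normals → Normal-bounds x
    normals⇒bounds {x} h =
      (λ j e → subst (_≤ 1ℚ) (dot-lower j x)
        (All.lookup h (∈-++⁺ˡ (∈-map⁺ lowerNormal (∈-filter⁺ (λ j → rank j ℕ.≟ 1) (∈-allFin j) e))))) ,
      (λ j e → subst (_≤ 1ℚ) (dot-upper j x)
        (All.lookup h (∈-++⁺ʳ lowerNormals (∈-++⁺ˡ
          (∈-map⁺ upperNormal (∈-filter⁺ (λ j → suc (rank j) ℕ.≟ k) (∈-allFin j) e)))))) ,
      (λ i j e → subst (_≤ 1ℚ) (dot-cover i j x)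
        (All.lookup h (∈-++⁺ʳ lowerNormals (∈-++⁺ʳ upperNormals (∈-map⁺ coverNormal
          (∈-filter⁺ (uncurry R?) (∈-cartesianProduct⁺ (∈-allFin i) (∈-allFin j)) e))))))

    bounds⇒normals : ∀ {x} → Normal-bounds x → All (λ w → dot w x ≤ 1ℚ) normals
    bounds⇒normals {x} (low , high , cover) = All-normals
      (λ j e → subst (_≤ 1ℚ) (sym (dot-lower j x)) (low j e))
      (λ j e → subst (_≤ 1ℚ) (sym (dot-upper j x)) (high j e))
      (λ i j e → subst (_≤ 1ℚ) (sym (dot-cover i j x)) (cover i j e))

    -- A point outside the hull is separated by some `y` that satisfies all facet inequalities; this
    -- `y` is itself a point of `Q` and contradicts the polar condition.
    polar⇒hull : ∀ x → (∀ y → Q y → dot x y ≤ 1ℚ) → Conv (_∈ (zeroP ∷ normals)) x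
    polar⇒hull x polar with hull⊎separated normals x
    ... | inj₁ hull = hull
    ... | inj₂ (y , Wy≤1 , xy>1) =
      contradiction (polar y (bounds⇒Q (normals⇒bounds Wy≤1))) (<⇒≱ xy>1)

    hull⇒polar : ∀ x → Conv (_∈ (zeroP ∷ normals)) x → ∀ y → Q y → dot x y ≤ 1ℚ
    hull⇒polar x (ws , nonneg , ws⊆W , total , x≐) y y∈Q =
      subst₂ _≤_ (dot-cong {y = y} (sym ∘ x≐) (λ _ → refl)) total
        (dot-combo-≤ ws y nonneg (All.map (All.lookup Wy≤1) ws⊆W))
      where
      Wy≤1 : All (λ w → dot w y ≤ 1ℚ) (zeroP ∷ normals)
      Wy≤1 = subst (_≤ 1ℚ) (sym (dot-zeroˡ y)) 0≤1 ∷ bounds⇒normals (Q⇒bounds y∈Q)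

    isGorenstein : IsGorenstein (Conv V)
    isGorenstein = k , 1≤k , d , chart , isLatticeChart ,
      (½ , positive⁻¹ ½ , box⇒Q) ,
      zeroP ∷ normals ,
      (λ _ → ℤ.+ 0 , refl) ∷ All-normals (λ j _ i → ℤ.- δ i j , refl) (λ j _ i → δ i j , refl) (λ i j _ e → δ e i ℤ.- δ e j , refl) ,
      λ x → mk⇔ (polar⇒hull x) (hull⇒polar x)

open OrderPolytope using (ℚ-ring; χ; Node; bot; top; elt; value; Entries; GradedModel; isGorenstein)
open import Data.Bool using (Bool; true; false; T)
open import Data.Empty using (⊥; ⊥-elim)
open import Data.Fin as F using (Fin; toℕ; fromℕ<; splitAt; _↑ˡ_; _↑ʳ_)
open import Data.Fin.Permutation
  using (Permutation′; permutation; _⟨$⟩ʳ_; _⟨$⟩ˡ_; inverseˡ; inverseʳ; reverse; flip; _∘ₚ_)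
import Data.Fin.Properties as F
open import Data.Nat
  using (zero; suc; _+_; _*_; _∸_; _⊓_; _≤_; _<_; z≤n; s≤s; s≤s⁻¹; ⌊_/2⌋; _%_)
open import Data.Nat.DivMod using ([m+kn]%n≡m%n)
open import Data.Nat.Induction using (<-wellFounded)
open import Data.Nat.Properties
open import Data.Nat.Tactic.RingSolver using (solve-∀)
open import Data.Product using (∃; _,_; proj₁; proj₂)
open import Data.Rational as ℚ using (ℚ; 0ℚ; 1ℚ)
import Data.Rational.Properties as ℚ
open import Data.Sum using (_⊎_; inj₁; inj₂; [_,_]′)
open import Function using (_∘_; id)
open import Induction.WellFounded using (Acc; acc)
open import Relation.Binary.Definitions using (tri<; tri≈; tri>)
open import Relation.Binary.PropositionalEquality
open import Relation.Nullary using (¬_; Dec; yes; no; contradiction)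
open import Relation.Nullary.Decidable using (_×-dec_; _⊎-dec_; ⌊_⌋; toWitness; fromWitness)
import Tactic.RingSolver as ℚ-Tactic

-- Lattice paths

-- The equation is a semiring identity, left to the solver; s is the slack.
linearℕ : ∀ {a b A B} s → a ≤ b → A + b + s ≡ B + a → A ≤ B
linearℕ {a} {b} {A} {B} s a≤b e = +-cancelʳ-≤ a A B (begin
  A + a        ≤⟨ +-monoʳ-≤ A a≤b ⟩
  A + b        ≤⟨ m≤m+n (A + b) s ⟩
  A + b + s    ≡⟨ e ⟩
  B + a        ∎)
  where open ≤-Reasoning

-- The pairs (i , c) with c < i < m are numbered row by row.
triangle : ℕ → ℕ
triangle zero    = 0
triangle (suc m) = triangle m + m

decode : ∀ m → Fin (triangle m) → ℕ × ℕ
decode (suc m) j = [ decode m , (λ c → m , toℕ c) ]′ (splitAt (triangle m) j)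

decode-bounds : ∀ m j → let (i , c) = decode m j in c < i × i < m
decode-bounds (suc m) j with splitAt (triangle m) j
... | inj₁ j′ = let (c<i , i<m) = decode-bounds m j′ in c<i , m<n⇒m<1+n i<m
... | inj₂ c  = F.toℕ<n c , ≤-refl

decode-injective : ∀ m {j j′} → decode m j ≡ decode m j′ → j ≡ j′
decode-injective (suc m) {j} {j′} e with splitAt (triangle m) j in eq | splitAt (triangle m) j′ in eq′
... | inj₁ a | inj₁ b = trans (sym (F.splitAt⁻¹-↑ˡ eq)) (trans (cong (_↑ˡ m) (decode-injective m e)) (F.splitAt⁻¹-↑ˡ eq′))
... | inj₁ a | inj₂ b = contradiction (cong proj₁ e) (<⇒≢ (proj₂ (decode-bounds m a)))
... | inj₂ a | inj₁ b = contradiction (cong proj₁ (sym e)) (<⇒≢ (proj₂ (decode-bounds m b)))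
... | inj₂ a | inj₂ b = trans (sym (F.splitAt⁻¹-↑ʳ eq)) (trans (cong (triangle m ↑ʳ_) (F.toℕ-injective (cong proj₂ e))) (F.splitAt⁻¹-↑ʳ eq′))

encode : ∀ m {i c} → c < i → i < m → Fin (triangle m)
encode (suc m) {i} {c} c<i i<1+m with i ≟ m
... | yes refl = triangle m ↑ʳ fromℕ< c<i
... | no  i≢m  = encode m c<i (≤∧≢⇒< (s≤s⁻¹ i<1+m) i≢m) ↑ˡ m

decode-encode : ∀ m {i c} (c<i : c < i) (i<m : i < m) → decode m (encode m c<i i<m) ≡ (i , c)
decode-encode (suc m) {i} {c} c<i i<1+m with i ≟ m
... | yes refl rewrite F.splitAt-↑ʳ (triangle m) m (fromℕ< c<i) = cong (m ,_) (F.toℕ-fromℕ< c<i)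
... | no  i≢m  rewrite F.splitAt-↑ˡ (triangle m) (encode m c<i (≤∧≢⇒< (s≤s⁻¹ i<1+m) i≢m)) m = decode-encode m c<i _

record IsPath (b : ℕ → ℕ) : Set where
  field
    start : b 0 ≡ 0
    step  : ∀ t → b (suc t) ≡ b t ⊎ b (suc t) ≡ suc (b t)

  step-≤ : ∀ t → b t ≤ b (suc t)
  step-≤ t with step t
  ... | inj₁ e = ≤-reflexive (sym e)
  ... | inj₂ e = ≤-trans (n≤1+n _) (≤-reflexive (sym e))

  step-≤-suc : ∀ t → b (suc t) ≤ suc (b t)
  step-≤-suc t with step t
  ... | inj₁ e = ≤-trans (≤-reflexive e) (n≤1+n _)
  ... | inj₂ e = ≤-reflexive e

  from-≤ : ∀ {t t′} → t ≤ t′ → b t ≤ b t′ × b t′ + t ≤ b t + t′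
  from-≤ {t} {t′} t≤t′ with m≤n⇒∃[o]m+o≡n t≤t′
  ... | o , refl = go o
    where
    go : ∀ o → b t ≤ b (t + o) × b (t + o) + t ≤ b t + (t + o)
    go zero    rewrite +-identityʳ t = ≤-refl , ≤-refl
    go (suc o) rewrite +-suc t o =
      let (h , g) = go o in
      ≤-trans h (step-≤ (t + o)) ,
      linearℕ 0 (+-mono-≤ (step-≤-suc (t + o)) g) (lemma (b (suc (t + o))) (b (t + o)) (b t) t o)
      where
      lemma : ∀ B′ B C t o → (B′ + t) + (suc B + (C + (t + o))) + 0 ≡ (C + suc (t + o)) + (B′ + (B + t))
      lemma = solve-∀

  mono : ∀ {t t′} → t ≤ t′ → b t ≤ b t′
  mono = proj₁ ∘ from-≤

  -- The number t - b t of high letters is monotone too, here written without subtraction.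
  slope : ∀ {t t′} → t ≤ t′ → b t′ + t ≤ b t + t′
  slope = proj₂ ∘ from-≤

  b≤ : ∀ t → b t ≤ t
  b≤ t = subst₂ _≤_ (+-identityʳ (b t)) (cong (_+ t) start) (slope z≤n)

firstFalse : (ℕ → Bool) → ℕ → ℕ
firstFalse f zero    = 0
firstFalse f (suc n) with f 0
... | true  = suc (firstFalse (f ∘ suc) n)
... | false = 0

-- A decreasing predicate that fails at `n` holds exactly on an initial segment, whose length will
-- be the value of a path.
firstFalse-⇔ : ∀ f n → (∀ c → T (f (suc c)) → T (f c)) → ¬ T (f n) →
               ∀ c → (c < firstFalse f n → T (f c)) × (T (f c) → c < firstFalse f n)
firstFalse-⇔ f zero    dec ¬fn c = (λ ()) , λ fc → contradiction (descend c fc) ¬fn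
  where
  descend : ∀ c → T (f c) → T (f 0)
  descend zero    h = h
  descend (suc c) h = descend c (dec c h)
firstFalse-⇔ f (suc n) dec ¬fn c with f 0 in eq
... | false = (λ ()) , λ fc → contradiction (descend c fc) (subst (λ x → ¬ T x) (sym eq) id)
  where
  descend : ∀ c → T (f c) → T (f 0)
  descend zero    h = h
  descend (suc c) h = descend c (dec c h)
firstFalse-⇔ f (suc n) dec ¬fn zero    | true = (λ _ → subst T (sym eq) _) , (λ _ → s≤s z≤n)
firstFalse-⇔ f (suc n) dec ¬fn (suc c) | true =
  let (h , g) = firstFalse-⇔ (f ∘ suc) n (dec ∘ suc) ¬fn c in (h ∘ s≤s⁻¹) , (s≤s ∘ g)

-- `up` followed by `diagonal` shows that each row `Z t` is decreasing in c, and repeated diagonal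
-- steps from (t, t) to (0, 0) that it fails at c = t. So each row is an initial segment. Its length
-- cannot shrink, by `up`, and grows by at most 1, by `diagonal`.
grid⇒path : (Z : ℕ → ℕ → Bool) → (∀ c → ¬ T (Z 0 c)) → (∀ t c → T (Z t c) → T (Z (suc t) c)) →
            (∀ t c → T (Z (suc t) (suc c)) → T (Z t c)) →
            ∃ λ b → IsPath b × (∀ t c → (c < b t → T (Z t c)) × (T (Z t c) → c < b t))
grid⇒path Z empty up diagonal = b , record { start = refl ; step = step } , correct
  where
  ¬diagonal : ∀ t → ¬ T (Z t t)
  ¬diagonal zero    = empty 0
  ¬diagonal (suc t) = ¬diagonal t ∘ diagonal t t
  b : ℕ → ℕ
  b t = firstFalse (Z t) t
  correct : ∀ t c → (c < b t → T (Z t c)) × (T (Z t c) → c < b t)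
  correct t = firstFalse-⇔ (Z t) t (λ c → diagonal t c ∘ up t (suc c)) (¬diagonal t)
  step : ∀ t → b (suc t) ≡ b t ⊎ b (suc t) ≡ suc (b t)
  step t with <-cmp (b (suc t)) (suc (b t))
  ... | tri< lt _ _ = inj₁ (≤-antisym (s≤s⁻¹ lt) (≮⇒≥ λ gt →
          <-irrefl refl (proj₂ (correct (suc t) _) (up t _ (proj₁ (correct t _) gt)))))
  ... | tri≈ _ eq _ = inj₂ eq
  ... | tri> _ _ gt = contradiction
          (proj₂ (correct t (b t)) (diagonal t (b t) (proj₁ (correct (suc t) (suc (b t))) gt))) (<-irrefl refl)

-- Permutations spelled by paths

injective⇒permutation : ∀ {n} (f : Fin n → Fin n) → (∀ {x y} → f x ≡ f y → x ≡ y) →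
                        ∃ λ (π : Permutation′ n) → ∀ x → π ⟨$⟩ʳ x ≡ f x
injective⇒permutation {zero}  f inj = permutation f f (λ ()) (λ ()) , λ _ → refl
injective⇒permutation {suc n} f inj =
  permutation f (proj₁ ∘ hit) (proj₂ ∘ hit) (λ x → inj (proj₂ (hit (f x)))) , λ _ → refl
  where
  hit : ∀ y → ∃ λ x → f x ≡ y
  hit y with F.any? (λ x → f x F.≟ y)
  ... | yes h = h
  -- Pigeonhole: punching out a missed value would inject `Fin (suc n)` into `Fin n`.
  ... | no ¬h = contradiction
    (F.injective⇒≤ {f = λ x → F.punchOut (avoid x)} (λ {x} {x′} e → inj (F.punchOut-injective (avoid x) (avoid x′) e)))
    1+n≰n
    where
    avoid : ∀ x → y ≢ f x
    avoid x e = ¬h (x , sym e)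

module _ {n} (f : Fin n → Fin n) where

  row : ℕ → ℕ
  row t with t <? n
  ... | yes t<n = toℕ (f (fromℕ< t<n))
  ... | no  _   = 0

  row-toℕ : ∀ x → row (toℕ x) ≡ toℕ (f x)
  row-toℕ x with toℕ x <? n
  ... | yes x<n = cong (toℕ ∘ f) (F.fromℕ<-toℕ x x<n)
  ... | no  x≮n = contradiction (F.toℕ<n x) x≮n

-- A permutation is spelled by a path b when, at each time t, it takes the next value of the low
-- chain or the next value of the high chain; b t counts the low letters among the first t.
-- Low-High lets the chains share values, but they can only meet at the last letter.
record Chains (n : ℕ) : Set₁ where
  field
    Low High : ℕ → ℕ → Set
    High?    : ∀ i v → Dec (High i v)
    Low-inj  : ∀ {i j v} → Low i v → Low j v → i ≡ j
    Low-fun  : ∀ {i v w} → Low i v → Low i w → v ≡ w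
    High-inj : ∀ {i j v} → High i v → High j v → i ≡ j
    High-fun : ∀ {i v w} → High i v → High i w → v ≡ w
    Low-High : ∀ {i j v} → Low i v → High j v → n ≤ suc (i + j)

  -- In `high` the index i = t - b t counts the high letters so far; it is kept with its equation to
  -- avoid truncated subtraction.
  data Letter (b : ℕ → ℕ) (t v : ℕ) : Set where
    low  : b (suc t) ≡ suc (b t) → Low (b t) v → Letter b t v
    high : ∀ i → b t + i ≡ t → b (suc t) ≡ b t → High i v → Letter b t v

  Inside : ℕ → ℕ → ℕ → Set
  Inside s t v = (∃ λ i → i < s × Low i v) ⊎ (∃ λ i → s + i < t × High i v)

  Outside : ℕ → ℕ → ℕ → Set
  Outside s t v = (∀ i → Low i v → s ≤ i) × (∀ i → High i v → t ≤ s + i)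

  ¬inside-outside : ∀ {s t v} → Inside s t v → ¬ Outside s t v
  ¬inside-outside (inj₁ (i , i<s , l)) (out , _) = <⇒≱ i<s (out i l)
  ¬inside-outside (inj₂ (i , <t , h))  (_ , out) = <⇒≱ <t (out i h)

  module _ {b} (path : IsPath b) where
    open IsPath path

    letter⇒inside : ∀ {t′ t v} → t′ < t → Letter b t′ v → Inside (b t) t v
    letter⇒inside {t′} {t} t′<t (low e l)      = inj₁ (b t′ , subst (_≤ b t) e (mono t′<t) , l)
    letter⇒inside {t′} {t} t′<t (high i e f h) = inj₂ (i ,
      linearℕ 0 (slope t′<t) (trans (cong₂ (λ x y → suc (b t + i) + (x + t) + y) f refl)
        (trans (lemma (b t) i (b t′) t) (cong (λ x → t + (b t + suc x)) e))) , h)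
      where
      lemma : ∀ b i b′ t → suc (b + i) + (b′ + t) + 0 ≡ t + (b + suc (b′ + i))
      lemma = solve-∀

    -- A letter read at `t′` is the next one of its own chain. If the value lies on the other chain
    -- as well, then `Low-High` and t′ < n put it at or beyond the end of the used part there.
    letter⇒outside : ∀ {t t′ v} → t ≤ t′ → t′ < n → Letter b t′ v → Outside (b t) t v
    letter⇒outside {t} {t′} t≤t′ t′<n (low e l) =
      (λ j l′ → subst (b t ≤_) (Low-inj l l′) (mono t≤t′)) ,
      (λ j h → linearℕ 0 (+-mono-≤ (slope t≤t′) (+-mono-≤ t′<n (Low-High l h))) (lemma (b t) (b t′) t t′ j n))
      where
      lemma : ∀ b b′ t t′ j n → t + ((b + t′) + (n + suc (b′ + j))) + 0 ≡ (b + j) + ((b′ + t) + (suc t′ + n))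
      lemma = solve-∀
    letter⇒outside {t} {t′} t≤t′ t′<n (high i e f h) =
      (λ j l → linearℕ 0 (+-mono-≤ (mono t≤t′) (+-mono-≤ t′<n (Low-High l h)))
        (trans (lemma₁ (b t) (b t′) n j i) (cong (λ x → j + (b t + (suc x + n))) e))) ,
      (λ j h′ → linearℕ 0 (slope t≤t′)
        (trans (cong (λ x → t + (b t + x) + 0) (trans (sym e) (cong (b t′ +_) (High-inj h h′))))
          (lemma₂ t (b t) (b t′) j)))
      where
      lemma₁ : ∀ b b′ n j i → b + (b′ + (n + suc (j + i))) + 0 ≡ j + (b + (suc (b′ + i) + n))
      lemma₁ = solve-∀
      lemma₂ : ∀ t b b′ j → t + (b + (b′ + j)) + 0 ≡ (b + j) + (b′ + t)
      lemma₂ = solve-∀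

    letter-injective : ∀ {t t′ v} → t < n → t′ < n → Letter b t v → Letter b t′ v → t ≡ t′
    letter-injective {t} {t′} t<n t′<n x y with <-cmp t t′
    ... | tri< t<t′ _ _ = contradiction (letter⇒outside ≤-refl t′<n y) (¬inside-outside (letter⇒inside t<t′ x))
    ... | tri≈ _ eq _   = eq
    ... | tri> _ _ t′<t = contradiction (letter⇒outside ≤-refl t<n x) (¬inside-outside (letter⇒inside t′<t y))

    path⇒permutation : (∀ t → t < n → ∃ λ v → v < n × Letter b t v) →
                       ∃ λ (τ : Permutation′ n) → ∀ x → Letter b (toℕ x) (toℕ (τ ⟨$⟩ʳ x))
    path⇒permutation next =
      let (τ , e) = injective⇒permutation f f-injective
      in  τ , λ x → subst (Letter b (toℕ x)) (cong toℕ (sym (e x))) (f-letter x)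
      where
      f : Fin n → Fin n
      f x = fromℕ< (proj₁ (proj₂ (next (toℕ x) (F.toℕ<n x))))
      f-letter : ∀ x → Letter b (toℕ x) (toℕ (f x))
      f-letter x = subst (Letter b (toℕ x)) (sym (F.toℕ-fromℕ< _)) (proj₂ (proj₂ (next (toℕ x) (F.toℕ<n x))))
      f-injective : ∀ {x y} → f x ≡ f y → x ≡ y
      f-injective {x} {y} e = F.toℕ-injective (letter-injective (F.toℕ<n x) (F.toℕ<n y)
        (f-letter x) (subst (Letter b (toℕ y)) (cong toℕ (sym e)) (f-letter y)))

  module _ (word : ℕ → ℕ) where

    turn : ∀ {P : Set} → Dec P → ℕ → ℕ
    turn (yes _) s = s
    turn (no  _) s = suc s

    -- The path is read off the word greedily, with a letter counted as low only if it is not the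
    -- next high value. Where both readings fit, this preference makes the path flat.
    lowCount : ℕ → ℕ
    lowCount zero    = 0
    lowCount (suc t) = turn (High? (t ∸ lowCount t) (word t)) (lowCount t)

    turn-step : ∀ {P : Set} (d : Dec P) s → turn d s ≡ s ⊎ turn d s ≡ suc s
    turn-step (yes _) s = inj₁ refl
    turn-step (no  _) s = inj₂ refl

    lowCount-path : IsPath lowCount
    lowCount-path = record { start = refl ; step = λ t → turn-step (High? (t ∸ lowCount t) (word t)) (lowCount t) }

    lowCount-high : ∀ t → High (t ∸ lowCount t) (word t) → lowCount (suc t) ≡ lowCount t
    lowCount-high t h with High? (t ∸ lowCount t) (word t)
    ... | yes _ = refl
    ... | no ¬h = contradiction h ¬h

    module _ (injective : ∀ {t t′} → t < n → t′ < n → word t ≡ word t′ → t ≡ t′)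
             (next : ∀ t s → t < n → s ≤ t → (∀ t′ → t′ < t → Inside s t (word t′)) →
                     (∀ t′ → t ≤ t′ → t′ < n → Outside s t (word t′)) →
                     Low s (word t) ⊎ High (t ∸ s) (word t)) where

      choose : ∀ t (d : Dec (High (t ∸ lowCount t) (word t))) → lowCount (suc t) ≡ turn d (lowCount t) →
               Low (lowCount t) (word t) ⊎ High (t ∸ lowCount t) (word t) → Letter lowCount t (word t)
      choose t (yes h) e _        = high (t ∸ lowCount t) (m+[n∸m]≡n (IsPath.b≤ lowCount-path t)) e h
      choose t (no ¬h) e (inj₁ l) = low e l
      choose t (no ¬h) e (inj₂ h) = contradiction h ¬h

      -- Both halves go into one induction because `next` uses both: the letters read so far are
      -- inside, the remaining ones outside.
      spell : ∀ t → t ≤ n → (∀ t′ → t′ < t → Letter lowCount t′ (word t′)) ×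
                            (∀ t′ → t ≤ t′ → t′ < n → Outside (lowCount t) t (word t′))
      spell zero    _   = (λ _ ()) , λ _ _ _ → (λ _ _ → z≤n) , (λ _ _ → z≤n)
      spell (suc t) t<n = letters , outside x
        where
        before = proj₁ (spell t (<⇒≤ t<n))
        after  = proj₂ (spell t (<⇒≤ t<n))
        s = lowCount t
        x : Letter lowCount t (word t)
        x = choose t (High? (t ∸ s) (word t)) refl
              (next t s t<n (IsPath.b≤ lowCount-path t)
                (λ t′ t′<t → letter⇒inside lowCount-path t′<t (before t′ t′<t)) after)
        letters : ∀ t′ → t′ < suc t → Letter lowCount t′ (word t′)
        letters t′ t′<1+t with t′ ≟ t
        ... | yes refl = x
        ... | no  t′≢t = before t′ (≤∧≢⇒< (s≤s⁻¹ t′<1+t) t′≢t)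
        -- On the chain just advanced, a later letter could only have kept the old end as its index,
        -- and then it would repeat the letter read at `t`, against `injective`.
        outside : Letter lowCount t (word t) → ∀ t′ → t < t′ → t′ < n → Outside (lowCount (suc t)) (suc t) (word t′)
        outside (low e l) t′ t<t′ t′<n =
          (λ j l′ → subst (_≤ j) (sym e) (≤∧≢⇒< (proj₁ (after t′ (<⇒≤ t<t′) t′<n) j l′)
            λ { refl → <⇒≢ t<t′ (injective t<n t′<n (Low-fun l l′)) })) ,
          (λ j h → subst (λ y → suc t ≤ y + j) (sym e) (s≤s (proj₂ (after t′ (<⇒≤ t<t′) t′<n) j h)))
        outside (high i f e h) t′ t<t′ t′<n =
          (λ j l → subst (_≤ j) (sym e) (proj₁ (after t′ (<⇒≤ t<t′) t′<n) j l)) ,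
          (λ j h′ → subst (λ y → suc t ≤ y + j) (sym e) (≤∧≢⇒< (proj₂ (after t′ (<⇒≤ t<t′) t′<n) j h′)
            λ eq → <⇒≢ t<t′ (injective t<n t′<n
              (High-fun h (subst (λ y → High y (word t′)) (sym (+-cancelˡ-≡ s i j (trans f eq))) h′)))))

      letters : ∀ t → t < n → Letter lowCount t (word t)
      letters t t<n = proj₁ (spell n ≤-refl) t t<n

-- Permutation matrix entries as differences of path statements

𝟙 : ∀ {P : Set} → Dec P → ℚ
𝟙 d = χ ⌊ d ⌋

𝟙-cong : ∀ {P Q : Set} (p? : Dec P) (q? : Dec Q) → (P → Q) → (Q → P) → 𝟙 p? ≡ 𝟙 q?
𝟙-cong (yes p) (yes q) f g = refl
𝟙-cong (yes p) (no ¬q) f g = contradiction (f p) ¬q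
𝟙-cong (no ¬p) (yes q) f g = contradiction (g q) ¬p
𝟙-cong (no ¬p) (no ¬q) f g = refl

𝟙-true : ∀ {P : Set} (p? : Dec P) → P → 𝟙 p? ≡ 1ℚ
𝟙-true (yes _) _ = refl
𝟙-true (no ¬p) p = contradiction p ¬p

𝟙-false : ∀ {P : Set} (p? : Dec P) → ¬ P → 𝟙 p? ≡ 0ℚ
𝟙-false (yes p) ¬p = contradiction p ¬p
𝟙-false (no _)  _  = refl

permMatrix-𝟙 : ∀ {n} (σ : Permutation′ n) i j → permMatrix σ (i , j) ≡ 𝟙 (σ ⟨$⟩ʳ i F.≟ j)
permMatrix-𝟙 σ i j with σ ⟨$⟩ʳ i F.≟ j
... | yes _ = refl
... | no  _ = refl

module _ {b : ℕ → ℕ} (t i : ℕ) where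

  low-flat : b (suc t) ≡ b t → 𝟙 (i <? b (suc t)) ℚ.- 𝟙 (i <? b t) ≡ 0ℚ
  low-flat e rewrite e = ℚ.+-inverseʳ (𝟙 (i <? b t))

  -- In a low step exactly one of the statements i < b changes, the one with i = b t, while all
  -- statements about high letters keep their truth values. In a high step the roles are exchanged,
  -- and the statement that changes has i = t - b t.
  low-jump : b (suc t) ≡ suc (b t) → 𝟙 (i <? b (suc t)) ℚ.- 𝟙 (i <? b t) ≡ 𝟙 (b t ≟ i)
  low-jump e with <-cmp (b t) i
  ... | tri< b<i _ _ = trans
    (cong₂ ℚ._-_ (𝟙-false (i <? b (suc t)) (λ h → <⇒≱ b<i (s≤s⁻¹ (subst (i <_) e h)))) (𝟙-false (i <? b t) (<-asym b<i)))
    (sym (𝟙-false (b t ≟ i) (<⇒≢ b<i)))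
  ... | tri≈ _ refl _ = trans
    (cong₂ ℚ._-_ (𝟙-true (i <? b (suc t)) (≤-reflexive (sym e))) (𝟙-false (i <? b t) (<-irrefl refl)))
    (sym (𝟙-true (b t ≟ i) refl))
  ... | tri> _ _ i<b = trans
    (cong₂ ℚ._-_ (𝟙-true (i <? b (suc t)) (subst (i <_) (sym e) (m<n⇒m<1+n i<b))) (𝟙-true (i <? b t) i<b))
    (sym (𝟙-false (b t ≟ i) (λ eq → <⇒≢ i<b (sym eq))))

  high-flat : b (suc t) ≡ suc (b t) → 𝟙 (t ≤? b t + i) ℚ.- 𝟙 (suc t ≤? b (suc t) + i) ≡ 0ℚ
  high-flat e rewrite e = trans
    (cong (ℚ._- 𝟙 (suc t ≤? suc (b t) + i)) (𝟙-cong (t ≤? b t + i) (suc t ≤? suc (b t) + i) s≤s s≤s⁻¹))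
    (ℚ.+-inverseʳ (𝟙 (suc t ≤? suc (b t) + i)))

  high-jump : b (suc t) ≡ b t → 𝟙 (t ≤? b t + i) ℚ.- 𝟙 (suc t ≤? b (suc t) + i) ≡ 𝟙 (t ≟ b t + i)
  high-jump e with <-cmp t (b t + i)
  ... | tri< t< _ _ = trans
    (cong₂ ℚ._-_ (𝟙-true (t ≤? b t + i) (<⇒≤ t<)) (𝟙-true (suc t ≤? b (suc t) + i) (subst (λ x → t < x + i) (sym e) t<)))
    (sym (𝟙-false (t ≟ b t + i) (<⇒≢ t<)))
  ... | tri≈ _ eq _ = trans
    (cong₂ ℚ._-_ (𝟙-true (t ≤? b t + i) (≤-reflexive eq))
      (𝟙-false (suc t ≤? b (suc t) + i) (λ h → <-irrefl eq (subst (λ x → t < x + i) e h))))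
    (sym (𝟙-true (t ≟ b t + i) eq))
  ... | tri> _ _ >t = trans
    (cong₂ ℚ._-_ (𝟙-false (t ≤? b t + i) (<⇒≱ >t))
      (𝟙-false (suc t ≤? b (suc t) + i) (λ h → <-asym >t (subst (λ x → t < x + i) e h))))
    (sym (𝟙-false (t ≟ b t + i) (λ eq → <⇒≢ >t (sym eq))))

χ-𝟙 : ∀ {P : Set} x (p? : Dec P) → (P → T x) → (T x → P) → χ x ≡ 𝟙 p?
χ-𝟙 true  p? f g = sym (𝟙-true p? (g _))
χ-𝟙 false p? f g = sym (𝟙-false p? f)

truth : ∀ {d} → (Fin d → Bool) → Node d → Bool
truth F bot     = false
truth F top     = true
truth F (elt j) = F j

value-truth : ∀ {d} (F : Fin d → Bool) a → value 1ℚ (χ ∘ F) a ≡ χ (truth F a)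
value-truth F bot     = refl
value-truth F top     = refl
value-truth F (elt j) = refl

-- Pairs off the triangle get the false statement by default. This is right for c ≥ i in both
-- classes; large i is handled where nodes are looked up, by clamping the time or by switching to
-- `top`.
node : ∀ m → ℕ → ℕ → Node (triangle m)
node m i c with c <? i | i <? m
... | yes c<i | yes i<m = elt (encode m c<i i<m)
... | _       | _       = bot

node-decode : ∀ m j {i c} → decode m j ≡ (i , c) → node m i c ≡ elt j
node-decode m j {i} {c} e with c <? i | i <? m
... | yes c<i | yes i<m = cong elt (decode-injective m (trans (decode-encode m c<i i<m) (sym e)))
... | yes _   | no i≮m  = contradiction (subst (_< m) (cong proj₁ e) (proj₂ (decode-bounds m j))) i≮m
... | no c≮i  | _       = contradiction (subst₂ _<_ (cong proj₂ e) (cong proj₁ e) (proj₁ (decode-bounds m j))) c≮i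

truth-node : ∀ m F {i c} → T (truth F (node m i c)) → ∃ λ j → decode m j ≡ (i , c) × T (F j)
truth-node m F {i} {c} h with c <? i | i <? m
... | yes c<i | yes i<m = encode m c<i i<m , decode-encode m c<i i<m , h

value-node : ∀ m (g : ℕ × ℕ → ℚ) {i c} → (c < i → ¬ i < m → g (i , c) ≡ 0ℚ) → (¬ c < i → g (i , c) ≡ 0ℚ) →
             value 1ℚ (g ∘ decode m) (node m i c) ≡ g (i , c)
value-node m g {i} {c} beyond beside with c <? i | i <? m
... | yes c<i | yes i<m = cong g (decode-encode m c<i i<m)
... | yes c<i | no i≮m  = sym (beyond c<i i≮m)
... | no c≮i  | _       = sym (beside c≮i)

-- If N t c stands for the statement c < b t, then highNode N t i stands for t ≤ b t + i: at most
-- i of the first t letters are high.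
highNode : ∀ {d} → (ℕ → ℕ → Node d) → ℕ → ℕ → Node d
highNode N t i with t ≤? i
... | yes _ = top
... | no  _ = N t (t ∸ suc i)

Represents : ∀ {d} → ℕ → (ℕ → ℕ → Node d) → (Fin d → Bool) → (ℕ → ℕ) → Set
Represents n N F b = ∀ t c → t ≤ n → value 1ℚ (χ ∘ F) (N t c) ≡ 𝟙 (c <? b t)

-- For t > i the inequality t ≤ b t + i is t - (i + 1) < b t; for t ≤ i it always holds.
represents-high : ∀ {d n} {N : ℕ → ℕ → Node d} {F b} → Represents n N F b → ∀ t i → t ≤ n →
                  value 1ℚ (χ ∘ F) (highNode N t i) ≡ 𝟙 (t ≤? b t + i)
represents-high {b = b} rep t i t≤n with t ≤? i
... | yes t≤i = sym (𝟙-true (t ≤? b t + i) (≤-trans t≤i (m≤n+m i (b t))))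
... | no  t≰i = trans (rep t c t≤n) (𝟙-cong (c <? b t) (t ≤? b t + i)
    (λ h → subst (_≤ b t + i) e (linearℕ 0 h (lemma₁ i c (b t))))
    (λ h → linearℕ 0 (subst (_≤ b t + i) (sym e) h) (lemma₂ i c (b t))))
  where
  c = t ∸ suc i
  e : suc i + c ≡ t
  e = m+[n∸m]≡n (≰⇒> t≰i)
  lemma₁ : ∀ i c b → suc (i + c) + b + 0 ≡ (b + i) + suc c
  lemma₁ = solve-∀
  lemma₂ : ∀ i c b → suc c + (b + i) + 0 ≡ b + suc (i + c)
  lemma₂ = solve-∀

represents-truth : ∀ {d} n (N : ℕ → ℕ → Node d) F {b} →
                   (∀ t c → (c < b t → T (truth F (N t c))) × (T (truth F (N t c)) → c < b t)) →
                   Represents n N F b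
represents-truth n N F {b} h t c _ =
  trans (value-truth F (N t c)) (χ-𝟙 (truth F (N t c)) (c <? b t) (proj₁ (h t c)) (proj₂ (h t c)))

-- Cover relations between the statements "c < b t" about a path b.
Cover : ℕ × ℕ → ℕ × ℕ → Set
Cover (t , c) (t′ , c′) = (t′ ≡ suc t × c′ ≡ c) ⊎ (t ≡ suc t′ × c ≡ suc c′)

Cover? : ∀ x y → Dec (Cover x y)
Cover? (t , c) (t′ , c′) = (t′ ≟ suc t ×-dec c′ ≟ c) ⊎-dec (t ≟ suc t′ ×-dec c ≟ suc c′)

-- This is s + t - 2c - 1: a cover either raises t by 1, or lowers t by 1 and 2c by 2. The shift s
-- puts the minimal elements at rank 1; it is n - 1 for the first class, with minimal element (n -
-- 1, n - 2), and 0 for the second.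
gridRank : ℕ → ℕ × ℕ → ℕ
gridRank s (t , c) = (s + t) ∸ suc (c + c)

gridRank-unique : ∀ s t c {r} → r + suc (c + c) ≡ s + t → gridRank s (t , c) ≡ r
gridRank-unique s t c {r} e = trans (cong (_∸ suc (c + c)) (sym e)) (m+n∸n≡m r (suc (c + c)))

gridRank-suc : ∀ s x {t c} → suc (c + c) ≤ s + t → Cover (t , c) x → gridRank s x ≡ suc (gridRank s (t , c))
gridRank-suc s _ {t} {c} bound (inj₁ (refl , refl)) =
  gridRank-unique s (suc t) c (trans (cong suc (m∸n+n≡m bound)) (sym (+-suc s t)))
gridRank-suc s (t′ , c′) bound (inj₂ (refl , refl)) = gridRank-unique s t′ c′
  (suc-injective (trans (lemma (gridRank s (suc t′ , suc c′)) c′) (trans (m∸n+n≡m bound) (+-suc s t′))))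
  where
  lemma : ∀ r c → suc (suc r + suc (c + c)) ≡ r + suc (suc c + suc c)
  lemma = solve-∀

below : (ℕ → ℕ) → ℕ × ℕ → Bool
below b (t , c) = ⌊ c <? b t ⌋

below-Cover : ∀ {b} → IsPath b → ∀ x y → Cover x y → T (below b x) → T (below b y)
below-Cover path (t , c) _ (inj₁ (refl , refl)) h = fromWitness (<-≤-trans (toWitness h) (IsPath.step-≤ path t))
below-Cover path _ (t , c) (inj₂ (refl , refl)) h = fromWitness (s≤s⁻¹ (≤-trans (toWitness h) (IsPath.step-≤-suc path t)))

-- Reversal, and positions of given values

opposite-sum : ∀ {n} (i : Fin n) → toℕ (F.opposite i) + suc (toℕ i) ≡ n
opposite-sum {n} i = trans (cong (_+ suc (toℕ i)) (F.opposite-prop i)) (m∸n+n≡m (F.toℕ<n i))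

opposite-anti : ∀ {n} {i j : Fin n} → i F.< j → toℕ (F.opposite j) < toℕ (F.opposite i)
opposite-anti {i = i} {j} h = s≤s⁻¹ (linearℕ 0 h
  (trans (lemma (toℕ (F.opposite j)) (toℕ j)) (trans (cong suc (trans (opposite-sum j) (sym (opposite-sum i))))
    (lemma′ (toℕ (F.opposite i)) (toℕ i)))))
  where
  lemma : ∀ o j → suc (suc o) + j + 0 ≡ suc (o + suc j)
  lemma = solve-∀
  lemma′ : ∀ o i → suc (o + suc i) ≡ suc o + suc i
  lemma′ = solve-∀

opposite-< : ∀ {n} {i j : Fin n} → toℕ (F.opposite i) < toℕ (F.opposite j) → j F.< i
opposite-< {i = i} {j} h = s≤s⁻¹ (linearℕ 0 h
  (trans (lemma (toℕ (F.opposite j)) (toℕ j)) (trans (cong suc (trans (opposite-sum j) (sym (opposite-sum i))))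
    (lemma′ (toℕ (F.opposite i)) (toℕ i)))))
  where
  lemma : ∀ o j → suc (suc j) + o + 0 ≡ suc (o + suc j)
  lemma = solve-∀
  lemma′ : ∀ o i → suc (o + suc i) ≡ suc i + suc o
  lemma′ = solve-∀

sum-opposite : ∀ {n} (v : Fin n) → toℕ v + suc (toℕ (F.opposite v)) ≡ n
sum-opposite v = trans (+-suc (toℕ v) _) (trans (cong suc (+-comm (toℕ v) _))
  (trans (sym (+-suc _ (toℕ v))) (opposite-sum v)))

permutation-injective : ∀ {n} (σ : Permutation′ n) {k l} → val σ k ≡ val σ l → k ≡ l
permutation-injective σ {k} {l} e =
  trans (sym (inverseˡ σ)) (trans (cong (σ ⟨$⟩ˡ_) (F.toℕ-injective e)) (inverseˡ σ))

value-position : ∀ {n} (σ : Permutation′ n) {v} → v < n → ∃ λ k → val σ k ≡ v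
value-position σ v<n = σ ⟨$⟩ˡ fromℕ< v<n , trans (cong toℕ (inverseʳ σ)) (F.toℕ-fromℕ< v<n)

time-position : ∀ {n t} → t < n → ∃ λ (k : Fin n) → toℕ (F.opposite k) ≡ t
time-position t<n = F.opposite (fromℕ< t<n) , trans (cong toℕ (F.opposite-involutive (fromℕ< t<n))) (F.toℕ-fromℕ< t<n)

-- Permutations avoiding 132 and 312

module Extremal (n : ℕ) where

  -- In both 132 and 312 the last letter is the middle value. Avoiding them thus means that every
  -- letter is below or above all letters to its left, so that reading from the right always removes
  -- the least or the greatest remaining value.
  chains : Chains n
  chains = record
    { Low      = λ i v → v ≡ i
    ; High     = λ i v → v + suc i ≡ n
    ; High?    = λ i v → v + suc i ≟ n
    ; Low-inj  = λ { refl refl → refl }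
    ; Low-fun  = λ { refl refl → refl }
    ; High-inj = λ {i} {j} {v} e f → suc-injective (+-cancelˡ-≡ v (suc i) (suc j) (trans e (sym f)))
    ; High-fun = λ {i} {v} {w} e f → +-cancelʳ-≡ (suc i) v w (trans e (sym f))
    ; Low-High = λ { {i} {j} refl e → ≤-reflexive (trans (sym e) (+-suc i j)) }
    }

  open Chains chains

  d : ℕ
  d = triangle n

  -- A path is determined before its last letter, which low and high spell alike.
  N : ℕ → ℕ → Node d
  N t c = node n (t ⊓ (n ∸ 1)) c

  N-decode : ∀ j {t c} → decode n j ≡ (t , c) → N t c ≡ elt j
  N-decode j {t} {c} e = trans (cong (λ x → node n x c) (m≤n⇒m⊓n≡m t≤)) (node-decode n j e)
    where
    t≤ : t ≤ n ∸ 1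
    t≤ = <⇒≤pred (subst (_< n) (cong proj₁ e) (proj₂ (decode-bounds n j)))

  entries : Entries (Matrix n) d
  entries = record
    { p = λ (k , v) → N (suc (toℕ (F.opposite k))) (toℕ v)
    ; q = λ (k , v) → N (toℕ (F.opposite k)) (toℕ v)
    ; r = λ (k , v) → highNode N (toℕ (F.opposite k)) (toℕ (F.opposite v))
    ; s = λ (k , v) → highNode N (suc (toℕ (F.opposite k))) (toℕ (F.opposite v))
    }

  open Entries entries

  letters⇒permMatrix : ∀ {F b} (σ : Permutation′ n) → Represents n N F b →
    (∀ k → Letter b (toℕ (F.opposite k)) (val σ k)) → point 1ℚ (χ ∘ F) ≐ permMatrix σ
  letters⇒permMatrix {F} {b} σ rep letter (k , v) = begin
    point 1ℚ (χ ∘ F) (k , v)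
      ≡⟨ cong₂ ℚ._+_
           (cong₂ ℚ._-_ (rep (suc t) (toℕ v) t<n) (rep t (toℕ v) (<⇒≤ t<n)))
           (cong₂ ℚ._-_ (represents-high {N = N} {F} {b} rep t i (<⇒≤ t<n)) (represents-high {N = N} {F} {b} rep (suc t) i t<n)) ⟩
    (𝟙 (toℕ v <? b (suc t)) ℚ.- 𝟙 (toℕ v <? b t)) ℚ.+ (𝟙 (t ≤? b t + i) ℚ.- 𝟙 (suc t ≤? b (suc t) + i))
      ≡⟨ indicator (letter k) ⟩
    𝟙 (σ ⟨$⟩ʳ k F.≟ v)
      ≡⟨ permMatrix-𝟙 σ k v ⟨
    permMatrix σ (k , v) ∎
    where
    open ≡-Reasoning
    t = toℕ (F.opposite k)
    i = toℕ (F.opposite v)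
    t<n = F.toℕ<n (F.opposite k)
    indicator : Letter b t (val σ k) →
      (𝟙 (toℕ v <? b (suc t)) ℚ.- 𝟙 (toℕ v <? b t)) ℚ.+ (𝟙 (t ≤? b t + i) ℚ.- 𝟙 (suc t ≤? b (suc t) + i)) ≡
      𝟙 (σ ⟨$⟩ʳ k F.≟ v)
    indicator (low e l) = trans
      (cong₂ ℚ._+_ (low-jump {b} t (toℕ v) e) (high-flat {b} t i e))
      (trans (ℚ.+-identityʳ _) (𝟙-cong (b t ≟ toℕ v) (σ ⟨$⟩ʳ k F.≟ v)
        (λ b≡v → F.toℕ-injective (trans l b≡v)) (λ σk≡v → trans (sym l) (cong toℕ σk≡v))))
    indicator (high j f e h) = trans
      (cong₂ ℚ._+_ (low-flat {b} t (toℕ v) e) (high-jump {b} t i e))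
      (trans (ℚ.+-identityˡ _) (𝟙-cong (t ≟ b t + i) (σ ⟨$⟩ʳ k F.≟ v)
        (λ t≡ → F.toℕ-injective (High-fun h (subst (λ x → High x (toℕ v))
                  (+-cancelˡ-≡ (b t) i j (trans (sym t≡) (sym f))) (sum-opposite v))))
        (λ σk≡v → trans (sym f) (cong (b t +_) (High-inj (subst (High j) (cong toℕ σk≡v) h) (sum-opposite v))))))

  c<t≤n∸1⇒t<n : ∀ {c t} → c < t → t ≤ n ∸ 1 → t < n
  c<t≤n∸1⇒t<n = go n
    where
    go : ∀ n {c t} → c < t → t ≤ n ∸ 1 → t < n
    go zero    c<t t≤0 = contradiction (≤-trans c<t t≤0) (λ ())
    go (suc n) c<t t≤n = s≤s t≤n

  -- `N` answers at time n as it does at time n - 1, so the last step of the path has to be flat.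
  path-represents : ∀ {b} → IsPath b → b n ≡ b (n ∸ 1) → Represents n N (below b ∘ decode n) b
  path-represents {b} path final t c t≤n = trans
    (value-node n (χ ∘ below b) {i = t ⊓ (n ∸ 1)}
      (λ c<t t≮n → contradiction (c<t≤n∸1⇒t<n c<t (m⊓n≤n t (n ∸ 1))) t≮n)
      (λ c≮t → 𝟙-false (c <? b (t ⊓ (n ∸ 1))) (λ c<b → c≮t (<-≤-trans c<b (IsPath.b≤ path _)))))
    (cong (λ x → 𝟙 (c <? x)) clamp)
    where
    clamp : b (t ⊓ (n ∸ 1)) ≡ b t
    clamp with t ≤? n ∸ 1
    ... | yes t≤ = cong b (m≤n⇒m⊓n≡m t≤)
    ... | no  t≰ = trans (cong b (m≥n⇒m⊓n≡n (<⇒≤ (≰⇒> t≰))))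
      (trans (sym final) (cong b (≤-antisym (≤-trans (m≤n+m∸n n 1) (≰⇒> t≰)) t≤n)))

  Relation : Fin d → Fin d → Set
  Relation i j = Cover (decode n i) (decode n j)

  Filter : (Fin d → Bool) → Set
  Filter F = ∀ i j → Relation i j → T (F i) → T (F j)

  module _ {F : Fin d → Bool} (up : Filter F) where

    At : ℕ → ℕ → Set
    At t c = T (truth F (node n t c))

    At-Cover : ∀ {t c t′ c′} → Cover (t , c) (t′ , c′) → c′ < t′ → t′ < n → At t c → At t′ c′
    At-Cover {t} {c} cover c′<t′ t′<n h =
      let (j , e , Fj) = truth-node n F {t} {c} h
          j′ = encode n c′<t′ t′<n
          e′ = decode-encode n c′<t′ t′<n
      in  subst (T ∘ truth F) (sym (node-decode n j′ e′))
            (up j j′ (subst₂ Cover (sym e) (sym e′) cover) Fj)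

    At-bounds : ∀ {t c} → At t c → c < t × t < n
    At-bounds {t} {c} h =
      let (j , e , _) = truth-node n F {t} {c} h
          (c<t , t<n) = decode-bounds n j
      in  subst₂ _<_ (cong proj₂ e) (cong proj₁ e) c<t , subst (_< n) (cong proj₁ e) t<n

    At-up : ∀ t c → suc t < n → At t c → At (suc t) c
    At-up t c t<n h = At-Cover {t} {c} (inj₁ (refl , refl)) (m<n⇒m<1+n (proj₁ (At-bounds {t} {c} h))) t<n h

    At-diagonal : ∀ t c → At (suc t) (suc c) → At t c
    At-diagonal t c h = let (c<t , t<n) = At-bounds {suc t} {suc c} h in
      At-Cover {suc t} {suc c} (inj₂ (refl , refl)) (s≤s⁻¹ c<t) (<⇒≤ t<n) h

    At-left : ∀ t c → At t (suc c) → At t c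
    At-left zero    c h = contradiction (proj₁ (At-bounds {zero} {suc c} h)) (λ ())
    At-left (suc t) c h = At-up t c (proj₂ (At-bounds {suc t} {suc c} h)) (At-diagonal t c h)

    Z : ℕ → ℕ → Bool
    Z t c = truth F (N t c)

    Z-up : ∀ t c → T (Z t c) → T (Z (suc t) c)
    Z-up t c h with suc t ≤? n ∸ 1
    ... | yes t< rewrite m≤n⇒m⊓n≡m (<⇒≤ t<) | m≤n⇒m⊓n≡m t< =
      At-up t c (c<t≤n∸1⇒t<n (s≤s z≤n) t<) h
    ... | no  t≮ rewrite m≥n⇒m⊓n≡n (s≤s⁻¹ (≰⇒> t≮)) | m≥n⇒m⊓n≡n (<⇒≤ (≰⇒> t≮)) = h

    Z-diagonal : ∀ t c → T (Z (suc t) (suc c)) → T (Z t c)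
    Z-diagonal t c h with suc t ≤? n ∸ 1
    ... | yes t< rewrite m≤n⇒m⊓n≡m (<⇒≤ t<) | m≤n⇒m⊓n≡m t< = At-diagonal t c h
    -- Here time is frozen at n - 1, and the diagonal step turns into a step to the left within the
    -- last row.
    ... | no  t≮ rewrite m≥n⇒m⊓n≡n (s≤s⁻¹ (≰⇒> t≮)) | m≥n⇒m⊓n≡n (<⇒≤ (≰⇒> t≮)) = At-left (n ∸ 1) c h

    filter⇒path : ∃ λ b → IsPath b × Represents n N F b
    filter⇒path =
      let (b , path , h) = grid⇒path Z (λ c h → contradiction (proj₁ (At-bounds {0} {c} h)) (λ ())) Z-up Z-diagonal
      in  b , path , represents-truth n N F {b} h

  Vertex : Region (Matrix n)
  Vertex = Vert-132-312 n

  path-next : ∀ {b} → IsPath b → ∀ t → t < n → ∃ λ v → v < n × Letter b t v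
  path-next {b} path t t<n with IsPath.step path t
  ... | inj₁ e = v , v<n , high (t ∸ b t) (m+[n∸m]≡n (IsPath.b≤ path t)) e v+1+i≡n
    where
    v = n ∸ suc (t ∸ b t)
    v+1+i≡n : v + suc (t ∸ b t) ≡ n
    v+1+i≡n = m∸n+n≡m (≤-trans (s≤s (m∸n≤m t (b t))) t<n)
    v<n : v < n
    v<n = subst (v <_) v+1+i≡n (m<m+n v (s≤s z≤n))
  ... | inj₂ e = b t , ≤-<-trans (IsPath.b≤ path t) t<n , low e refl

  -- Letters to the left of `k` are read later, hence are outside once `k` has been read: all above
  -- a low letter, all below a high one.
  letters⇒extremal : ∀ {b} → IsPath b → (σ : Permutation′ n) → (∀ k → Letter b (toℕ (F.opposite k)) (val σ k)) →
                     ∀ i j k → i F.< k → j F.< k →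
                     val σ k < val σ i × val σ k < val σ j ⊎ val σ i < val σ k × val σ j < val σ k
  letters⇒extremal {b} path σ letter i j k i<k j<k = compare (letter k)
    where
    t = toℕ (F.opposite k)
    outside : ∀ x → x F.< k → Outside (b (suc t)) (suc t) (val σ x)
    outside x x<k = letter⇒outside path (opposite-anti x<k) (F.toℕ<n (F.opposite x)) (letter x)
    compare : Letter b t (val σ k) →
              val σ k < val σ i × val σ k < val σ j ⊎ val σ i < val σ k × val σ j < val σ k
    compare (low e l) = inj₁ (under i i<k , under j j<k)
      where
      under : ∀ x → x F.< k → val σ k < val σ x
      under x x<k = subst (_≤ val σ x) (trans e (cong suc (sym l))) (proj₁ (outside x x<k) _ refl)
    compare (high m f e h) = inj₂ (over i i<k , over j j<k)
      where
      over : ∀ x → x F.< k → val σ x < val σ k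
      over x x<k = linearℕ 0 (proj₂ (outside x x<k) (toℕ (F.opposite (σ ⟨$⟩ʳ x))) (sum-opposite (σ ⟨$⟩ʳ x)))
        (trans (cong (λ y → suc (val σ x) + (y + toℕ (F.opposite (σ ⟨$⟩ʳ x))) + 0) e)
        (trans (lemma₁ (val σ x) (b t) (toℕ (F.opposite (σ ⟨$⟩ʳ x))))
        (trans (cong (b t +_) (trans (sum-opposite (σ ⟨$⟩ʳ x)) (sym h)))
        (trans (lemma₂ (b t) (val σ k) m) (cong (λ y → val σ k + suc y) f)))))
        where
        lemma₁ : ∀ v b o → suc v + (b + o) + 0 ≡ b + (v + suc o)
        lemma₁ = solve-∀
        lemma₂ : ∀ b w m → b + (w + suc m) ≡ w + suc (b + m)
        lemma₂ = solve-∀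

  letters⇒vertex : ∀ {F b} → IsPath b → Represents n N F b → (σ : Permutation′ n) →
                   (∀ k → Letter b (toℕ (F.opposite k)) (val σ k)) → Vertex (point 1ℚ (χ ∘ F))
  letters⇒vertex {F} {b} path rep σ letter = σ , avoid132 , avoid312 , letters⇒permMatrix {F} {b} σ rep letter
    where
    avoid132 : ¬ Contains132 σ
    avoid132 (i , j , k , i<j , j<k , i<k′ , k<j) with letters⇒extremal path σ letter i j k (<-trans i<j j<k) j<k
    ... | inj₁ (k<i , _) = <-asym k<i i<k′
    ... | inj₂ (_ , j<k′) = <-asym k<j j<k′
    avoid312 : ¬ Contains312 σ
    avoid312 (i , j , k , i<j , j<k , j<k′ , k<i) with letters⇒extremal path σ letter i j k (<-trans i<j j<k) j<k
    ... | inj₁ (_ , k<j) = <-asym k<j j<k′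
    ... | inj₂ (i<k′ , _) = <-asym i<k′ k<i

  filter⇒vertex : ∀ F → Filter F → Vertex (point 1ℚ (χ ∘ F))
  filter⇒vertex F up =
    let (b , path , rep) = filter⇒path up
        (τ , letter) = path⇒permutation path (path-next path)
    in  letters⇒vertex {F} {b} path rep (reverse ∘ₚ τ) (letter ∘ F.opposite)

  reversed : Permutation′ n → ℕ → ℕ
  reversed σ = row (λ x → σ ⟨$⟩ʳ F.opposite x)

  reversed-val : ∀ σ k → reversed σ (toℕ (F.opposite k)) ≡ val σ k
  reversed-val σ k = trans (row-toℕ (λ x → σ ⟨$⟩ʳ F.opposite x) (F.opposite k)) (cong (val σ) (F.opposite-involutive k))

  reversed-injective : ∀ σ {t t′} → t < n → t′ < n → reversed σ t ≡ reversed σ t′ → t ≡ t′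
  reversed-injective σ t<n t′<n e with time-position t<n | time-position t′<n
  ... | k , refl | l , refl = cong (toℕ ∘ F.opposite)
    (permutation-injective σ (trans (sym (reversed-val σ k)) (trans e (reversed-val σ l))))

  -- If the value read at time t were neither the lowest nor the highest one left, both of these
  -- would stand to its left and form a 132 or a 312 with it.
  extremal-next : ∀ σ → ¬ Contains132 σ → ¬ Contains312 σ → ∀ t s → t < n → s ≤ t →
                  (∀ t′ → t′ < t → Inside s t (reversed σ t′)) →
                  (∀ t′ → t ≤ t′ → t′ < n → Outside s t (reversed σ t′)) →
                  Low s (reversed σ t) ⊎ High (t ∸ s) (reversed σ t)
  extremal-next σ avoid132 avoid312 t s t<n s≤t inside outside with time-position t<n
  ... | k , refl rewrite reversed-val σ k = decide (val σ k ≟ s) (High? a (val σ k))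
    where
    a = t ∸ s
    a+s≡t : a + s ≡ t
    a+s≡t = m∸n+n≡m s≤t
    v = val σ k
    out : Outside s t v
    out = subst (Outside s t) (reversed-val σ k) (outside t ≤-refl t<n)
    left : ∀ l → ¬ Inside s t (val σ l) → val σ l ≢ v → l F.< k
    left l ¬in l≢v with <-cmp (toℕ (F.opposite l)) t
    ... | tri< l<t _ _ = contradiction (subst (Inside s t) (reversed-val σ l) (inside _ l<t)) ¬in
    ... | tri≈ _ eq _  = contradiction (trans (sym (reversed-val σ l)) (trans (cong (reversed σ) eq) (reversed-val σ k))) l≢v
    ... | tri> _ _ t<l = opposite-< {i = k} {l} t<l
    decide : Dec (v ≡ s) → Dec (High a v) → Low s v ⊎ High a v
    decide (yes v≡s) _       = inj₁ v≡s
    decide (no v≢s) (yes h)  = inj₂ h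
    decide (no v≢s) (no ¬h)  = ⊥-elim patterns
      where
      -- With `a` high and `s` low letters taken, the remaining values run from `s` to `top′`.
      top′ = n ∸ suc a
      top′+1+a≡n : top′ + suc a ≡ n
      top′+1+a≡n = m∸n+n≡m (≤-trans (s≤s (m∸n≤m t s)) t<n)
      s<v : s < v
      s<v = ≤∧≢⇒< (proj₁ out v refl) (v≢s ∘ sym)
      v≤top : v ≤ top′
      v≤top = linearℕ 0 (proj₂ out i v+1+i≡n)
        (suc-injective (trans (lemma₁ v s i) (trans (cong (s +_) (trans v+1+i≡n (sym top′+1+a≡n)))
          (trans (lemma₂ s top′ a) (cong (λ y → suc (top′ + y)) a+s≡t)))))
        where
        i = toℕ (F.opposite (σ ⟨$⟩ʳ k))
        v+1+i≡n = sum-opposite (σ ⟨$⟩ʳ k)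
        lemma₁ : ∀ v s i → suc (v + (s + i) + 0) ≡ s + (v + suc i)
        lemma₁ = solve-∀
        lemma₂ : ∀ s w a → s + (w + suc a) ≡ suc (w + (a + s))
        lemma₂ = solve-∀
      v<top : v < top′
      v<top = ≤∧≢⇒< v≤top (λ e → ¬h (trans (cong (_+ suc a) e) top′+1+a≡n))
      top<n : top′ < n
      top<n = subst (top′ <_) top′+1+a≡n (m<m+n top′ (s≤s z≤n))
      ¬inside-low : ¬ Inside s t s
      ¬inside-low (inj₁ (i , i<s , refl)) = <-irrefl refl i<s
      ¬inside-low (inj₂ (i , s+i<t , e))  = <⇒≱ t<n (subst (_≤ t) (trans (sym (+-suc s i)) e) s+i<t)
      ¬inside-high : ¬ Inside s t top′
      ¬inside-high (inj₁ (i , top<s , refl)) = <⇒≱ t<n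
        (subst₂ _≤_ (trans (sym (+-suc top′ a)) top′+1+a≡n) (trans (+-comm s a) a+s≡t) (+-monoˡ-≤ a top<s))
      ¬inside-high (inj₂ (i , s+i<t , e)) = <⇒≢ s+i<t
        (trans (+-comm s i) (trans (cong (_+ s) (High-inj e top′+1+a≡n)) a+s≡t))
      patterns : ⊥
      patterns with value-position σ (<-trans s<v (<-trans v<top top<n)) | value-position σ top<n
      ... | l , l≡s | h , h≡top with <-cmp (toℕ l) (toℕ h)
      ... | tri< l<h _ _ = avoid132 (l , h , k , l<h , h<k , subst (_< v) (sym l≡s) s<v , subst (v <_) (sym h≡top) v<top)
        where
        h<k : h F.< k
        h<k = left h (λ x → ¬inside-high (subst (Inside s t) h≡top x)) (λ e → <⇒≢ v<top (trans (sym e) h≡top))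
      ... | tri≈ _ l≡h _ = <⇒≢ (<-trans s<v v<top) (trans (sym l≡s) (trans (cong (val σ) (F.toℕ-injective l≡h)) h≡top))
      ... | tri> _ _ h<l = avoid312 (h , l , k , h<l , l<k , subst (_< v) (sym l≡s) s<v , subst (v <_) (sym h≡top) v<top)
        where
        l<k : l F.< k
        l<k = left l (λ x → ¬inside-low (subst (Inside s t) l≡s x)) (λ e → <⇒≢ s<v (sym (trans (sym e) l≡s)))

  -- Only one value remains at the end, and it is next on both chains; the preference for high
  -- letters makes the last step flat.
  last-flat : ∀ (word b : ℕ → ℕ) → IsPath b → (∀ t → t < n → word t < n) →
              (∀ t → t < n → Letter b t (word t)) →
              (∀ t → High (t ∸ b t) (word t) → b (suc t) ≡ b t) → b n ≡ b (n ∸ 1)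
  last-flat word b path = go n refl
    where
    go : ∀ m → m ≡ n → (∀ t → t < n → word t < n) → (∀ t → t < n → Letter b t (word t)) →
         (∀ t → High (t ∸ b t) (word t) → b (suc t) ≡ b t) → b m ≡ b (m ∸ 1)
    go zero    _    _     _      _     = refl
    go (suc m) refl word< letter prefer = prefer m (subst (High (m ∸ b m)) (sym v≡b) (trans (+-suc (b m) _) (cong suc (m+[n∸m]≡n (IsPath.b≤ path m)))))
      where
      v = word m
      out : Outside (b m) m v
      out = letter⇒outside path ≤-refl ≤-refl (letter m ≤-refl)
      i = m ∸ v
      v+i≡m : v + i ≡ m
      v+i≡m = m+[n∸m]≡n (s≤s⁻¹ (word< m ≤-refl))
      v≡b : v ≡ b m
      v≡b = ≤-antisym
        (+-cancelʳ-≤ i v (b m) (subst (_≤ b m + i) (sym v+i≡m) (proj₂ out i (trans (+-suc v i) (cong suc v+i≡m)))))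
        (proj₁ out v refl)

  vertex⇒filter : ∀ M → Vertex M → ∃ λ F → Filter F × M ≐ point 1ℚ (χ ∘ F)
  vertex⇒filter M (σ , avoid132 , avoid312 , M≐) =
    below b ∘ decode n , (λ i j → below-Cover path (decode n i) (decode n j)) ,
    λ x → trans (M≐ x) (sym (letters⇒permMatrix {below b ∘ decode n} {b} σ (path-represents path final) letter x))
    where
    word = reversed σ
    b = lowCount word
    path = lowCount-path word
    spelled : ∀ t → t < n → Letter b t (word t)
    spelled = letters word (reversed-injective σ) (extremal-next σ avoid132 avoid312)
    letter : ∀ k → Letter b (toℕ (F.opposite k)) (val σ k)
    letter k = subst (Letter b (toℕ (F.opposite k))) (reversed-val σ k) (spelled _ (F.toℕ<n (F.opposite k)))
    word< : ∀ t → t < n → word t < n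
    word< t t<n = let (k , e) = time-position t<n in
      subst (_< n) (trans (sym (reversed-val σ k)) (cong word e)) (F.toℕ<n (σ ⟨$⟩ʳ k))
    final : b n ≡ b (n ∸ 1)
    final = last-flat word b path word< spelled (lowCount-high word)

  -- Summing entries over time isolates only the difference of a low and a high statement at one
  -- time. The high statement is again a low one, with smaller c, or `top`; so the nodes are
  -- recovered by induction on c.
  recover : ∀ (A : ℚ → Set) → (∀ {p q} → A p → A q → A (p ℚ.- q)) →
            ∀ v → A (v bot) → A (v top) → (∀ x → A (entry v x)) → ∀ j → A (v (elt j))
  recover A A-sub v A-bot A-top A-entry j =
    let (c<t , t<n) = decode-bounds n j in
    subst (A ∘ v) (N-decode j refl) (A-N _ (<-wellFounded _) (<-trans c<t t<n) t<n)
    where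
    A-add : ∀ {p q} → A p → A q → A (p ℚ.+ q)
    A-add {p} {q} a b = subst A (lemma p q (v bot)) (A-sub a (A-sub (A-sub A-bot A-bot) b))
      where
      lemma : ∀ p q b → p ℚ.- ((b ℚ.- b) ℚ.- q) ≡ p ℚ.+ q
      lemma = ℚ-Tactic.solve-∀ ℚ-ring

    -- The sum of the entries for value `w` over the times before `t` telescopes; at time 0 the two
    -- nodes are `bot` and `top`.
    A-difference : ∀ t → t ≤ n → ∀ (w : Fin n) → A (v (N t (toℕ w)) ℚ.- v (highNode N t (toℕ (F.opposite w))))
    A-difference zero    _   w = A-sub A-bot A-top
    A-difference (suc t) t<n w with time-position t<n
    ... | k , refl = subst A
      (lemma (v (N (suc t) (toℕ w))) (v (N t (toℕ w))) (v (highNode N t i)) (v (highNode N (suc t) i)))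
      (A-add (A-entry (k , w)) (A-difference t (<⇒≤ t<n) w))
      where
      i = toℕ (F.opposite w)
      lemma : ∀ a b c e → ((a ℚ.- b) ℚ.+ (c ℚ.- e)) ℚ.+ (b ℚ.- c) ≡ a ℚ.- e
      lemma = ℚ-Tactic.solve-∀ ℚ-ring

    A-N : ∀ {t} w → Acc _<_ w → w < n → t < n → A (v (N t w))
    A-high : ∀ {t} w i → Acc _<_ w → w < n → t < n → w + suc i ≡ n → A (v (highNode N t i))
    A-N {t} w wf w<n t<n =
      subst A (lemma (v (N t w)) (v (highNode N t i)))
        (A-add (subst (λ x → A (v (N t x) ℚ.- v (highNode N t i))) (F.toℕ-fromℕ< w<n)
                  (A-difference t (<⇒≤ t<n) (fromℕ< w<n)))
               (A-high w i wf w<n t<n (trans (cong (_+ suc i) (sym (F.toℕ-fromℕ< w<n))) (sum-opposite (fromℕ< w<n)))))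
      where
      i = toℕ (F.opposite (fromℕ< w<n))
      lemma : ∀ a b → (a ℚ.- b) ℚ.+ b ≡ a
      lemma = ℚ-Tactic.solve-∀ ℚ-ring
    A-high {t} w i (acc rec) w<n t<n e with t ≤? i
    ... | yes _   = A-top
    ... | no  t≰i = A-N (t ∸ suc i) (rec smaller) (<-trans smaller w<n) t<n
      where
      -- From t < n = w + i + 1: leaving out time n is what makes the recursion descend.
      smaller : t ∸ suc i < w
      smaller = +-cancelʳ-< (suc i) (t ∸ suc i) w (subst₂ _<_ (sym (m∸n+n≡m (≰⇒> t≰i))) (sym e) t<n)

  -- One more than the rank 2n - 3 of the only maximal element (n - 1, 0). For n ≤ 1 the poset is
  -- empty and truncated subtraction gives k = 1.
  k : ℕ
  k = suc (gridRank (n ∸ 1) (n ∸ 1 , 0))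

  rank : Fin d → ℕ
  rank j = gridRank (n ∸ 1) (decode n j)

  rank-suc : ∀ {i j} → Relation i j → rank j ≡ suc (rank i)
  rank-suc {i} {j} = gridRank-suc (n ∸ 1) (decode n j) bound
    where
    bound : let (t , c) = decode n i in suc (c + c) ≤ n ∸ 1 + t
    bound = let (c<t , t<n) = decode-bounds n i; c = proj₂ (decode n i) in
      subst (_≤ n ∸ 1 + proj₁ (decode n i)) (+-suc c c) (+-mono-≤ (≤-trans (<⇒≤ c<t) (<⇒≤pred t<n)) c<t)

  rank<k : ∀ j → rank j < k
  rank<k j = s≤s (∸-mono (+-monoʳ-≤ (n ∸ 1) (<⇒≤pred (proj₂ (decode-bounds n j)))) (s≤s z≤n))

  last-time : ∀ {t} → t < n → ¬ suc t < n → n ∸ 1 ≡ t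
  last-time t<n 1+t≮n = cong (_∸ 1) (≤-antisym (≮⇒≥ 1+t≮n) t<n)

  lower : ∀ j → rank j ≡ 1 ⊎ ∃ λ i → Relation i j
  lower j = go (decode n j) refl
    where
    go : ∀ x → decode n j ≡ x → rank j ≡ 1 ⊎ ∃ λ i → Relation i j
    go (t , c) e with suc t <? n | subst (λ (t , c) → c < t × t < n) e (decode-bounds n j)
    ... | yes 1+t<n | c<t , _ = inj₂ (encode n (s≤s c<t) 1+t<n ,
      subst₂ Cover (sym (decode-encode n (s≤s c<t) 1+t<n)) (sym e) (inj₂ (refl , refl)))
    ... | no 1+t≮n | s≤s {n = t′} c≤t′ , t<n with c <? t′
    ...   | yes c<t′ = inj₂ (encode n c<t′ (<⇒≤ t<n) ,
      subst₂ Cover (sym (decode-encode n c<t′ (<⇒≤ t<n))) (sym e) (inj₁ (refl , refl)))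
    ...   | no  c≮t′ rewrite ≤-antisym c≤t′ (≮⇒≥ c≮t′) = inj₁ (trans (cong (gridRank (n ∸ 1)) e)
      (trans (cong (λ s → gridRank s (suc t′ , t′)) (last-time t<n 1+t≮n))
        (gridRank-unique (suc t′) (suc t′) t′ (cong suc (sym (+-suc t′ t′))))))

  upper : ∀ j → suc (rank j) ≡ k ⊎ ∃ λ i → Relation j i
  upper j = go (decode n j) refl
    where
    go : ∀ x → decode n j ≡ x → suc (rank j) ≡ k ⊎ ∃ λ i → Relation j i
    go (t , c) e with suc t <? n | subst (λ (t , c) → c < t × t < n) e (decode-bounds n j)
    go (t , c) e | yes 1+t<n | c<t , _ = inj₂ (encode n (m<n⇒m<1+n c<t) 1+t<n ,
      subst₂ Cover (sym e) (sym (decode-encode n (m<n⇒m<1+n c<t) 1+t<n)) (inj₁ (refl , refl)))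
    go (t , zero) e | no 1+t≮n | _ , t<n = inj₁ (cong suc (trans (cong (gridRank (n ∸ 1)) e)
      (cong (λ s → gridRank (n ∸ 1) (s , 0)) (sym (last-time t<n 1+t≮n)))))
    go (suc t , suc c) e | no _ | c<t , t<n = inj₂ (encode n (s≤s⁻¹ c<t) (<⇒≤ t<n) ,
      subst₂ Cover (sym e) (sym (decode-encode n (s≤s⁻¹ c<t) (<⇒≤ t<n))) (inj₂ (refl , refl)))

  model : GradedModel Vertex
  model = record
    { k             = k
    ; 1≤k           = s≤s z≤n
    ; entries       = entries
    ; rank          = rank
    ; R             = Relation
    ; R?            = λ i j → Cover? (decode n i) (decode n j)
    ; rank-suc      = λ {i} {j} → rank-suc {i} {j}
    ; rank<k        = rank<k
    ; lower         = lower
    ; upper         = upper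
    ; filter⇒vertex = filter⇒vertex
    ; vertex⇒filter = vertex⇒filter
    ; recover       = recover
    }

-- Alternating permutations avoiding 123

double-cancel-< : ∀ {i j} → i + i < suc (j + j) → i ≤ j
double-cancel-< {i} {j} h = ≮⇒≥ λ j<i → <⇒≱ h (≤-trans (s≤s (+-monoʳ-≤ j (n≤1+n j))) (+-mono-≤ j<i j<i))

double-< : ∀ {i j} → i + i < j + j → i < j
double-< h = ≰⇒> λ j≤i → <⇒≱ h (+-mono-≤ j≤i j≤i)

double-injective : ∀ {i j} → i + i ≡ j + j → i ≡ j
double-injective e = ≤-antisym (double-cancel-< (s≤s (≤-reflexive e))) (double-cancel-< (s≤s (≤-reflexive (sym e))))

double≢1+double : ∀ {i j} → i + i ≢ suc (j + j)
double≢1+double {i} {j} e = even≢odd i j (trans (2*≡ i) (trans e (cong suc (sym (2*≡ j)))))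
  where
  2*≡ : ∀ i → 2 * i ≡ i + i
  2*≡ = solve-∀

even⊎odd : ∀ x → x ≡ ⌊ x /2⌋ + ⌊ x /2⌋ ⊎ x ≡ suc (⌊ x /2⌋ + ⌊ x /2⌋)
even⊎odd zero          = inj₁ refl
even⊎odd (suc zero)    = inj₂ refl
even⊎odd (suc (suc x)) with even⊎odd x
... | inj₁ e = inj₁ (cong suc (trans (cong suc e) (sym (+-suc ⌊ x /2⌋ ⌊ x /2⌋))))
... | inj₂ e = inj₂ (cong (suc ∘ suc) (trans e (sym (+-suc ⌊ x /2⌋ ⌊ x /2⌋))))

double%2 : ∀ r i → (r + (i + i)) % 2 ≡ r % 2
double%2 r i = trans (cong (λ x → (r + x) % 2) (lemma i)) ([m+kn]%n≡m%n r i 2)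
  where
  lemma : ∀ i → i + i ≡ i * 2
  lemma = solve-∀

module Alternate (n : ℕ) where

  -- For n ≥ 1 this is ⌈n/2⌉; for n = 0 it is 1, which makes the triangle below empty as well.
  m : ℕ
  m = suc ⌊ n ∸ 1 /2⌋

  <m⇒double : ∀ {i} → i < m → i + i ≤ n ∸ 1
  <m⇒double (s≤s i≤) = ≤-trans (+-mono-≤ i≤ (≤-trans i≤ (⌊n/2⌋≤⌈n/2⌉ (n ∸ 1))))
    (≤-reflexive (⌊n/2⌋+⌈n/2⌉≡n (n ∸ 1)))

  double<n⇒<m : ∀ {i} → i + i < n → i < m
  double<n⇒<m {i} h = s≤s (subst (_≤ ⌊ n ∸ 1 /2⌋) (sym (n≡⌊n+n/2⌋ i)) (⌊n/2⌋-mono (<⇒≤pred h)))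

  n≤m+m : n ≤ m + m
  n≤m+m = ≤-trans (m≤n+m∸n n 1) (s≤s (subst (_≤ ⌊ n ∸ 1 /2⌋ + m) (⌊n/2⌋+⌈n/2⌉≡n (n ∸ 1))
    (+-monoʳ-≤ ⌊ n ∸ 1 /2⌋ (⌊n/2⌋-mono (n≤1+n (suc (n ∸ 1)))))))

  -- With 0-based positions the valleys are 2i and the peaks 2i + 1; when n is odd the last
  -- position, although a valley, continues the sequence of peaks.
  data Low (i x : ℕ) : Set where
    valley : x ≡ i + i → suc x < n → Low i x

  data High (i x : ℕ) : Set where
    peak : x ≡ suc (i + i) → x < n → High i x
    last : x ≡ i + i → suc x ≡ n → High i x

  ¬Low-High : ∀ {i j x} → Low i x → ¬ High j x
  ¬Low-High {i} {j} (valley e _) (peak f _) = double≢1+double {i} {j} (trans (sym e) f)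
  ¬Low-High (valley _ <n) (last _ ≡n) = <-irrefl ≡n <n

  Low-injective : ∀ {i j x} → Low i x → Low j x → i ≡ j
  Low-injective (valley e _) (valley f _) = double-injective (trans (sym e) f)

  Low-functional : ∀ {i x y} → Low i x → Low i y → x ≡ y
  Low-functional (valley e _) (valley f _) = trans e (sym f)

  High-injective : ∀ {i j x} → High i x → High j x → i ≡ j
  High-injective (peak e _) (peak f _) = double-injective (suc-injective (trans (sym e) f))
  High-injective {i} {j} (peak e _) (last f _) = contradiction (trans (sym f) e) (double≢1+double {j} {i})
  High-injective {i} {j} (last e _) (peak f _) = contradiction (trans (sym e) f) (double≢1+double {i} {j})
  High-injective (last e _) (last f _) = double-injective (trans (sym e) f)

  High-functional : ∀ {i x y} → High i x → High i y → x ≡ y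
  High-functional (peak e _)  (peak f _)  = trans e (sym f)
  High-functional (peak e <n) (last f ≡n) = contradiction (trans (trans e (cong suc (sym f))) ≡n) (<⇒≢ <n)
  High-functional (last e ≡n) (peak f <n) = contradiction (trans (trans f (cong suc (sym e))) ≡n) (<⇒≢ <n)
  High-functional (last e _)  (last f _)  = trans e (sym f)

  High? : ∀ i x → Dec (High i x)
  High? i x with x ≟ suc (i + i) ×-dec x <? n | x ≟ i + i ×-dec suc x ≟ n
  ... | yes (e , <n) | _           = yes (peak e <n)
  ... | no  _   | yes (e , ≡n)     = yes (last e ≡n)
  ... | no ¬peak | no ¬last        = no λ { (peak e <n) → ¬peak (e , <n) ; (last e ≡n) → ¬last (e , ≡n) }

  chains : Chains n
  chains = record
    { Low      = Low
    ; High     = High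
    ; High?    = High?
    ; Low-inj  = Low-injective
    ; Low-fun  = Low-functional
    ; High-inj = High-injective
    ; High-fun = High-functional
    ; Low-High = λ l h → contradiction h (¬Low-High l)
    }

  open Chains chains hiding (Low; High; High?)

  High⇒< : ∀ {i x} → High i x → i + i < n
  High⇒< {i} (peak e <n) = <-trans (n<1+n (i + i)) (subst (_< n) e <n)
  High⇒< {i} (last e ≡n) = ≤-reflexive (trans (cong suc (sym e)) ≡n)

  high-exists : ∀ i → i + i < n → ∃ λ x → x < n × High i x
  high-exists i h with suc (i + i) <? n
  ... | yes <n = suc (i + i) , <n , peak refl <n
  ... | no  ≮n = i + i , h , last refl (≤-antisym h (≮⇒≥ ≮n))

  label : ∀ x → x < n → (∃ λ i → Low i x) ⊎ (∃ λ i → High i x)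
  label x x<n with even⊎odd x | suc x <? n
  ... | inj₁ e | yes <n = inj₁ (⌊ x /2⌋ , valley e <n)
  ... | inj₁ e | no  ≮n = inj₂ (⌊ x /2⌋ , last e (≤-antisym x<n (≮⇒≥ ≮n)))
  ... | inj₂ e | _      = inj₂ (⌊ x /2⌋ , peak e x<n)

  d : ℕ
  d = triangle m

  -- cell i c stands for: high letter i comes after more than c low letters.
  cell : ℕ → ℕ → Node d
  cell i c with m ≤? i
  ... | yes _ = top
  ... | no  _ = node m i c

  -- At time t = i + c + 1, more than c low letters means at most i high ones, so that the high
  -- letter i is still to come. For t ≤ c the truncated difference is 0, and `cell 0 c` is false.
  N : ℕ → ℕ → Node d
  N t c = cell (t ∸ suc c) c

  cell-top : ∀ {i} c → m ≤ i → cell i c ≡ top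
  cell-top {i} c m≤i with m ≤? i
  ... | yes _   = refl
  ... | no  m≰i = contradiction m≤i m≰i

  cell-node : ∀ {i} c → i < m → cell i c ≡ node m i c
  cell-node {i} c i<m with m ≤? i
  ... | yes m≤i = contradiction m≤i (<⇒≱ i<m)
  ... | no  _   = refl

  time : ℕ × ℕ → ℕ × ℕ
  time (i , c) = suc (i + c) , c

  N-decode : ∀ j {i c} → decode m j ≡ (i , c) → N (suc (i + c)) c ≡ elt j
  N-decode j {i} {c} e = trans (cong (λ x → cell x c) (m+n∸n≡m i c))
    (trans (cell-node c (subst (_< m) (cong proj₁ e) (proj₂ (decode-bounds m j)))) (node-decode m j e))

  entries : Entries (Matrix n) d
  entries = record
    { p = λ (x , v) → [ (λ (i , _) → N (suc (toℕ (F.opposite v))) i) , (λ _ → bot) ]′ (label (toℕ x) (F.toℕ<n x))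
    ; q = λ (x , v) → [ (λ (i , _) → N (toℕ (F.opposite v)) i) , (λ _ → bot) ]′ (label (toℕ x) (F.toℕ<n x))
    ; r = λ (x , v) → [ (λ _ → bot) , (λ (i , _) → highNode N (toℕ (F.opposite v)) i) ]′ (label (toℕ x) (F.toℕ<n x))
    ; s = λ (x , v) → [ (λ _ → bot) , (λ (i , _) → highNode N (suc (toℕ (F.opposite v))) i) ]′ (label (toℕ x) (F.toℕ<n x))
    }

  open Entries entries

  Spells : (ℕ → ℕ) → Permutation′ n → Set
  Spells b σ = ∀ x → Letter b (toℕ (F.opposite (σ ⟨$⟩ʳ x))) (toℕ x)

  letters⇒permMatrix : ∀ {F b} (σ : Permutation′ n) → Represents n N F b → Spells b σ →
                       point 1ℚ (χ ∘ F) ≐ permMatrix σ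
  letters⇒permMatrix {F} {b} σ rep letter (x , v) with label (toℕ x) (F.toℕ<n x)
  ... | inj₁ (i , l) = begin
    (value 1ℚ (χ ∘ F) (N (suc t) i) ℚ.- value 1ℚ (χ ∘ F) (N t i)) ℚ.+ (0ℚ ℚ.- 0ℚ)
      ≡⟨ ℚ.+-identityʳ _ ⟩
    value 1ℚ (χ ∘ F) (N (suc t) i) ℚ.- value 1ℚ (χ ∘ F) (N t i)
      ≡⟨ cong₂ ℚ._-_ (rep (suc t) i t<n) (rep t i (<⇒≤ t<n)) ⟩
    𝟙 (i <? b (suc t)) ℚ.- 𝟙 (i <? b t)
      ≡⟨ indicator at-v ⟩
    𝟙 (σ ⟨$⟩ʳ x F.≟ v)
      ≡⟨ permMatrix-𝟙 σ x v ⟨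
    permMatrix σ (x , v) ∎
    where
    open ≡-Reasoning
    t = toℕ (F.opposite v)
    t<n = F.toℕ<n (F.opposite v)
    at-v : Letter b t (toℕ (σ ⟨$⟩ˡ v))
    at-v = subst (λ w → Letter b (toℕ (F.opposite w)) (toℕ (σ ⟨$⟩ˡ v))) (inverseʳ σ) (letter (σ ⟨$⟩ˡ v))
    indicator : Letter b t (toℕ (σ ⟨$⟩ˡ v)) → 𝟙 (i <? b (suc t)) ℚ.- 𝟙 (i <? b t) ≡ 𝟙 (σ ⟨$⟩ʳ x F.≟ v)
    indicator (low e l′) = trans (low-jump {b} t i e) (𝟙-cong (b t ≟ i) (σ ⟨$⟩ʳ x F.≟ v)
      (λ { refl → trans (cong (σ ⟨$⟩ʳ_) (F.toℕ-injective (Low-functional l l′))) (inverseʳ σ) })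
      (λ { refl → Low-injective (subst (Low (b t)) (cong toℕ (inverseˡ σ)) l′) l }))
    indicator (high j f e h) = trans (low-flat {b} t i e) (sym (𝟙-false (σ ⟨$⟩ʳ x F.≟ v)
      λ { refl → ¬Low-High l (subst (High j) (cong toℕ (inverseˡ σ)) h) }))
  ... | inj₂ (i , h) = begin
    (0ℚ ℚ.- 0ℚ) ℚ.+ (value 1ℚ (χ ∘ F) (highNode N t i) ℚ.- value 1ℚ (χ ∘ F) (highNode N (suc t) i))
      ≡⟨ ℚ.+-identityˡ _ ⟩
    value 1ℚ (χ ∘ F) (highNode N t i) ℚ.- value 1ℚ (χ ∘ F) (highNode N (suc t) i)
      ≡⟨ cong₂ ℚ._-_ (represents-high {N = N} {F} {b} rep t i (<⇒≤ t<n)) (represents-high {N = N} {F} {b} rep (suc t) i t<n) ⟩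
    𝟙 (t ≤? b t + i) ℚ.- 𝟙 (suc t ≤? b (suc t) + i)
      ≡⟨ indicator at-v ⟩
    𝟙 (σ ⟨$⟩ʳ x F.≟ v)
      ≡⟨ permMatrix-𝟙 σ x v ⟨
    permMatrix σ (x , v) ∎
    where
    open ≡-Reasoning
    t = toℕ (F.opposite v)
    t<n = F.toℕ<n (F.opposite v)
    at-v : Letter b t (toℕ (σ ⟨$⟩ˡ v))
    at-v = subst (λ w → Letter b (toℕ (F.opposite w)) (toℕ (σ ⟨$⟩ˡ v))) (inverseʳ σ) (letter (σ ⟨$⟩ˡ v))
    indicator : Letter b t (toℕ (σ ⟨$⟩ˡ v)) → 𝟙 (t ≤? b t + i) ℚ.- 𝟙 (suc t ≤? b (suc t) + i) ≡ 𝟙 (σ ⟨$⟩ʳ x F.≟ v)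
    indicator (low e l) = trans (high-flat {b} t i e) (sym (𝟙-false (σ ⟨$⟩ʳ x F.≟ v)
      λ { refl → ¬Low-High (subst (Low (b t)) (cong toℕ (inverseˡ σ)) l) h }))
    indicator (high j f e h′) = trans (high-jump {b} t i e) (𝟙-cong (t ≟ b t + i) (σ ⟨$⟩ʳ x F.≟ v)
      (λ t≡ → trans (cong (σ ⟨$⟩ʳ_) (F.toℕ-injective (High-functional h
                (subst (λ y → High y (toℕ (σ ⟨$⟩ˡ v))) (+-cancelˡ-≡ (b t) j i (trans f t≡)) h′)))) (inverseʳ σ))
      (λ { refl → trans (sym f) (cong (b t +_) (High-injective (subst (High j) (cong toℕ (inverseˡ σ)) h′) h)) }))

  -- Values are read from the top, so the peak after a valley is read before the valley: at any time
  -- at most half of the letters read are low. The high chain has only `m` letters.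
  record Ballot (b : ℕ → ℕ) : Set where
    field
      path     : IsPath b
      balanced : ∀ t → t ≤ n → b t + b t ≤ t
      highs≤m  : ∀ t → t ≤ n → t ≤ b t + m

  ballot-represents : ∀ {b} → Ballot b → Represents n N (below b ∘ time ∘ decode m) b
  ballot-represents {b} ballot t c t≤n with t ≤? c
  ... | yes t≤c rewrite m≤n⇒m∸n≡0 (m≤n⇒m≤1+n t≤c) =
    sym (𝟙-false (c <? b t) (λ c<b → <⇒≱ c<b (≤-trans (IsPath.b≤ (Ballot.path ballot) t) t≤c)))
  ... | no t≰c = split (m ≤? i)
    where
    open Ballot ballot
    i = t ∸ suc c
    i+1+c≡t : i + suc c ≡ t
    i+1+c≡t = m∸n+n≡m (≰⇒> t≰c)
    y : Fin d → ℚ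
    y = χ ∘ below b ∘ time ∘ decode m
    split : Dec (m ≤ i) → value 1ℚ y (cell i c) ≡ 𝟙 (c <? b t)
    split (yes m≤i) = trans (cong (value 1ℚ y) (cell-top c m≤i))
      (sym (𝟙-true (c <? b t) (+-cancelʳ-≤ m (suc c) (b t)
        (≤-trans (≤-trans (+-monoʳ-≤ (suc c) m≤i) (≤-reflexive (trans (+-comm (suc c) i) i+1+c≡t))) (highs≤m t t≤n)))))
    split (no m≰i) = trans (cong (value 1ℚ y) (cell-node c (≰⇒> m≰i)))
      (trans (value-node m (χ ∘ below b ∘ time) {i} {c} (λ _ i≮m → contradiction (≰⇒> m≰i) i≮m) beside)
             (cong (λ x → 𝟙 (c <? b x)) 1+i+c≡t))
      where
      1+i+c≡t : suc (i + c) ≡ t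
      1+i+c≡t = trans (sym (+-suc i c)) i+1+c≡t
      beside : ¬ c < i → 𝟙 (c <? b (suc (i + c))) ≡ 0ℚ
      beside c≮i = 𝟙-false (c <? b (suc (i + c))) λ c<b → <⇒≱
        (≤-trans (+-mono-≤ c<b c<b) (balanced (suc (i + c)) (≤-trans (≤-reflexive 1+i+c≡t) t≤n)))
        (≤-trans (s≤s (+-monoˡ-≤ c (≮⇒≥ c≮i))) (≤-reflexive (sym (+-suc c c))))

  Relation : Fin d → Fin d → Set
  Relation i j = Cover (time (decode m i)) (time (decode m j))

  Filter : (Fin d → Bool) → Set
  Filter F = ∀ i j → Relation i j → T (F i) → T (F j)

  module _ {F : Fin d → Bool} (up : Filter F) where

    In : ℕ → ℕ → Set
    In i c = T (truth F (cell i c))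

    In-node : ∀ i c → i < m → In i c → ∃ λ j → decode m j ≡ (i , c) × T (F j)
    In-node i c i<m h = truth-node m F {i} {c} (subst (T ∘ truth F) (cell-node c i<m) h)

    In-Cover : ∀ {i c i′ c′} → Cover (time (i , c)) (time (i′ , c′)) → c′ < i′ → i < m → i′ < m → In i c → In i′ c′
    In-Cover {i} {c} {i′} {c′} cover c′<i′ i<m i′<m h =
      let (j , e , Fj) = In-node i c i<m h
          j′ = encode m c′<i′ i′<m
          e′ = decode-encode m c′<i′ i′<m
      in  subst (T ∘ truth F) (sym (trans (cell-node c′ i′<m) (node-decode m j′ e′)))
            (up j j′ (subst₂ (λ x y → Cover (time x) (time y)) (sym e) (sym e′) cover) Fj)

    In-< : ∀ i c → i < m → In i c → c < i
    In-< i c i<m h = let (j , e , _) = In-node i c i<m h in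
      subst₂ _<_ (cong proj₂ e) (cong proj₁ e) (proj₁ (decode-bounds m j))

    In-top : ∀ i c → m ≤ i → In i c
    In-top i c m≤i = subst (T ∘ truth F) (sym (cell-top c m≤i)) _

    In-up : ∀ i c → In i c → In (suc i) c
    In-up i c h = split (m ≤? suc i)
      where
      split : Dec (m ≤ suc i) → In (suc i) c
      split (yes m≤1+i) = In-top (suc i) c m≤1+i
      split (no  m≰1+i) = In-Cover {i} {c} (inj₁ (refl , refl)) (m<n⇒m<1+n (In-< i c i<m h)) i<m (≰⇒> m≰1+i) h
        where
        i<m : i < m
        i<m = <-trans (n<1+n i) (≰⇒> m≰1+i)

    In-left : ∀ i c → In i (suc c) → In i c
    In-left i c h = split (m ≤? i)
      where
      split : Dec (m ≤ i) → In i c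
      split (yes m≤i) = In-top i c m≤i
      split (no  m≰i) = In-Cover {i} {suc c} {i} {c} (inj₂ (cong suc (+-suc i c) , refl))
        (<-trans (n<1+n c) (In-< i (suc c) (≰⇒> m≰i) h)) (≰⇒> m≰i) (≰⇒> m≰i) h

    ¬In-0 : ∀ c → ¬ In 0 c
    ¬In-0 c h with In-< 0 c (s≤s z≤n) h
    ... | ()

    Z : ℕ → ℕ → Bool
    Z t c = truth F (N t c)

    Z-up : ∀ t c → T (Z t c) → T (Z (suc t) c)
    Z-up t c h with t ≤? c
    ... | yes t≤c = contradiction (subst (λ i → In i c) (m≤n⇒m∸n≡0 (m≤n⇒m≤1+n t≤c)) h) (¬In-0 c)
    ... | no  t≰c = subst (λ i → In i c) (sym (+-∸-assoc 1 (≰⇒> t≰c))) (In-up (t ∸ suc c) c h)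

    filter⇒ballot : ∃ λ b → Ballot b × Represents n N F b
    filter⇒ballot = b , record { path = path ; balanced = balanced ; highs≤m = highs≤m } , represents-truth n N F {b} h
      where
      walk = grid⇒path Z (λ c → ¬In-0 c) Z-up (λ t c → In-left (t ∸ suc c) c)
      b = proj₁ walk
      path = proj₁ (proj₂ walk)
      h = proj₂ (proj₂ walk)
      balanced : ∀ t → t ≤ n → b t + b t ≤ t
      balanced t t≤n = at (b t) refl
        where
        at : ∀ s → b t ≡ s → s + s ≤ t
        at zero    e = z≤n
        at (suc c) e = subst (suc c + suc c ≤_) i+1+c≡t (+-monoˡ-≤ (suc c) (c<i (m ≤? i)))
          where
          i = t ∸ suc c
          i+1+c≡t : i + suc c ≡ t
          i+1+c≡t = m∸n+n≡m (subst (_≤ t) e (IsPath.b≤ path t))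
          c<i : Dec (m ≤ i) → c < i
          c<i (no m≰i)  = In-< i c (≰⇒> m≰i) (proj₁ (h t c) (≤-reflexive (sym e)))
          -- This cell is `top` and gives no information; the bound comes from t ≤ n ≤ 2m instead.
          c<i (yes m≤i) = ≤-trans (+-cancelˡ-≤ m (suc c) m (≤-trans (+-monoˡ-≤ (suc c) m≤i)
            (≤-trans (≤-reflexive i+1+c≡t) (≤-trans t≤n n≤m+m)))) m≤i
      highs≤m : ∀ t → t ≤ n → t ≤ b t + m
      highs≤m t t≤n = ≤-trans (m≤n+m∸n t (suc (b t))) (subst (_≤ b t + m) (+-suc (b t) i) (+-monoʳ-≤ (b t) i<m))
        where
        i = t ∸ suc (b t)
        i<m : i < m
        i<m = ≰⇒> λ m≤i → <-irrefl refl (proj₂ (h t (b t)) (In-top i (b t) m≤i))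

  ballot-next : ∀ {b} → Ballot b → ∀ t → t < n → ∃ λ x → x < n × Letter b t x
  ballot-next {b} ballot t t<n with IsPath.step (Ballot.path ballot) t
  ... | inj₁ e =
    let (x , x<n , h) = high-exists i i+i<n in x , x<n , high i b+i≡t e h
    where
    open Ballot ballot
    i = t ∸ b t
    b+i≡t : b t + i ≡ t
    b+i≡t = m+[n∸m]≡n (IsPath.b≤ path t)
    i<m : i < m
    i<m = +-cancelˡ-≤ (b t) (suc i) m (subst₂ _≤_ (trans (cong suc (sym b+i≡t)) (sym (+-suc (b t) i)))
      (cong (_+ m) e) (highs≤m (suc t) t<n))
    i+i<n : i + i < n
    i+i<n = <-≤-trans (s≤s (<m⇒double i<m)) (≤-reflexive (m+[n∸m]≡n {1} (≤-trans (s≤s z≤n) t<n)))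
  ... | inj₂ e = b t + b t , <-trans (n<1+n _) <n , low e (valley refl <n)
    where
    -- Balance after the low step leaves room for the peak that follows the valley at position 2 (b
    -- t).
    <n : suc (b t + b t) < n
    <n = ≤-trans (subst (λ s → s ≤ suc t) (trans (cong₂ _+_ e e) (cong suc (+-suc (b t) (b t))))
      (Ballot.balanced ballot (suc t) t<n)) t<n

  module Order {b : ℕ → ℕ} (ballot : Ballot b) (σ : Permutation′ n) (letter : Spells b σ) where
    open Ballot ballot

    position-time : Fin n → ℕ
    position-time x = toℕ (F.opposite (σ ⟨$⟩ʳ x))

    time<n : ∀ x → position-time x < n
    time<n x = F.toℕ<n (F.opposite (σ ⟨$⟩ʳ x))

    time-val : ∀ x y → position-time x < position-time y → val σ y < val σ x
    time-val x y = opposite-<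

    low-low : ∀ {i j x y} → Low i (toℕ x) → Low j (toℕ y) → i < j → position-time x < position-time y
    low-low {x = x} {y} l l′ i<j = ≰⇒> λ y≤x →
      after (letter y) (letter⇒outside path y≤x (time<n x) (letter x))
      where
      after : Letter b (position-time y) (toℕ y) → ¬ Outside (b (position-time y)) (position-time y) (toℕ x)
      after (low _ l″)      (out , _) = <⇒≱ i<j (subst (_≤ _) (Low-injective l″ l′) (out _ l))
      after (high _ _ _ h″) _         = ¬Low-High l′ h″

    high-high : ∀ {i j x y} → High i (toℕ x) → High j (toℕ y) → i < j → position-time x < position-time y
    high-high {x = x} {y} h h′ i<j = ≰⇒> λ y≤x →
      after (letter y) (letter⇒outside path y≤x (time<n x) (letter x))
      where
      after : Letter b (position-time y) (toℕ y) → ¬ Outside (b (position-time y)) (position-time y) (toℕ x)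
      after (low _ l″)      _         = ¬Low-High l″ h′
      after (high k f _ h″) (_ , out) with High-injective h″ h′
      ... | refl = <⇒≱ i<j (+-cancelˡ-≤ (b (position-time y)) _ _ (subst (_≤ b (position-time y) + _) (sym f) (out _ h)))

    -- If the low letter j is read at time t, then b t = j and balance at t + 1 gives t - j > j, so
    -- the high letters 0, ..., j have been read.
    high-low : ∀ {i j x y} → High i (toℕ x) → Low j (toℕ y) → i ≤ j → position-time x < position-time y
    high-low {i} {j} {x} {y} h l i≤j = ≰⇒> λ y≤x →
      after (letter y) (letter⇒outside path y≤x (time<n x) (letter x))
      where
      t = position-time y
      after : Letter b t (toℕ y) → ¬ Outside (b t) t (toℕ x)
      after (high _ _ _ h″) _         = ¬Low-High l h″
      after (low e l″)      (_ , out) with Low-injective l″ l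
      ... | refl = <⇒≱ (s≤s⁻¹ (subst (_≤ suc t) (trans (cong₂ _+_ e e) (cong suc (+-suc (b t) (b t)))) (balanced (suc t) (time<n y))))
        (≤-trans (out i h) (+-monoʳ-≤ (b t) i≤j))

    alternating : Alternating σ
    alternating x y y≡1+x = even , odd
      where
      even : toℕ x % 2 ≡ 0 → val σ x < val σ y
      even x%2≡0 with label (toℕ x) (F.toℕ<n x)
      ... | inj₁ (i , l@(valley e <n)) = time-val y x (high-low {x = y} {x} (peak (trans y≡1+x (cong suc e)) (F.toℕ<n y)) l ≤-refl)
      ... | inj₂ (i , peak e _) = contradiction (trans (sym x%2≡0) (trans (cong (_% 2) e) (double%2 1 i))) (λ ())
      ... | inj₂ (i , last _ ≡n) = contradiction (trans y≡1+x ≡n) (<⇒≢ (F.toℕ<n y))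
      odd : toℕ x % 2 ≡ 1 → val σ y < val σ x
      odd x%2≡1 with label (toℕ x) (F.toℕ<n x)
      ... | inj₁ (i , valley e _) = contradiction (trans (sym x%2≡1) (trans (cong (_% 2) e) (double%2 0 i))) (λ ())
      ... | inj₂ (i , last _ ≡n) = contradiction (trans y≡1+x ≡n) (<⇒≢ (F.toℕ<n y))
      ... | inj₂ (i , h@(peak e _)) = time-val x y before
        where
        y≡ : toℕ y ≡ suc i + suc i
        y≡ = trans y≡1+x (trans (cong suc e) (cong suc (sym (+-suc i i))))
        before : position-time x < position-time y
        -- A peak is followed by the next valley or, at the end of a permutation of odd length, by
        -- the next member of the high chain.
        before with suc (toℕ y) <? n
        ... | yes <n = high-low {x = x} {y} h (valley y≡ <n) (n≤1+n i)
        ... | no  ≮n = high-high {x = x} {y} h (last y≡ (≤-antisym (F.toℕ<n y) (≮⇒≥ ≮n))) ≤-refl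

    low-index : ∀ {i j x y} → Low i x → Low j y → x < y → i < j
    low-index (valley refl _) (valley refl _) x<y = double-< x<y

    high-index : ∀ {i j x y} → High i x → High j y → x < y → y < n → i < j
    high-index (peak refl _) (peak refl _) x<y _ = double-< (s≤s⁻¹ x<y)
    high-index (peak refl _) (last refl _) x<y _ = double-< (<-trans (n<1+n _) x<y)
    high-index (last _ ≡n)   _             x<y y<n = contradiction (subst (_≤ _) ≡n x<y) (<⇒≱ y<n)

    -- Two of any three positions lie on the same chain, and along each chain the values decrease.
    avoid123 : ¬ Contains123 σ
    avoid123 (x , y , z , x<y , y<z , σx<σy , σy<σz) =
      clash (label (toℕ x) (F.toℕ<n x)) (label (toℕ y) (F.toℕ<n y)) (label (toℕ z) (F.toℕ<n z))
      where
      Label : ℕ → Set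
      Label x = (∃ λ i → Low i x) ⊎ (∃ λ i → High i x)
      low-clash : ∀ {u w i j} → u F.< w → val σ u < val σ w → Low i (toℕ u) → ¬ Low j (toℕ w)
      low-clash {u} {w} u<w σu<σw l l′ = <-asym σu<σw (time-val u w (low-low {x = u} {w} l l′ (low-index l l′ u<w)))
      high-clash : ∀ {u w i j} → u F.< w → val σ u < val σ w → High i (toℕ u) → ¬ High j (toℕ w)
      high-clash {u} {w} u<w σu<σw h h′ =
        <-asym σu<σw (time-val u w (high-high {x = u} {w} h h′ (high-index h h′ u<w (F.toℕ<n w))))
      x<z = <-trans x<y y<z
      σx<σz = <-trans σx<σy σy<σz
      clash : Label (toℕ x) → Label (toℕ y) → Label (toℕ z) → ⊥
      clash (inj₁ (_ , l)) (inj₁ (_ , l′)) _               = low-clash {x} {y} x<y σx<σy l l′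
      clash (inj₁ (_ , l)) (inj₂ _)        (inj₁ (_ , l′)) = low-clash {x} {z} x<z σx<σz l l′
      clash (inj₁ _)       (inj₂ (_ , h))  (inj₂ (_ , h′)) = high-clash {y} {z} y<z σy<σz h h′
      clash (inj₂ (_ , h)) (inj₂ (_ , h′)) _               = high-clash {x} {y} x<y σx<σy h h′
      clash (inj₂ (_ , h)) (inj₁ _)        (inj₂ (_ , h′)) = high-clash {x} {z} x<z σx<σz h h′
      clash (inj₂ _)       (inj₁ (_ , l))  (inj₁ (_ , l′)) = low-clash {y} {z} y<z σy<σz l l′

  Vertex : Region (Matrix n)
  Vertex = Vert-alt-123 n

  letters⇒vertex : ∀ {F b} → Ballot b → Represents n N F b → (σ : Permutation′ n) → Spells b σ →
                   Vertex (point 1ℚ (χ ∘ F))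
  letters⇒vertex {F} {b} ballot rep σ letter =
    σ , Order.alternating ballot σ letter , Order.avoid123 ballot σ letter , letters⇒permMatrix {F} {b} σ rep letter

  filter⇒vertex : ∀ F → Filter F → Vertex (point 1ℚ (χ ∘ F))
  filter⇒vertex F up =
    let (b , ballot , rep) = filter⇒ballot up
        (τ , letter) = path⇒permutation (Ballot.path ballot) (ballot-next ballot)
    -- `τ` sends times to positions, so the permutation goes back from a position to its time and
    -- reverses that into a value.
    in  letters⇒vertex {F} {b} ballot rep (flip τ ∘ₚ reverse) (spells τ letter)
    where
    spells : ∀ {b} (τ : Permutation′ n) → (∀ y → Letter b (toℕ y) (toℕ (τ ⟨$⟩ʳ y))) → Spells b (flip τ ∘ₚ reverse)
    spells {b} τ letter x = subst₂ (λ y z → Letter b (toℕ y) (toℕ z))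
      (sym (F.opposite-involutive (τ ⟨$⟩ˡ x))) (inverseʳ τ) (letter (τ ⟨$⟩ˡ x))

  when : Permutation′ n → Fin n → ℕ
  when σ x = toℕ (F.opposite (σ ⟨$⟩ʳ x))

  schedule : Permutation′ n → ℕ → ℕ
  schedule σ = row (λ y → σ ⟨$⟩ˡ F.opposite y)

  schedule-when : ∀ σ x → schedule σ (when σ x) ≡ toℕ x
  schedule-when σ x = trans (row-toℕ (λ y → σ ⟨$⟩ˡ F.opposite y) (F.opposite (σ ⟨$⟩ʳ x)))
    (cong toℕ (trans (cong (σ ⟨$⟩ˡ_) (F.opposite-involutive (σ ⟨$⟩ʳ x))) (inverseˡ σ)))

  scheduled : ∀ σ {t} → t < n → ∃ λ x → when σ x ≡ t
  scheduled σ t<n = let (v , e) = time-position t<n in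
    σ ⟨$⟩ˡ v , trans (cong (toℕ ∘ F.opposite) (inverseʳ σ)) e

  schedule-injective : ∀ σ {t t′} → t < n → t′ < n → schedule σ t ≡ schedule σ t′ → t ≡ t′
  schedule-injective σ t<n t′<n e with scheduled σ t<n | scheduled σ t′<n
  ... | x , refl | y , refl = cong (when σ)
    (F.toℕ-injective (trans (sym (schedule-when σ x)) (trans e (schedule-when σ y))))

  module Decreasing (σ : Permutation′ n) (alternating : Alternating σ) (avoid123 : ¬ Contains123 σ) where

    ascent : ∀ {i} x y → toℕ x ≡ i + i → toℕ y ≡ suc (toℕ x) → val σ x < val σ y
    ascent {i} x y x≡ y≡ = proj₁ (alternating x y y≡) (trans (cong (_% 2) x≡) (double%2 0 i))

    distinct : ∀ {x y : Fin n} → x F.< y → val σ x ≢ val σ y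
    distinct x<y e = <⇒≢ x<y (cong toℕ (permutation-injective σ e))

    -- An ascent of two valleys continues to the peak after the second one, and an ascent of
    -- two peaks starts at the valley before the first one.
    low-decreasing : ∀ {i j x y} → Low i (toℕ x) → Low j (toℕ y) → x F.< y → val σ y < val σ x
    low-decreasing {j = j} {x} {y} _ (valley y≡ <n) x<y = ≤∧≢⇒< (≮⇒≥ rising) (distinct x<y ∘ sym)
      where
      z = fromℕ< <n
      z≡ : toℕ z ≡ suc (toℕ y)
      z≡ = F.toℕ-fromℕ< <n
      rising : ¬ val σ x < val σ y
      rising σx<σy = avoid123 (x , y , z , x<y , ≤-reflexive (sym z≡) , σx<σy , ascent {j} y z y≡ z≡)

    high-decreasing : ∀ {i j x y} → High i (toℕ x) → High j (toℕ y) → x F.< y → val σ y < val σ x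
    high-decreasing {y = y} (last _ ≡n) _ x<y = contradiction (subst (_≤ toℕ y) ≡n x<y) (<⇒≱ (F.toℕ<n y))
    high-decreasing {i} {x = x} {y} (peak x≡ <n) _ x<y = ≤∧≢⇒< (≮⇒≥ rising) (distinct x<y ∘ sym)
      where
      w<n : i + i < n
      w<n = <-trans (subst (i + i <_) (sym x≡) (n<1+n (i + i))) <n
      w = fromℕ< w<n
      w≡ : toℕ w ≡ i + i
      w≡ = F.toℕ-fromℕ< w<n
      x≡1+w : toℕ x ≡ suc (toℕ w)
      x≡1+w = trans x≡ (cong suc (sym w≡))
      rising : ¬ val σ x < val σ y
      rising σx<σy = avoid123 (w , x , y , ≤-reflexive (sym x≡1+w) , x<y , ascent {i} w x w≡ x≡1+w , σx<σy)

    next : ∀ t s → t < n → s ≤ t → (∀ t′ → t′ < t → Inside s t (schedule σ t′)) →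
           (∀ t′ → t ≤ t′ → t′ < n → Outside s t (schedule σ t′)) →
           Low s (schedule σ t) ⊎ High (t ∸ s) (schedule σ t)
    next t s t<n s≤t inside outside with scheduled σ t<n
    ... | x , refl rewrite schedule-when σ x = decide (label (toℕ x) (F.toℕ<n x))
      where
      s+[t∸s]≡t : s + (t ∸ s) ≡ t
      s+[t∸s]≡t = m+[n∸m]≡n s≤t
      out : Outside s t (toℕ x)
      out = subst (Outside s t) (schedule-when σ x) (outside t ≤-refl t<n)
      earlier : ∀ y → val σ x < val σ y → Inside s t (toℕ y)
      earlier y σx<σy = subst (Inside s t) (schedule-when σ y) (inside (when σ y) (opposite-anti σx<σy))
      decide : (∃ λ i → Low i (toℕ x)) ⊎ (∃ λ i → High i (toℕ x)) → Low s (toℕ x) ⊎ High (t ∸ s) (toℕ x)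
      decide (inj₁ (i , l@(valley x≡ <n))) with s ≟ i
      ... | yes refl = inj₁ l
      ... | no s≢i = ⊥-elim (late (earlier y (low-decreasing {x = y} {x} low-y l y<x)))
        where
        s<i : s < i
        s<i = ≤∧≢⇒< (proj₁ out i l) s≢i
        y<x′ : s + s < toℕ x
        y<x′ = subst (s + s <_) (sym x≡) (+-mono-< s<i s<i)
        y = fromℕ< (<-trans y<x′ (F.toℕ<n x))
        y≡ : toℕ y ≡ s + s
        y≡ = F.toℕ-fromℕ< _
        y<x : y F.< x
        y<x = subst (_< toℕ x) (sym y≡) y<x′
        low-y : Low s (toℕ y)
        low-y = valley y≡ (≤-trans (s≤s y<x) (<⇒≤ <n))
        late : ¬ Inside s t (toℕ y)
        late (inj₁ (j , j<s , l′)) = <⇒≢ j<s (Low-injective l′ low-y)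
        late (inj₂ (_ , _ , h))    = ¬Low-High low-y h
      decide (inj₂ (i , h)) with t ∸ s ≟ i
      ... | yes refl = inj₂ h
      ... | no a≢i = ⊥-elim (late (earlier y (high-decreasing {x = y} {x} high-y h y<x)))
        where
        a = t ∸ s
        a<i : a < i
        a<i = ≤∧≢⇒< (+-cancelˡ-≤ s a i (subst (_≤ s + i) (sym s+[t∸s]≡t) (proj₂ out i h))) a≢i
        double≤ : High i (toℕ x) → i + i ≤ toℕ x
        double≤ (peak e _) = ≤-trans (n≤1+n (i + i)) (≤-reflexive (sym e))
        double≤ (last e _) = ≤-reflexive (sym e)
        y<x′ : suc (a + a) < toℕ x
        y<x′ = ≤-trans (≤-trans (≤-reflexive (cong suc (sym (+-suc a a)))) (+-mono-≤ a<i a<i)) (double≤ h)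
        y = fromℕ< (<-trans y<x′ (F.toℕ<n x))
        y≡ : toℕ y ≡ suc (a + a)
        y≡ = F.toℕ-fromℕ< _
        y<x : y F.< x
        y<x = subst (_< toℕ x) (sym y≡) y<x′
        high-y : High a (toℕ y)
        high-y = peak y≡ (F.toℕ<n y)
        late : ¬ Inside s t (toℕ y)
        late (inj₁ (_ , _ , l))        = ¬Low-High l high-y
        late (inj₂ (j , s+j<t , h′)) = <⇒≢ s+j<t (trans (cong (s +_) (High-injective h′ high-y)) s+[t∸s]≡t)

    b : ℕ → ℕ
    b = lowCount (schedule σ)

    path : IsPath b
    path = lowCount-path (schedule σ)

    spelled : ∀ t → t < n → Letter b t (schedule σ t)
    spelled = letters (schedule σ) (schedule-injective σ) next

    spells : Spells b σ
    spells x = subst (Letter b (when σ x)) (schedule-when σ x) (spelled (when σ x) (F.toℕ<n (F.opposite (σ ⟨$⟩ʳ x))))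

    -- At a low step the peak after the valley has the same index b t and a larger value, so it is
    -- among the first t letters; hence more than b t of these are high.
    balanced : ∀ t → t ≤ n → b t + b t ≤ t
    balanced zero    _   = z≤n
    balanced (suc t) t<n = advance (spelled t t<n)
      where
      advance : Letter b t (schedule σ t) → b (suc t) + b (suc t) ≤ suc t
      advance (high _ _ e _) rewrite e = ≤-trans (balanced t (<⇒≤ t<n)) (n≤1+n t)
      advance (low e l) with scheduled σ t<n
      ... | x , refl rewrite e | +-suc (b t) (b t) = s≤s (follows (subst (Low (b t)) (schedule-when σ x) l))
        where
        follows : Low (b t) (toℕ x) → b t + b t < t
        follows (valley x≡ <n) = settle (subst (Inside (b t) t) (schedule-when σ y)
            (letter⇒inside path (opposite-anti (ascent {b t} x y x≡ y≡)) (spelled (when σ y) (F.toℕ<n (F.opposite (σ ⟨$⟩ʳ y))))))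
          where
          y = fromℕ< <n
          y≡ : toℕ y ≡ suc (toℕ x)
          y≡ = F.toℕ-fromℕ< <n
          high-y : High (b t) (toℕ y)
          high-y = peak (trans y≡ (cong suc x≡)) (F.toℕ<n y)
          settle : Inside (b t) t (toℕ y) → b t + b t < t
          settle (inj₁ (_ , _ , l′))     = contradiction high-y (¬Low-High l′)
          settle (inj₂ (j , b+j<t , h)) = subst (λ i → b t + i < t) (High-injective h high-y) b+j<t

    highs≤m : ∀ t → t ≤ n → t ≤ b t + m
    highs≤m zero    _   = z≤n
    highs≤m (suc t) t<n = advance (spelled t t<n)
      where
      advance : Letter b t (schedule σ t) → suc t ≤ b (suc t) + m
      advance (low e _)      rewrite e = s≤s (highs≤m t (<⇒≤ t<n))
      advance (high i f e h) rewrite e = subst (_< b t + m) f (+-monoʳ-< (b t) (double<n⇒<m (High⇒< h)))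

    ballot : Ballot b
    ballot = record { path = path ; balanced = balanced ; highs≤m = highs≤m }

  vertex⇒filter : ∀ M → Vertex M → ∃ λ F → Filter F × M ≐ point 1ℚ (χ ∘ F)
  vertex⇒filter M (σ , alternating , avoid123 , M≐) =
    below b ∘ time ∘ decode m ,
    (λ i j → below-Cover path (time (decode m i)) (time (decode m j))) ,
    λ x → trans (M≐ x) (sym (letters⇒permMatrix {below b ∘ time ∘ decode m} {b} σ (ballot-represents ballot) spells x))
    where open Decreasing σ alternating avoid123

  -- Low and high letters occupy different positions here, so no induction on c is needed: the
  -- entries at the position of the high letter i telescope from `top` at time 0 to the node (i, c)
  -- at time i + c + 1.
  recover : ∀ (A : ℚ → Set) → (∀ {p q} → A p → A q → A (p ℚ.- q)) →
            ∀ v → A (v bot) → A (v top) → (∀ x → A (entry v x)) → ∀ j → A (v (elt j))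
  recover A A-sub v A-bot A-top A-entry j =
    subst A (cong v (trans high≡N (N-decode j refl))) (A-high (suc (i + c)) 1+i+c≤n)
    where
    i = proj₁ (decode m j)
    c = proj₂ (decode m j)
    c<i : c < i
    c<i = proj₁ (decode-bounds m j)
    i+i<n : i + i < n
    i+i<n = positive n (<-≤-trans (+-mono-< c<i c<i) (<m⇒double (proj₂ (decode-bounds m j)))) (<m⇒double (proj₂ (decode-bounds m j)))
      where
      positive : ∀ n {k l} → k < n ∸ 1 → l ≤ n ∸ 1 → l < n
      positive zero    () _
      positive (suc n) _  l≤n = s≤s l≤n
    1+i+c≤n : suc (i + c) ≤ n
    1+i+c≤n = ≤-trans (s≤s (+-monoʳ-≤ i (<⇒≤ c<i))) i+i<n
    high≡N : highNode N (suc (i + c)) i ≡ N (suc (i + c)) c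
    high≡N with suc (i + c) ≤? i
    ... | yes ≤i = contradiction (m≤m+n i c) (<⇒≱ ≤i)
    ... | no  _  = cong (N (suc (i + c))) (m+n∸m≡n i c)
    x : Fin n
    x = fromℕ< (proj₁ (proj₂ (high-exists i i+i<n)))
    high-x : High i (toℕ x)
    high-x = subst (High i) (sym (F.toℕ-fromℕ< _)) (proj₂ (proj₂ (high-exists i i+i<n)))
    A-difference : ∀ w → A ((v bot ℚ.- v bot) ℚ.+
      (v (highNode N (toℕ (F.opposite w)) i) ℚ.- v (highNode N (suc (toℕ (F.opposite w))) i)))
    A-difference w with label (toℕ x) (F.toℕ<n x) | A-entry (x , w)
    ... | inj₁ (_ , l) | _ = contradiction high-x (¬Low-High l)
    ... | inj₂ (_ , h) | a with High-injective h high-x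
    ...   | refl = a
    A-high : ∀ t → t ≤ n → A (v (highNode N t i))
    A-high zero    _   = A-top
    A-high (suc t) t<n with time-position t<n
    ... | w , refl = subst A (lemma (v bot) (v (highNode N t i)) (v (highNode N (suc t) i)))
      (A-sub (A-high t (<⇒≤ t<n)) (A-sub (A-difference w) (A-sub A-bot A-bot)))
      where
      lemma : ∀ b h h′ → h ℚ.- (((b ℚ.- b) ℚ.+ (h ℚ.- h′)) ℚ.- (b ℚ.- b)) ≡ h′
      lemma = ℚ-Tactic.solve-∀ ℚ-ring

  -- In the coordinates (i, c) this is i - c, which runs from 1 to m - 1; hence the dilation factor
  -- `m`.
  rank : Fin d → ℕ
  rank j = gridRank 0 (time (decode m j))

  rank-suc : ∀ {i j} → Relation i j → rank j ≡ suc (rank i)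
  rank-suc {i} {j} = gridRank-suc 0 (time (decode m j)) (s≤s (+-monoˡ-≤ (proj₂ (decode m i)) (<⇒≤ (proj₁ (decode-bounds m i)))))

  rank<k : ∀ j → rank j < m
  rank<k j = ≤-<-trans (m≤n+o⇒m∸n≤o (i + c) (c + c) (≤-trans (≤-reflexive (+-comm i c))
      (+-monoˡ-≤ i (m≤m+n c c)))) (proj₂ (decode-bounds m j))
    where
    i = proj₁ (decode m j)
    c = proj₂ (decode m j)

  lower : ∀ j → rank j ≡ 1 ⊎ ∃ λ i → Relation i j
  lower j = go (decode m j) refl
    where
    go : ∀ x → decode m j ≡ x → rank j ≡ 1 ⊎ ∃ λ i → Relation i j
    go (i , c) e with subst (λ (i , c) → c < i × i < m) e (decode-bounds m j)
    ... | s≤s {n = i′} c≤i′ , i<m with c <? i′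
    ...   | yes c<i′ = inj₂ (encode m c<i′ (<-trans (n<1+n i′) i<m) ,
      subst₂ (λ x y → Cover (time x) (time y)) (sym (decode-encode m c<i′ (<-trans (n<1+n i′) i<m))) (sym e) (inj₁ (refl , refl)))
    ...   | no  c≮i′ rewrite ≤-antisym c≤i′ (≮⇒≥ c≮i′) = inj₁ (trans (cong (gridRank 0 ∘ time) e)
      (gridRank-unique 0 (suc (suc i′ + i′)) i′ refl))

  upper : ∀ j → suc (rank j) ≡ m ⊎ ∃ λ i → Relation j i
  upper j = go (decode m j) refl
    where
    go : ∀ x → decode m j ≡ x → suc (rank j) ≡ m ⊎ ∃ λ i → Relation j i
    go (i , c) e with suc i <? m | subst (λ (i , c) → c < i × i < m) e (decode-bounds m j)
    go (i , c) e | yes 1+i<m | c<i , _ = inj₂ (encode m (m<n⇒m<1+n c<i) 1+i<m ,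
      subst₂ (λ x y → Cover (time x) (time y)) (sym e) (sym (decode-encode m (m<n⇒m<1+n c<i) 1+i<m)) (inj₁ (refl , refl)))
    go (i , zero) e | no 1+i≮m | _ , i<m = inj₁ (trans (cong (suc ∘ gridRank 0 ∘ time) e)
      (trans (cong suc (+-identityʳ i)) (≤-antisym i<m (≮⇒≥ 1+i≮m))))
    go (i , suc c) e | no _ | c<i , i<m = inj₂ (encode m (<-trans (n<1+n c) c<i) i<m ,
      subst₂ (λ x y → Cover (time x) (time y)) (sym e) (sym (decode-encode m (<-trans (n<1+n c) c<i) i<m))
        (inj₂ (cong suc (+-suc i c) , refl)))

  model : GradedModel Vertex
  model = record
    { k             = m
    ; 1≤k           = s≤s z≤n
    ; entries       = entries
    ; rank          = rank
    ; R             = Relation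
    ; R?            = λ i j → Cover? (time (decode m i)) (time (decode m j))
    ; rank-suc      = λ {i} {j} → rank-suc {i} {j}
    ; rank<k        = rank<k
    ; lower         = lower
    ; upper         = upper
    ; filter⇒vertex = filter⇒vertex
    ; vertex⇒filter = vertex⇒filter
    ; recover       = recover
    }

theorem6p2 : (n : ℕ) → IsGorenstein (B-132-312 n) × IsGorenstein (B̃-123 n)
theorem6p2 n = isGorenstein (Extremal.model n) , isGorenstein (Alternate.model n)
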